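{- Let $p>3$ be a prime. Then $$\sum_{n=0}^{p-1}\frac{Q_n}{(-6)^n}\equiv\sum_{n=0}^{p-1}\frac{Q_n}{(-12)^n}\equiv\begin{cases}2u\pmod p&\text{if }3\mid p-1,\ p=u^2+3v^2\text{ with integers }u,v\text{ and }3\mid u-1,\\0\pmod p&\text{if }p\equiv2\pmod3.\end{cases}$$
   Context: $f_n=\sum_{k=0}^n\binom nk^3$ and $Q_n=\sum_{k=0}^n\binom nk(-8)^{n-k}f_k$. Congruences are in the ring of rationals with denominator prime to $p$. -}

module Defs where

open import Data.Nat as ℕ using (ℕ; zero; suc)
open import Data.Nat.Combinatorics using (_C_)
open import Data.Integer as ℤ using (ℤ; +_)
open import Data.Rational as ℚ using (ℚ; ↥_; ↧_)
open import Data.Product using (_×_)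
open import Data.Integer.Divisibility using () renaming (_∣_ to _∣ℤ_)
open import Relation.Nullary using (¬_)

sumℕ : ℕ → (ℕ → ℕ) → ℕ
sumℕ zero    f = f 0
sumℕ (suc n) f = sumℕ n f ℕ.+ f (suc n)

sumℤ : ℕ → (ℕ → ℤ) → ℤ
sumℤ zero    f = f 0
sumℤ (suc n) f = sumℤ n f ℤ.+ f (suc n)

sumℚ : ℕ → (ℕ → ℚ) → ℚ
sumℚ zero    f = f 0
sumℚ (suc n) f = sumℚ n f ℚ.+ f (suc n)

f : ℕ → ℕ
f n = sumℕ n (λ k → (n C k) ℕ.^ 3)

Q : ℕ → ℤ
Q n = sumℤ n (λ k → (+ (n C k)) ℤ.* ((ℤ.- (+ 8)) ℤ.^ (n ℕ.∸ k)) ℤ.* (+ (f k)))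

powℚ : ℚ → ℕ → ℚ
powℚ x zero    = ℚ.1ℚ
powℚ x (suc n) = powℚ x n ℚ.* x

inv-6 : ℚ
inv-6 = ℚ.- ((+ 1) ℚ./ 6)

inv-12 : ℚ
inv-12 = ℚ.- ((+ 1) ℚ./ 12)

S6 : ℕ → ℚ
S6 p = sumℚ (p ℕ.∸ 1) (λ n → (Q n ℚ./ 1) ℚ.* powℚ inv-6 n)

S12 : ℕ → ℚ
S12 p = sumℚ (p ℕ.∸ 1) (λ n → (Q n ℚ./ 1) ℚ.* powℚ inv-12 n)

-- Congruence modulo p in the ring ℤ_(p) of rationals with denominator prime to p:
-- x ≡ y (mod p) iff x - y (in lowest terms) has numerator divisible by p
-- and denominator not divisible by p.
_≡_[modℚ_] : ℚ → ℚ → ℕ → Set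
x ≡ y [modℚ p ] = ((+ p) ∣ℤ (↥ (x ℚ.- y))) × (¬ ((+ p) ∣ℤ (↧ (x ℚ.- y))))

{-# OPTIONS --safe #-}
-- Summing over n first and using ∑_{i ≤ L} C(K+i, K) yⁱ ≡ (1 - y)ᴸ for K + L = p - 1, both sums reduce
-- to F(t) = ∑_{k<p} f_k tᵏ modulo p, at t = 1/2 and at t = -1/4.  MacMahon's formula for f_n and the same
-- summation give F(t) ≡ ∑_{3j<p} T_j t²ʲ (1 - 2t)^(p-1-3j) with T_j = (3j)!/(j!)³.  At t = 1/2 only
-- 3j = p - 1 survives.  At t = -1/4 the sum is a Legendre polynomial of degree ⌊p/3⌋ at 0, evaluated by
-- summing one polynomial over all residues in two ways.  Both values are 0 for p ≡ 2 (mod 3) and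
-- C(3m, m) for p = 6m + 1.  Finally, let α, β, γ be the sums of the quadratic character of 1 - x over the
-- three cosets of the nonzero cubes.  Power sums show 3α ≡ -1 - C(3m, m), while α + β + γ = -1 and
-- α² + β² + γ² = p - 2m (the Jacobi sum α + βω + γω² has norm p).  Hence p = a² + 3b² with
-- 2a = 3α + 1, and a = -u by uniqueness of the representation and reduction modulo 3.
module Submission where

open import Defs
open import Data.Nat as ℕ using (ℕ; zero; suc; _>_; _%_; _∸_; z≤n; s≤s)
open import Data.Nat.Primality using (Prime; euclidsLemma; prime⇒irreducible; prime⇒nonTrivial; ¬prime[0])
open import Data.Integer as ℤ using (ℤ; +_; -[1+_]; 0ℤ; 1ℤ; -1ℤ; _+_; _*_; _-_; -_; _^_)
open import Data.Integer.Divisibility using () renaming (_∣_ to _∣ℤ_)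
open import Data.Rational as ℚ using (ℚ; mkℚ; ↥_; ↧_)
open import Data.Product using (_×_; _,_; ∃; proj₁; proj₂)
open import Relation.Binary.PropositionalEquality using (_≡_; _≢_; refl; sym; trans; cong; cong₂; subst; module ≡-Reasoning)
open import Data.Empty using (⊥; ⊥-elim; ⊥-elim-irr)
import Data.Integer.DivMod as ℤ
open import Data.Integer.Divisibility.Signed using (divides; ∣⇒∣ᵤ; ∣ᵤ⇒∣; _∣?_) renaming (_∣_ to _∣ₛ_)
import Data.Integer.Properties as ℤ
open import Data.Integer.Tactic.RingSolver using (solve-∀)
open import Data.Nat.Combinatorics using (_C_; nCn≡1; nCk≡nC[n∸k]; k>n⇒nCk≡0; nCk+nC[k+1]≡[n+1]C[k+1])
import Data.Nat.Divisibility as ℕ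
import Data.Nat.DivMod as ℕ
open import Data.Nat.Induction using (<-rec)
import Data.Nat.Properties as ℕ
import Data.Nat.Tactic.RingSolver as ℕ-Solver
import Data.Rational.Properties as ℚ
open import Data.Rational.Unnormalised as ℚᵘ using (mkℚᵘ; *≡*)
import Data.Rational.Unnormalised.Properties as ℚᵘ
open import Data.Sum as Sum using (_⊎_; inj₁; inj₂)
open import Relation.Binary using (Setoid; tri<; tri≈; tri>)
import Relation.Binary.Reasoning.Setoid as SetoidReasoning
open import Relation.Nullary using (¬_; Dec; yes; no)
open import Relation.Nullary.Decidable using (map′; ¬?; decidable-stable)

-- Finite sums over 0 ≤ i < n.

-- No cube root of unity is adjoined to the integers. The Jacobi sum is carried by its three integer
-- coordinates, and the cubic character occurs only modulo p, as the power `x ^ ((p - 1)/3)`. The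
-- single analytic tool is the sum of `x ^ e` over all residues, which modulo p is -1 for e = p - 1
-- and 0 for every other e below 2(p - 1); it serves both the Legendre polynomial and the character
-- sums. Such a computation gives a character sum only up to a multiple of p. The exact value comes
-- from a bound: a multiple of p of absolute value at most p - 1 is 0. Hence the pairing of a
-- congruence with two inequalities in the second half. The number (3α + 1)/2 is an integer because
-- α is odd: there are 2m nonzero cubes, x = 1 contributes 0 to α and each other cube contributes a
-- sign. Division is avoided. Ratios of binomial coefficients are recurrences with cleared
-- denominators, an inverse modulo p is a power, and the rational sums are multiplied by a (p -
-- 1)-th power, which is 1 modulo p.

∑ : ℕ → (ℕ → ℤ) → ℤ
∑ zero    g = 0ℤ
∑ (suc n) g = ∑ n g + g n

∑-cong : ∀ n {g h} → (∀ i → i ℕ.< n → g i ≡ h i) → ∑ n g ≡ ∑ n h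
∑-cong zero    eq = refl
∑-cong (suc n) eq = cong₂ _+_ (∑-cong n (λ i i<n → eq i (ℕ.m<n⇒m<1+n i<n))) (eq n (ℕ.n<1+n n))

∑-zero : ∀ n {g} → (∀ i → i ℕ.< n → g i ≡ 0ℤ) → ∑ n g ≡ 0ℤ
∑-zero zero    eq = refl
∑-zero (suc n) eq = cong₂ _+_ (∑-zero n (λ i i<n → eq i (ℕ.m<n⇒m<1+n i<n))) (eq n (ℕ.n<1+n n))

∑-+ : ∀ n g h → ∑ n (λ i → g i + h i) ≡ ∑ n g + ∑ n h
∑-+ zero    g h = refl
∑-+ (suc n) g h = trans (cong (_+ (g n + h n)) (∑-+ n g h)) (interchange (∑ n g) (∑ n h) (g n) (h n))
  where
  interchange : ∀ a b c d → a + b + (c + d) ≡ a + c + (b + d)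
  interchange = solve-∀

∑-*ˡ : ∀ n c g → ∑ n (λ i → c * g i) ≡ c * ∑ n g
∑-*ˡ zero    c g = sym (ℤ.*-zeroʳ c)
∑-*ˡ (suc n) c g = trans (cong (_+ c * g n) (∑-*ˡ n c g)) (sym (ℤ.*-distribˡ-+ c (∑ n g) (g n)))

∑-*ʳ : ∀ n c g → ∑ n (λ i → g i * c) ≡ ∑ n g * c
∑-*ʳ n c g = trans (∑-cong n (λ i _ → ℤ.*-comm (g i) c)) (trans (∑-*ˡ n c g) (ℤ.*-comm c (∑ n g)))

∑-neg : ∀ n g → ∑ n (λ i → - g i) ≡ - ∑ n g
∑-neg zero    g = refl
∑-neg (suc n) g = trans (cong (_- g n) (∑-neg n g)) (sym (ℤ.neg-distrib-+ (∑ n g) (g n)))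

∑-sub : ∀ n g h → ∑ n (λ i → g i - h i) ≡ ∑ n g - ∑ n h
∑-sub n g h = trans (∑-+ n g (λ i → - h i)) (cong (λ z → ∑ n g + z) (∑-neg n h))

∑-swap : ∀ m n (g : ℕ → ℕ → ℤ) → ∑ m (λ i → ∑ n (g i)) ≡ ∑ n (λ j → ∑ m (λ i → g i j))
∑-swap zero    n g = sym (∑-zero n (λ _ _ → refl))
∑-swap (suc m) n g = trans (cong (_+ ∑ n (g m)) (∑-swap m n g)) (sym (∑-+ n (λ j → ∑ m (λ i → g i j)) (g m)))

∑-const : ∀ n c → ∑ n (λ _ → c) ≡ + n * c
∑-const zero    c = sym (ℤ.*-zeroˡ c)
∑-const (suc n) c = trans (cong (_+ c) (∑-const n c)) (collect (+ n) c)
  where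
  collect : ∀ n c → n * c + c ≡ (1ℤ + n) * c
  collect = solve-∀

∑-split : ∀ m n g → ∑ (m ℕ.+ n) g ≡ ∑ m g + ∑ n (λ i → g (m ℕ.+ i))
∑-split m zero    g rewrite ℕ.+-identityʳ m = sym (ℤ.+-identityʳ (∑ m g))
∑-split m (suc n) g rewrite ℕ.+-suc m n =
  trans (cong (_+ g (m ℕ.+ n)) (∑-split m n g)) (ℤ.+-assoc (∑ m g) _ _)

∑-head : ∀ n g → ∑ (suc n) g ≡ g 0 + ∑ n (λ i → g (suc i))
∑-head n g = trans (∑-split 1 n g) (cong (_+ ∑ n (λ i → g (suc i))) (ℤ.+-identityˡ (g 0)))

∑-truncate : ∀ {m n} g → m ℕ.≤ n → (∀ i → m ℕ.≤ i → g i ≡ 0ℤ) → ∑ n g ≡ ∑ m g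
∑-truncate {m} {n} g m≤n eq = begin
  ∑ n g                                        ≡⟨ cong (λ k → ∑ k g) (sym (ℕ.m+[n∸m]≡n m≤n)) ⟩
  ∑ (m ℕ.+ (n ∸ m)) g                          ≡⟨ ∑-split m (n ∸ m) g ⟩
  ∑ m g + ∑ (n ∸ m) (λ i → g (m ℕ.+ i))        ≡⟨ cong (λ z → ∑ m g + z) (∑-zero (n ∸ m) (λ i _ → eq (m ℕ.+ i) (ℕ.m≤m+n m i))) ⟩
  ∑ m g + 0ℤ                                   ≡⟨ ℤ.+-identityʳ _ ⟩
  ∑ m g                                        ∎
  where open ≡-Reasoning

∑-telescope : ∀ n (g : ℕ → ℤ) → ∑ n (λ i → g (suc i) - g i) ≡ g n - g 0
∑-telescope zero    g = sym (ℤ.+-inverseʳ (g 0))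
∑-telescope (suc n) g = trans (cong (_+ (g (suc n) - g n)) (∑-telescope n g)) (collapse (g n) (g 0) (g (suc n)))
  where
  collapse : ∀ a b c → a - b + (c - a) ≡ c - b
  collapse = solve-∀

∑-mono : ∀ n {g h} → (∀ i → i ℕ.< n → g i ℤ.≤ h i) → ∑ n g ℤ.≤ ∑ n h
∑-mono zero    le = ℤ.≤-refl
∑-mono (suc n) le = ℤ.+-mono-≤ (∑-mono n (λ i i<n → le i (ℕ.m<n⇒m<1+n i<n))) (le n (ℕ.n<1+n n))

∑-single : ∀ {n k} g → k ℕ.< n → (∀ i → i ℕ.< n → i ≢ k → g i ≡ 0ℤ) → ∑ n g ≡ g k
∑-single {suc n} {k} g k<1+n rest = Sum.[ k<n-case , k≡n-case ]′ (ℕ.m≤n⇒m<n∨m≡n (ℕ.≤-pred k<1+n))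
  where
  k<n-case : k ℕ.< n → ∑ (suc n) g ≡ g k
  k<n-case k<n = trans (cong₂ _+_ (∑-single g k<n (λ i i<n → rest i (ℕ.m<n⇒m<1+n i<n))) (rest n (ℕ.n<1+n n) (λ n≡k → ℕ.<⇒≢ k<n (sym n≡k))))
    (ℤ.+-identityʳ (g k))
  k≡n-case : k ≡ n → ∑ (suc n) g ≡ g k
  k≡n-case refl = trans (cong (_+ g k) (∑-zero k (λ i i<k → rest i (ℕ.m<n⇒m<1+n i<k) (ℕ.<⇒≢ i<k)))) (ℤ.+-identityˡ (g k))

∑-≥ : ∀ n {g h} → (∀ i → i ℕ.< n → - h i ℤ.≤ g i) → - ∑ n h ℤ.≤ ∑ n g
∑-≥ n {g} {h} le = subst (ℤ._≤ ∑ n g) (∑-neg n h) (∑-mono n le)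

∑-* : ∀ m n g h → ∑ m g * ∑ n h ≡ ∑ m (λ i → ∑ n (λ j → g i * h j))
∑-* m n g h = trans (sym (∑-*ʳ m (∑ n h) g)) (∑-cong m (λ i _ → sym (∑-*ˡ n (g i) h)))

-- Binomial coefficients.

binom : ℕ → ℕ → ℤ
binom n k = + (n C k)

binom-suc : ∀ n k → binom (suc n) (suc k) ≡ binom n k + binom n (suc k)
binom-suc n k = cong +_ (sym (nCk+nC[k+1]≡[n+1]C[k+1] n k))

binom-> : ∀ {n k} → n ℕ.< k → binom n k ≡ 0ℤ
binom-> n<k = cong +_ (k>n⇒nCk≡0 n<k)

binom-self : ∀ n → binom n n ≡ 1ℤ
binom-self n = cong +_ (nCn≡1 n)

binom-sym : ∀ a b → binom (a ℕ.+ b) a ≡ binom (a ℕ.+ b) b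
binom-sym a b = cong +_ (trans (nCk≡nC[n∸k] (ℕ.m≤m+n a b)) (cong ((a ℕ.+ b) C_) (ℕ.m+n∸m≡n a b)))

-- Induction on `b`: Pascal's rule for `binom (suc b) (suc j)` splits the sum into those for `i` and
-- `suc i`, so the offset `i` has to stay free although the usual identity has `i = 0`.
vandermonde : ∀ k b i → ∑ (suc b) (λ j → binom k (i ℕ.+ j) * binom b j) ≡ binom (k ℕ.+ b) (b ℕ.+ i)
vandermonde k zero i rewrite ℕ.+-identityʳ k | ℕ.+-identityʳ i =
  trans (ℤ.+-identityˡ _) (ℤ.*-identityʳ (binom k i))
vandermonde k (suc b) i = begin
  ∑ (2 ℕ.+ b) (λ j → binom k (i ℕ.+ j) * binom (suc b) j)
    ≡⟨ ∑-head (suc b) _ ⟩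
  binom k (i ℕ.+ 0) * 1ℤ + ∑ (suc b) (λ j → binom k (i ℕ.+ suc j) * binom (suc b) (suc j))
    ≡⟨ cong (λ z → binom k (i ℕ.+ 0) * 1ℤ + z) (∑-cong (suc b) (λ j _ → trans (cong (binom k (i ℕ.+ suc j) *_) (binom-suc b j))
         (trans (ℤ.*-distribˡ-+ (binom k (i ℕ.+ suc j)) (binom b j) (binom b (suc j)))
           (ℤ.+-comm (binom k (i ℕ.+ suc j) * binom b j) (binom k (i ℕ.+ suc j) * binom b (suc j)))))) ⟩
  binom k (i ℕ.+ 0) * 1ℤ + ∑ (suc b) (λ j → binom k (i ℕ.+ suc j) * binom b (suc j) + binom k (i ℕ.+ suc j) * binom b j)
    ≡⟨ cong (λ z → binom k (i ℕ.+ 0) * 1ℤ + z) (∑-+ (suc b) _ _) ⟩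
  binom k (i ℕ.+ 0) * 1ℤ + (∑ (suc b) (λ j → binom k (i ℕ.+ suc j) * binom b (suc j)) + ∑ (suc b) (λ j → binom k (i ℕ.+ suc j) * binom b j))
    ≡⟨ sym (ℤ.+-assoc (binom k (i ℕ.+ 0) * 1ℤ) _ _) ⟩
  binom k (i ℕ.+ 0) * 1ℤ + ∑ (suc b) (λ j → binom k (i ℕ.+ suc j) * binom b (suc j)) + ∑ (suc b) (λ j → binom k (i ℕ.+ suc j) * binom b j)
    ≡⟨ cong₂ _+_ (sym (∑-head (suc b) (λ j → binom k (i ℕ.+ j) * binom b j)))
         (∑-cong (suc b) (λ j _ → cong (λ l → binom k l * binom b j) (ℕ.+-suc i j))) ⟩
  ∑ (2 ℕ.+ b) (λ j → binom k (i ℕ.+ j) * binom b j) + ∑ (suc b) (λ j → binom k (suc i ℕ.+ j) * binom b j)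
    ≡⟨ cong₂ _+_ (∑-truncate _ (ℕ.n≤1+n (suc b)) (λ j b<j → trans (cong (binom k (i ℕ.+ j) *_) (binom-> b<j)) (ℤ.*-zeroʳ (binom k (i ℕ.+ j)))))
         (vandermonde k b (suc i)) ⟩
  ∑ (suc b) (λ j → binom k (i ℕ.+ j) * binom b j) + binom (k ℕ.+ b) (b ℕ.+ suc i)
    ≡⟨ cong₂ _+_ (vandermonde k b i) (cong (binom (k ℕ.+ b)) (ℕ.+-suc b i)) ⟩
  binom (k ℕ.+ b) (b ℕ.+ i) + binom (k ℕ.+ b) (suc (b ℕ.+ i))
    ≡⟨ sym (binom-suc (k ℕ.+ b) (b ℕ.+ i)) ⟩
  binom (suc (k ℕ.+ b)) (suc (b ℕ.+ i))
    ≡⟨ cong (λ l → binom l (suc (b ℕ.+ i))) (sym (ℕ.+-suc k b)) ⟩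
  binom (k ℕ.+ suc b) (suc b ℕ.+ i) ∎
  where open ≡-Reasoning

binom-absorb : ∀ n k → + suc k * binom (suc n) (suc k) ≡ + suc n * binom n k
binom-absorb zero    zero    = refl
binom-absorb zero    (suc k) = trans (cong (+ suc (suc k) *_) (binom-> {1} {2 ℕ.+ k} (s≤s (s≤s z≤n))))
  (trans (ℤ.*-zeroʳ (+ suc (suc k))) (sym (trans (cong (1ℤ *_) (binom-> {0} {suc k} (s≤s z≤n))) refl)))
binom-absorb (suc n) zero    = begin
  1ℤ * binom (2 ℕ.+ n) 1                    ≡⟨ cong (1ℤ *_) (binom-suc (suc n) 0) ⟩
  1ℤ * (1ℤ + binom (suc n) 1)               ≡⟨ expand (binom (suc n) 1) ⟩
  1ℤ + 1ℤ * binom (suc n) 1                 ≡⟨ cong (λ z → 1ℤ + z) (binom-absorb n 0) ⟩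
  1ℤ + + suc n * 1ℤ                         ≡⟨ cong (λ z → 1ℤ + z) (ℤ.*-identityʳ (+ suc n)) ⟩
  + suc (suc n)                             ≡⟨ sym (ℤ.*-identityʳ (+ suc (suc n))) ⟩
  + suc (suc n) * 1ℤ                        ∎
  where
  open ≡-Reasoning
  expand : ∀ a → 1ℤ * (1ℤ + a) ≡ 1ℤ + 1ℤ * a
  expand = solve-∀
binom-absorb (suc n) (suc k) = begin
  + suc (suc k) * binom (2 ℕ.+ n) (2 ℕ.+ k)
    ≡⟨ cong (+ suc (suc k) *_) (binom-suc (suc n) (suc k)) ⟩
  + suc (suc k) * (binom (suc n) (suc k) + binom (suc n) (2 ℕ.+ k))
    ≡⟨ expand (+ suc k) (binom (suc n) (suc k)) (binom (suc n) (2 ℕ.+ k)) ⟩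
  binom (suc n) (suc k) + (+ suc k * binom (suc n) (suc k) + + suc (suc k) * binom (suc n) (2 ℕ.+ k))
    ≡⟨ cong₂ (λ a b → binom (suc n) (suc k) + (a + b)) (binom-absorb n k) (binom-absorb n (suc k)) ⟩
  binom (suc n) (suc k) + (+ suc n * binom n k + + suc n * binom n (suc k))
    ≡⟨ cong (λ a → binom (suc n) (suc k) + a) (sym (ℤ.*-distribˡ-+ (+ suc n) (binom n k) (binom n (suc k)))) ⟩
  binom (suc n) (suc k) + + suc n * (binom n k + binom n (suc k))
    ≡⟨ cong (λ a → binom (suc n) (suc k) + + suc n * a) (sym (binom-suc n k)) ⟩
  binom (suc n) (suc k) + + suc n * binom (suc n) (suc k)
    ≡⟨ collect (+ suc n) (binom (suc n) (suc k)) ⟩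
  + suc (suc n) * binom (suc n) (suc k) ∎
  where
  open ≡-Reasoning
  expand : ∀ k a b → (1ℤ + k) * (a + b) ≡ a + (k * a + (1ℤ + k) * b)
  expand = solve-∀
  collect : ∀ n a → a + n * a ≡ (1ℤ + n) * a
  collect = solve-∀

-- The ratio of consecutive coefficients with the denominator cleared. The inductions modulo `p`
-- rest on it, because `suc k` can be cancelled there as long as `k < q`.
binom-step : ∀ n k → + suc k * binom n (suc k) ≡ (+ n - + k) * binom n k
binom-step n k = begin
  + suc k * binom n (suc k)
    ≡⟨ shift (+ k) (binom n k) (binom n (suc k)) ⟩
  + suc k * (binom n k + binom n (suc k)) - + suc k * binom n k
    ≡⟨ cong (λ a → + suc k * a - + suc k * binom n k) (sym (binom-suc n k)) ⟩
  + suc k * binom (suc n) (suc k) - + suc k * binom n k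
    ≡⟨ cong (_- + suc k * binom n k) (binom-absorb n k) ⟩
  + suc n * binom n k - + suc k * binom n k
    ≡⟨ collect (+ n) (+ k) (binom n k) ⟩
  (+ n - + k) * binom n k ∎
  where
  open ≡-Reasoning
  shift : ∀ k a b → (1ℤ + k) * b ≡ (1ℤ + k) * (a + b) - (1ℤ + k) * a
  shift = solve-∀
  collect : ∀ n k a → (1ℤ + n) * a - (1ℤ + k) * a ≡ (n - k) * a
  collect = solve-∀

-- Absorption lowers all the indices involved by one, so induction on `i` applies once the positive
-- factors `suc i` and `suc (i + r)` are cancelled. The additive indices keep truncated subtraction
-- out.
binom-revision : ∀ i s r → binom (i ℕ.+ s) (i ℕ.+ r) * binom (i ℕ.+ r) i ≡ binom (i ℕ.+ s) i * binom s r
binom-revision zero    s r = ℤ.*-comm (binom s r) 1ℤ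
binom-revision (suc i) s r = ℤ.*-cancelˡ-≡ (+ suc (i ℕ.+ r)) _ _
  (ℤ.*-cancelˡ-≡ (+ suc i) _ _ (begin
  + suc i * (+ suc (i ℕ.+ r) * (binom (suc (i ℕ.+ s)) (suc (i ℕ.+ r)) * binom (suc (i ℕ.+ r)) (suc i)))
    ≡⟨ regroup (+ suc i) (+ suc (i ℕ.+ r)) (binom (suc (i ℕ.+ s)) (suc (i ℕ.+ r))) (binom (suc (i ℕ.+ r)) (suc i)) ⟩
  (+ suc (i ℕ.+ r) * binom (suc (i ℕ.+ s)) (suc (i ℕ.+ r))) * (+ suc i * binom (suc (i ℕ.+ r)) (suc i))
    ≡⟨ cong₂ _*_ (binom-absorb (i ℕ.+ s) (i ℕ.+ r)) (binom-absorb (i ℕ.+ r) i) ⟩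
  (+ suc (i ℕ.+ s) * binom (i ℕ.+ s) (i ℕ.+ r)) * (+ suc (i ℕ.+ r) * binom (i ℕ.+ r) i)
    ≡⟨ regroup′ (+ suc (i ℕ.+ s)) (+ suc (i ℕ.+ r)) (binom (i ℕ.+ s) (i ℕ.+ r)) (binom (i ℕ.+ r) i) ⟩
  + suc (i ℕ.+ r) * (+ suc (i ℕ.+ s) * (binom (i ℕ.+ s) (i ℕ.+ r) * binom (i ℕ.+ r) i))
    ≡⟨ cong (λ a → + suc (i ℕ.+ r) * (+ suc (i ℕ.+ s) * a)) (binom-revision i s r) ⟩
  + suc (i ℕ.+ r) * (+ suc (i ℕ.+ s) * (binom (i ℕ.+ s) i * binom s r))
    ≡⟨ cong (+ suc (i ℕ.+ r) *_) (sym (ℤ.*-assoc (+ suc (i ℕ.+ s)) (binom (i ℕ.+ s) i) (binom s r))) ⟩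
  + suc (i ℕ.+ r) * (+ suc (i ℕ.+ s) * binom (i ℕ.+ s) i * binom s r)
    ≡⟨ cong (λ a → + suc (i ℕ.+ r) * (a * binom s r)) (sym (binom-absorb (i ℕ.+ s) i)) ⟩
  + suc (i ℕ.+ r) * (+ suc i * binom (suc (i ℕ.+ s)) (suc i) * binom s r)
    ≡⟨ regroup″ (+ suc (i ℕ.+ r)) (+ suc i) (binom (suc (i ℕ.+ s)) (suc i)) (binom s r) ⟩
  + suc i * (+ suc (i ℕ.+ r) * (binom (suc (i ℕ.+ s)) (suc i) * binom s r)) ∎))
  where
  open ≡-Reasoning
  regroup : ∀ a b c d → a * (b * (c * d)) ≡ (b * c) * (a * d)
  regroup = solve-∀
  regroup′ : ∀ a b c d → (a * c) * (b * d) ≡ b * (a * (c * d))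
  regroup′ = solve-∀
  regroup″ : ∀ a b c d → a * (b * c * d) ≡ b * (a * (c * d))
  regroup″ = solve-∀

binom-revision-∸ : ∀ {n i} r → i ℕ.≤ n → binom n (i ℕ.+ r) * binom (i ℕ.+ r) i ≡ binom n i * binom (n ∸ i) r
binom-revision-∸ {n} {i} r i≤n =
  subst (λ l → binom l (i ℕ.+ r) * binom (i ℕ.+ r) i ≡ binom l i * binom (n ∸ i) r) (ℕ.m+[n∸m]≡n i≤n)
    (binom-revision i (n ∸ i) r)

-- Both sides count the pairs of disjoint subsets of sizes `a` and `b` in a set of size `n`.
binom-exchange : ∀ {n} a b → a ℕ.≤ n → b ℕ.≤ n → binom n a * binom (n ∸ a) b ≡ binom n b * binom (n ∸ b) a
binom-exchange {n} a b a≤n b≤n = begin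
  binom n a * binom (n ∸ a) b                ≡⟨ sym (binom-revision-∸ b a≤n) ⟩
  binom n (a ℕ.+ b) * binom (a ℕ.+ b) a      ≡⟨ cong (binom n (a ℕ.+ b) *_) (binom-sym a b) ⟩
  binom n (a ℕ.+ b) * binom (a ℕ.+ b) b      ≡⟨ cong (λ l → binom n l * binom l b) (ℕ.+-comm a b) ⟩
  binom n (b ℕ.+ a) * binom (b ℕ.+ a) b      ≡⟨ binom-revision-∸ a b≤n ⟩
  binom n b * binom (n ∸ b) a                ∎
  where open ≡-Reasoning

-- With n = k + m, expanding binom (n + j) n by Vandermonde and summing over j first turns
-- the right-hand side into binom n k times another Vandermonde sum.
binom-square : ∀ k m →
  binom (k ℕ.+ m) k * binom (k ℕ.+ m) k ≡ ∑ (suc m) (λ j → binom k j * binom m j * binom (k ℕ.+ m ℕ.+ j) j)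
binom-square k m = sym (begin
  ∑ (suc m) (λ j → binom k j * binom m j * binom (n ℕ.+ j) j)
    ≡⟨ ∑-cong (suc m) (λ j j<1+m → cong (binom k j * binom m j *_) (expand j j<1+m)) ⟩
  ∑ (suc m) (λ j → binom k j * binom m j * ∑ (suc m) (λ i → binom n i * binom j i))
    ≡⟨ ∑-cong (suc m) (λ j _ → sym (∑-*ˡ (suc m) (binom k j * binom m j) _)) ⟩
  ∑ (suc m) (λ j → ∑ (suc m) (λ i → binom k j * binom m j * (binom n i * binom j i)))
    ≡⟨ ∑-swap (suc m) (suc m) _ ⟩
  ∑ (suc m) (λ i → ∑ (suc m) (λ j → binom k j * binom m j * (binom n i * binom j i)))
    ≡⟨ ∑-cong (suc m) (λ i i<1+m → inner i (ℕ.≤-pred i<1+m)) ⟩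
  ∑ (suc m) (λ i → binom n k * (binom k i * binom m i))
    ≡⟨ ∑-*ˡ (suc m) (binom n k) _ ⟩
  binom n k * ∑ (suc m) (λ i → binom k i * binom m i)
    ≡⟨ cong (binom n k *_) (trans (vandermonde k m 0) (cong (binom n) (ℕ.+-identityʳ m))) ⟩
  binom n k * binom n m
    ≡⟨ cong (binom n k *_) (sym (binom-sym k m)) ⟩
  binom n k * binom n k ∎)
  where
  open ≡-Reasoning
  n = k ℕ.+ m
  expand : ∀ j → j ℕ.< suc m → binom (n ℕ.+ j) j ≡ ∑ (suc m) (λ i → binom n i * binom j i)
  expand j j<1+m = sym (begin
    ∑ (suc m) (λ i → binom n i * binom j i)
      ≡⟨ ∑-truncate _ j<1+m (λ i j<i → trans (cong (binom n i *_) (binom-> j<i)) (ℤ.*-zeroʳ (binom n i))) ⟩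
    ∑ (suc j) (λ i → binom n i * binom j i)   ≡⟨ vandermonde n j 0 ⟩
    binom (n ℕ.+ j) (j ℕ.+ 0)                 ≡⟨ cong (binom (n ℕ.+ j)) (ℕ.+-identityʳ j) ⟩
    binom (n ℕ.+ j) j                         ∎)
  inner : ∀ i → i ℕ.≤ m →
    ∑ (suc m) (λ j → binom k j * binom m j * (binom n i * binom j i)) ≡ binom n k * (binom k i * binom m i)
  inner i i≤m = begin
    ∑ (suc m) g
      ≡⟨ cong (λ l → ∑ l g) (sym (trans (ℕ.+-suc i (m ∸ i)) (cong suc (ℕ.m+[n∸m]≡n i≤m)))) ⟩
    ∑ (i ℕ.+ suc (m ∸ i)) g
      ≡⟨ ∑-split i (suc (m ∸ i)) g ⟩
    ∑ i g + ∑ (suc (m ∸ i)) (λ s → g (i ℕ.+ s))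
      ≡⟨ cong₂ _+_ (∑-zero i (λ j j<i → trans (cong (λ z → binom k j * binom m j * (binom n i * z)) (binom-> j<i)) (annihilate (binom k j * binom m j) (binom n i))))
           (∑-cong (suc (m ∸ i)) (λ s _ → term s)) ⟩
    0ℤ + ∑ (suc (m ∸ i)) (λ s → binom n i * binom m i * (binom k (i ℕ.+ s) * binom (m ∸ i) s))
      ≡⟨ trans (ℤ.+-identityˡ _) (∑-*ˡ (suc (m ∸ i)) (binom n i * binom m i) _) ⟩
    binom n i * binom m i * ∑ (suc (m ∸ i)) (λ s → binom k (i ℕ.+ s) * binom (m ∸ i) s)
      ≡⟨ cong (binom n i * binom m i *_) (vandermonde k (m ∸ i) i) ⟩
    binom n i * binom m i * binom (k ℕ.+ (m ∸ i)) (m ∸ i ℕ.+ i)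
      ≡⟨ cong₂ (λ a b → binom n i * binom m i * binom a b) (sym (ℕ.+-∸-assoc k i≤m)) (ℕ.m∸n+n≡m i≤m) ⟩
    binom n i * binom m i * binom (n ∸ i) m
      ≡⟨ swap (binom n i) (binom m i) (binom (n ∸ i) m) ⟩
    binom n i * binom (n ∸ i) m * binom m i
      ≡⟨ cong (_* binom m i) (binom-exchange i m (ℕ.≤-trans i≤m (ℕ.m≤n+m m k)) (ℕ.m≤n+m m k)) ⟩
    binom n m * binom (n ∸ m) i * binom m i
      ≡⟨ cong₂ (λ a b → a * binom b i * binom m i) (sym (binom-sym k m)) (ℕ.m+n∸n≡m k m) ⟩
    binom n k * binom k i * binom m i
      ≡⟨ ℤ.*-assoc (binom n k) (binom k i) (binom m i) ⟩
    binom n k * (binom k i * binom m i) ∎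
    where
    g : ℕ → ℤ
    g j = binom k j * binom m j * (binom n i * binom j i)
    annihilate : ∀ a b → a * (b * 0ℤ) ≡ 0ℤ
    annihilate = solve-∀
    swap : ∀ a b c → a * b * c ≡ a * c * b
    swap = solve-∀
    regroup : ∀ a b c d → a * b * (c * d) ≡ c * a * (b * d)
    regroup = solve-∀
    regroup′ : ∀ a b c d → c * a * (b * d) ≡ c * b * (a * d)
    regroup′ = solve-∀
    term : ∀ s → g (i ℕ.+ s) ≡ binom n i * binom m i * (binom k (i ℕ.+ s) * binom (m ∸ i) s)
    term s = begin
      binom k (i ℕ.+ s) * binom m (i ℕ.+ s) * (binom n i * binom (i ℕ.+ s) i)
        ≡⟨ regroup (binom k (i ℕ.+ s)) (binom m (i ℕ.+ s)) (binom n i) (binom (i ℕ.+ s) i) ⟩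
      binom n i * binom k (i ℕ.+ s) * (binom m (i ℕ.+ s) * binom (i ℕ.+ s) i)
        ≡⟨ cong (binom n i * binom k (i ℕ.+ s) *_) (binom-revision-∸ s i≤m) ⟩
      binom n i * binom k (i ℕ.+ s) * (binom m i * binom (m ∸ i) s)
        ≡⟨ regroup′ (binom k (i ℕ.+ s)) (binom m i) (binom n i) (binom (m ∸ i) s) ⟩
      binom n i * binom m i * (binom k (i ℕ.+ s) * binom (m ∸ i) s) ∎

∑-binom : ∀ n → ∑ (suc n) (binom n) ≡ (+ 2) ^ n
∑-binom zero    = refl
∑-binom (suc n) = begin
  ∑ (2 ℕ.+ n) (binom (suc n))
    ≡⟨ ∑-head (suc n) _ ⟩
  1ℤ + ∑ (suc n) (λ k → binom (suc n) (suc k))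
    ≡⟨ cong (λ z → 1ℤ + z) (trans (∑-cong (suc n) (λ k _ → binom-suc n k)) (∑-+ (suc n) _ _)) ⟩
  1ℤ + (∑ (suc n) (binom n) + ∑ (suc n) (λ k → binom n (suc k)))
    ≡⟨ swap 1ℤ (∑ (suc n) (binom n)) _ ⟩
  ∑ (suc n) (binom n) + (1ℤ + ∑ (suc n) (λ k → binom n (suc k)))
    ≡⟨ cong (λ z → ∑ (suc n) (binom n) + z)
         (trans (sym (∑-head (suc n) (binom n))) (∑-truncate _ (ℕ.n≤1+n (suc n)) (λ k n<k → binom-> n<k))) ⟩
  ∑ (suc n) (binom n) + ∑ (suc n) (binom n)
    ≡⟨ cong₂ _+_ (∑-binom n) (∑-binom n) ⟩
  (+ 2) ^ n + (+ 2) ^ n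
    ≡⟨ double ((+ 2) ^ n) ⟩
  (+ 2) ^ suc n ∎
  where
  open ≡-Reasoning
  swap : ∀ a b c → a + (b + c) ≡ b + (a + c)
  swap = solve-∀
  double : ∀ a → a + a ≡ + 2 * a
  double = solve-∀

binomial-theorem : ∀ x y n → (x + y) ^ n ≡ ∑ (suc n) (λ j → binom n j * (y ^ j * x ^ (n ∸ j)))
binomial-theorem x y zero    = refl
binomial-theorem x y (suc n) = begin
  (x + y) * (x + y) ^ n
    ≡⟨ cong ((x + y) *_) (binomial-theorem x y n) ⟩
  (x + y) * ∑ (suc n) t
    ≡⟨ ℤ.*-distribʳ-+ (∑ (suc n) t) x y ⟩
  x * ∑ (suc n) t + y * ∑ (suc n) t
    ≡⟨ cong₂ _+_ (trans (sym (∑-*ˡ (suc n) x t)) (∑-cong (suc n) (λ j j<1+n → shiftˣ j (ℕ.≤-pred j<1+n))))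
         (trans (sym (∑-*ˡ (suc n) y t)) (∑-cong (suc n) (λ j _ → shiftʸ y (binom n j) (y ^ j) (x ^ (n ∸ j))))) ⟩
  ∑ (suc n) a + ∑ (suc n) b
    ≡⟨ cong (_+ ∑ (suc n) b) (trans (sym (∑-truncate a (ℕ.n≤1+n (suc n)) (λ j n<j → cong (_* (y ^ j * x ^ (suc n ∸ j))) (binom-> n<j))))
         (∑-head (suc n) a)) ⟩
  a 0 + ∑ (suc n) (λ j → a (suc j)) + ∑ (suc n) b
    ≡⟨ rotate (a 0) (∑ (suc n) (λ j → a (suc j))) (∑ (suc n) b) ⟩
  a 0 + (∑ (suc n) b + ∑ (suc n) (λ j → a (suc j)))
    ≡⟨ cong (λ z → a 0 + z) (trans (sym (∑-+ (suc n) b _)) (∑-cong (suc n) (λ j _ → pascal j))) ⟩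
  a 0 + ∑ (suc n) (λ j → binom (suc n) (suc j) * (y ^ suc j * x ^ (n ∸ j)))
    ≡⟨ sym (∑-head (suc n) (λ j → binom (suc n) j * (y ^ j * x ^ (suc n ∸ j)))) ⟩
  ∑ (2 ℕ.+ n) (λ j → binom (suc n) j * (y ^ j * x ^ (suc n ∸ j))) ∎
  where
  open ≡-Reasoning
  t a b : ℕ → ℤ
  t j = binom n j * (y ^ j * x ^ (n ∸ j))
  a j = binom n j * (y ^ j * x ^ (suc n ∸ j))
  b j = binom n j * (y ^ suc j * x ^ (n ∸ j))
  shift : ∀ x c u v → x * (c * (u * v)) ≡ c * (u * (x * v))
  shift = solve-∀
  shiftˣ : ∀ j → j ℕ.≤ n → x * t j ≡ a j
  shiftˣ j j≤n = trans (shift x (binom n j) (y ^ j) (x ^ (n ∸ j)))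
    (cong (λ e → binom n j * (y ^ j * x ^ e)) (sym (ℕ.+-∸-assoc 1 j≤n)))
  shiftʸ : ∀ y c u v → y * (c * (u * v)) ≡ c * (y * u * v)
  shiftʸ = solve-∀
  rotate : ∀ a b c → a + b + c ≡ a + (c + b)
  rotate = solve-∀
  pascal : ∀ j → b j + a (suc j) ≡ binom (suc n) (suc j) * (y ^ suc j * x ^ (n ∸ j))
  pascal j = trans (sym (ℤ.*-distribʳ-+ (y ^ suc j * x ^ (n ∸ j)) (binom n j) (binom n (suc j))))
    (cong (_* (y ^ suc j * x ^ (n ∸ j))) (sym (binom-suc n j)))

binomial-theorem₁ : ∀ x n → (1ℤ + x) ^ n ≡ ∑ (suc n) (λ j → binom n j * x ^ j)
binomial-theorem₁ x n = trans (binomial-theorem 1ℤ x n) (∑-cong (suc n) (λ j _ → cong (binom n j *_)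
  (trans (cong (x ^ j *_) (ℤ.^-zeroˡ (n ∸ j))) (ℤ.*-identityʳ (x ^ j)))))

^-distribʳ-* : ∀ x y n → (x * y) ^ n ≡ x ^ n * y ^ n
^-distribʳ-* x y zero    = refl
^-distribʳ-* x y (suc n) = trans (cong (x * y *_) (^-distribʳ-* x y n)) (interchange x y (x ^ n) (y ^ n))
  where
  interchange : ∀ a b c d → a * b * (c * d) ≡ a * c * (b * d)
  interchange = solve-∀

0^suc : ∀ {n} → 0 ℕ.< n → 0ℤ ^ n ≡ 0ℤ
0^suc (s≤s _) = refl

-- Integers modulo p.

module Congruence (p : ℕ) where

  infix 4 _≈_ _≉_

  -- A record and not a synonym for divisibility, because `a` and `b` cannot be read off from the
  -- difference `a - b`.
  record _≈_ (a b : ℤ) : Set where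
    constructor congruent
    field difference : + p ∣ₛ (a - b)

  open _≈_ public

  _≉_ : ℤ → ℤ → Set
  a ≉ b = ¬ (a ≈ b)

  witness : ∀ {a b} k → a - b ≡ k * + p → a ≈ b
  witness k eq = congruent (divides k eq)

  ≡⇒≈ : ∀ {a b} → a ≡ b → a ≈ b
  ≡⇒≈ {a} refl = witness 0ℤ (ℤ.+-inverseʳ a)

  ≈-refl : ∀ {a} → a ≈ a
  ≈-refl = ≡⇒≈ refl

  ≈-sym : ∀ {a b} → a ≈ b → b ≈ a
  ≈-sym {a} {b} (congruent (divides k eq)) = witness (- k)
    (trans (flip a b) (trans (cong -_ eq) (ℤ.neg-distribˡ-* k (+ p))))
    where
    flip : ∀ a b → b - a ≡ - (a - b)
    flip = solve-∀

  ≈-trans : ∀ {a b c} → a ≈ b → b ≈ c → a ≈ c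
  ≈-trans {a} {b} {c} (congruent (divides k eq)) (congruent (divides l eq′)) = witness (k + l)
    (trans (join a b c) (trans (cong₂ _+_ eq eq′) (sym (ℤ.*-distribʳ-+ (+ p) k l))))
    where
    join : ∀ a b c → a - c ≡ a - b + (b - c)
    join = solve-∀

  +-cong : ∀ {a b c d} → a ≈ b → c ≈ d → a + c ≈ b + d
  +-cong {a} {b} {c} {d} (congruent (divides k eq)) (congruent (divides l eq′)) = witness (k + l)
    (trans (join a b c d) (trans (cong₂ _+_ eq eq′) (sym (ℤ.*-distribʳ-+ (+ p) k l))))
    where
    join : ∀ a b c d → a + c - (b + d) ≡ a - b + (c - d)
    join = solve-∀

  *-cong : ∀ {a b c d} → a ≈ b → c ≈ d → a * c ≈ b * d
  *-cong {a} {b} {c} {d} (congruent (divides k eq)) (congruent (divides l eq′)) = witness (k * c + b * l)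
    (trans (join a b c d) (trans (cong₂ (λ u v → u * c + b * v) eq eq′) (collect k c b l (+ p))))
    where
    join : ∀ a b c d → a * c - b * d ≡ (a - b) * c + b * (c - d)
    join = solve-∀
    collect : ∀ k c b l p → k * p * c + b * (l * p) ≡ (k * c + b * l) * p
    collect = solve-∀

  +-congˡ : ∀ a {b c} → b ≈ c → a + b ≈ a + c
  +-congˡ a = +-cong (≈-refl {a})

  +-congʳ : ∀ a {b c} → b ≈ c → b + a ≈ c + a
  +-congʳ a b≈c = +-cong b≈c ≈-refl

  *-congˡ : ∀ a {b c} → b ≈ c → a * b ≈ a * c
  *-congˡ a = *-cong (≈-refl {a})

  *-congʳ : ∀ a {b c} → b ≈ c → b * a ≈ c * a
  *-congʳ a b≈c = *-cong b≈c ≈-refl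

  neg-cong : ∀ {a b} → a ≈ b → - a ≈ - b
  neg-cong {a} {b} a≈b = ≈-trans (≡⇒≈ (sym (ℤ.-1*i≡-i a))) (≈-trans (*-congˡ -1ℤ a≈b) (≡⇒≈ (ℤ.-1*i≡-i b)))

  sub-cong : ∀ {a b c d} → a ≈ b → c ≈ d → a - c ≈ b - d
  sub-cong a≈b c≈d = +-cong a≈b (neg-cong c≈d)

  ^-cong : ∀ {a b} n → a ≈ b → a ^ n ≈ b ^ n
  ^-cong zero    a≈b = ≈-refl
  ^-cong (suc n) a≈b = *-cong a≈b (^-cong n a≈b)

  ∑-cong≈ : ∀ n {g h} → (∀ i → i ℕ.< n → g i ≈ h i) → ∑ n g ≈ ∑ n h
  ∑-cong≈ zero    eq = ≈-refl
  ∑-cong≈ (suc n) eq = +-cong (∑-cong≈ n (λ i i<n → eq i (ℕ.m<n⇒m<1+n i<n))) (eq n (ℕ.n<1+n n))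

  ∑-zero≈ : ∀ n {g} → (∀ i → i ℕ.< n → g i ≈ 0ℤ) → ∑ n g ≈ 0ℤ
  ∑-zero≈ n eq = ≈-trans (∑-cong≈ n eq) (≡⇒≈ (∑-zero n (λ _ _ → refl)))

  ∑-single≈ : ∀ {n k} g → k ℕ.< n → (∀ i → i ℕ.< n → i ≢ k → g i ≈ 0ℤ) → ∑ n g ≈ g k
  ∑-single≈ {suc n} {k} g k<1+n rest = Sum.[ k<n-case , k≡n-case ]′ (ℕ.m≤n⇒m<n∨m≡n (ℕ.≤-pred k<1+n))
    where
    k<n-case : k ℕ.< n → ∑ (suc n) g ≈ g k
    k<n-case k<n = ≈-trans (+-cong (∑-single≈ g k<n (λ i i<n → rest i (ℕ.m<n⇒m<1+n i<n))) (rest n (ℕ.n<1+n n) (λ n≡k → ℕ.<⇒≢ k<n (sym n≡k))))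
      (≡⇒≈ (ℤ.+-identityʳ (g k)))
    k≡n-case : k ≡ n → ∑ (suc n) g ≈ g k
    k≡n-case refl = ≈-trans (+-congʳ (g k) (∑-zero≈ k (λ i i<k → rest i (ℕ.m<n⇒m<1+n i<k) (ℕ.<⇒≢ i<k))))
      (≡⇒≈ (ℤ.+-identityˡ (g k)))

  setoid : Setoid _ _
  setoid = record { Carrier = ℤ ; _≈_ = _≈_ ; isEquivalence = record { refl = ≈-refl ; sym = ≈-sym ; trans = ≈-trans } }

  module ≈-Reasoning = SetoidReasoning setoid

  p≈0 : + p ≈ 0ℤ
  p≈0 = witness 1ℤ (trans (ℤ.+-identityʳ (+ p)) (sym (ℤ.*-identityˡ (+ p))))

  ∣⇒≈0 : ∀ {a} → + p ∣ₛ a → a ≈ 0ℤ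
  ∣⇒≈0 {a} (divides k eq) = witness k (trans (ℤ.+-identityʳ a) eq)

  ≈0⇒∣ : ∀ {a} → a ≈ 0ℤ → + p ∣ₛ a
  ≈0⇒∣ {a} (congruent d) = subst (+ p ∣ₛ_) (ℤ.+-identityʳ a) d

  ≈⇒-≈0 : ∀ {a b} → a ≈ b → a - b ≈ 0ℤ
  ≈⇒-≈0 {a} {b} (congruent d) = ∣⇒≈0 d

  -≈0⇒≈ : ∀ {a b} → a - b ≈ 0ℤ → a ≈ b
  -≈0⇒≈ a-b≈0 = congruent (≈0⇒∣ a-b≈0)

  infix 4 _≈?_

  abstract
    _≈?_ : ∀ a b → Dec (a ≈ b)
    a ≈? b = map′ congruent difference (+ p ∣? (a - b))

  ≈0⇒small : ∀ {k} → k ℕ.< p → + k ≈ 0ℤ → k ≡ 0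
  ≈0⇒small {zero}  k<p k≈0 = refl
  ≈0⇒small {suc k} k<p k≈0 = ⊥-elim (ℕ.<⇒≱ k<p (ℕ.∣⇒≤ (∣⇒∣ᵤ (≈0⇒∣ k≈0))))

-- Prime modulus `p = q + 1`: Fermat, truncated binomial series, power sums.

module PrimeModulus (q : ℕ) (p-prime : Prime (suc q)) where

  p : ℕ
  p = suc q

  open Congruence p public

  0<q : 0 ℕ.< q
  0<q = ℕ.≤-pred (ℕ.nonTrivial⇒n>1 p {{prime⇒nonTrivial p-prime}})

  q≈-1 : + q ≈ -1ℤ
  q≈-1 = witness 1ℤ (shift (+ q))
    where
    shift : ∀ q → q - -1ℤ ≡ 1ℤ * (1ℤ + q)
    shift = solve-∀

  small≉0 : ∀ {k} → k ℕ.< q → + suc k ≉ 0ℤ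
  small≉0 k<q k≈0 with () ← ≈0⇒small (s≤s k<q) k≈0

  1≉0 : 1ℤ ≉ 0ℤ
  1≉0 = small≉0 0<q

  euclid : ∀ {a b} → a * b ≈ 0ℤ → a ≈ 0ℤ ⊎ b ≈ 0ℤ
  euclid {a} {b} ab≈0 = Sum.map (λ p∣a → ∣⇒≈0 (∣ᵤ⇒∣ p∣a)) (λ p∣b → ∣⇒≈0 (∣ᵤ⇒∣ p∣b))
    (euclidsLemma ℤ.∣ a ∣ ℤ.∣ b ∣ p-prime (subst (p ℕ.∣_) (ℤ.abs-* a b) (∣⇒∣ᵤ (≈0⇒∣ ab≈0))))

  *-cancelˡ≈ : ∀ {a b c} → a ≉ 0ℤ → a * b ≈ a * c → b ≈ c
  *-cancelˡ≈ {a} {b} {c} a≉0 eq =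
    Sum.[ (λ a≈0 → ⊥-elim (a≉0 a≈0)) , -≈0⇒≈ ]′ (euclid {a} {b - c} (≈-trans (≡⇒≈ (distrib a b c)) (≈⇒-≈0 eq)))
    where
    distrib : ∀ a b c → a * (b - c) ≡ a * b - a * c
    distrib = solve-∀

  *-≉0 : ∀ {a b} → a ≉ 0ℤ → b ≉ 0ℤ → a * b ≉ 0ℤ
  *-≉0 a≉0 b≉0 ab≈0 with euclid ab≈0
  ... | inj₁ a≈0 = a≉0 a≈0
  ... | inj₂ b≈0 = b≉0 b≈0

  ^-≉0 : ∀ {a} n → a ≉ 0ℤ → a ^ n ≉ 0ℤ
  ^-≉0 zero    a≉0 = 1≉0
  ^-≉0 (suc n) a≉0 = *-≉0 a≉0 (^-≉0 n a≉0)

  residue : ∀ x → ∃ λ r → r ℕ.< p × x ≈ + r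
  residue x = x ℤ.%ℕ p , ℤ.n%ℕd<d x p ,
    witness (x ℤ./ℕ p) (trans (cong (_- + (x ℤ.%ℕ p)) (ℤ.a≡a%ℕn+[a/ℕn]*n x p)) (cancel (+ (x ℤ.%ℕ p)) _))
    where
    cancel : ∀ a b → a + b - a ≡ b
    cancel = solve-∀

  -- The case of Lucas' theorem that is needed. In `binom-step` the numerator `p + r - k` is `p`
  -- itself at `k = r`, and from there on the factor `p` is passed to every next coefficient while
  -- `suc k` stays invertible.
  binom≈0 : ∀ {r k} → r ℕ.< k → k ℕ.< p → binom (p ℕ.+ r) k ≈ 0ℤ
  binom≈0 {r} {suc k} r<1+k (s≤s k<q) = *-cancelˡ≈ (small≉0 k<q) (≈-trans (≡⇒≈ (binom-step (p ℕ.+ r) k))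
    (≈-trans vanish (≡⇒≈ (sym (ℤ.*-zeroʳ (+ suc k))))))
    where
    vanish : (+ (p ℕ.+ r) - + k) * binom (p ℕ.+ r) k ≈ 0ℤ
    vanish with ℕ.m≤n⇒m<n∨m≡n (ℕ.≤-pred r<1+k)
    ... | inj₁ r<k  = ≈-trans (*-congˡ (+ (p ℕ.+ r) - + k) (binom≈0 r<k (ℕ.m<n⇒m<1+n k<q))) (≡⇒≈ (ℤ.*-zeroʳ (+ (p ℕ.+ r) - + k)))
    ... | inj₂ refl = ≈-trans (*-congʳ (binom (p ℕ.+ r) r) (≈-trans (≡⇒≈ (cancel (+ p) (+ r))) p≈0)) (≡⇒≈ refl)
      where
      cancel : ∀ a b → a + b - b ≡ a
      cancel = solve-∀

  binom-p≈0 : ∀ {k} → k ℕ.< q → binom p (suc k) ≈ 0ℤ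
  binom-p≈0 {k} k<q = subst (λ n → binom n (suc k) ≈ 0ℤ) (ℕ.+-identityʳ p) (binom≈0 (s≤s z≤n) (s≤s k<q))

  fermat-ℕ : ∀ n → (+ n) ^ p ≈ + n
  fermat-ℕ zero    = ≡⇒≈ (0^suc (s≤s (z≤n {q})))
  fermat-ℕ (suc n) = begin
    (+ suc n) ^ p
      ≡⟨ binomial-theorem₁ (+ n) p ⟩
    ∑ p (λ j → binom p j * (+ n) ^ j) + binom p p * (+ n) ^ p
      ≈⟨ +-cong (≡⇒≈ (∑-head q _)) (*-cong (≡⇒≈ (binom-self p)) (fermat-ℕ n)) ⟩
    1ℤ + ∑ q (λ j → binom p (suc j) * (+ n) ^ suc j) + 1ℤ * + n
      ≈⟨ +-congʳ (1ℤ * + n) (+-congˡ 1ℤ (∑-zero≈ q (λ j j<q → *-congʳ ((+ n) ^ suc j) (binom-p≈0 j<q)))) ⟩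
    1ℤ + 0ℤ + 1ℤ * + n
      ≡⟨ cong (λ z → 1ℤ + z) (ℤ.*-identityˡ (+ n)) ⟩
    + suc n ∎
    where open ≈-Reasoning

  fermat : ∀ x → x ^ p ≈ x
  fermat x with r , _ , x≈r ← residue x = ≈-trans (^-cong p x≈r) (≈-trans (fermat-ℕ r) (≈-sym x≈r))

  fermat₁ : ∀ {x} → x ≉ 0ℤ → x ^ q ≈ 1ℤ
  fermat₁ {x} x≉0 = *-cancelˡ≈ x≉0 (≈-trans (fermat x) (≡⇒≈ (sym (ℤ.*-identityʳ x))))

  -- The left side is a truncation of the series of `(1 - y)` to the power `-(K + 1)`, and
  -- `-(K + 1) = L - p`. In the induction Pascal's rule produces one factor `1 - y` and raises `K`;
  -- the only boundary term is a multiple of `binom p (suc K)`.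
  geometric : ∀ K L y → K ℕ.+ L ≡ q → ∑ (suc L) (λ i → binom (K ℕ.+ i) K * y ^ i) ≈ (1ℤ - y) ^ L
  geometric K zero    y eq = ≡⇒≈ (trans (ℤ.+-identityˡ (binom (K ℕ.+ 0) K * 1ℤ)) (trans (ℤ.*-identityʳ (binom (K ℕ.+ 0) K))
    (trans (cong (λ n → binom n K) (ℕ.+-identityʳ K)) (binom-self K))))
  geometric K (suc L) y eq = begin
    ∑ (2 ℕ.+ L) (λ i → binom (K ℕ.+ i) K * y ^ i)
      ≡⟨ trans (∑-cong (2 ℕ.+ L) (λ i _ → pascal i)) (∑-sub (2 ℕ.+ L) h _) ⟩
    ∑ (2 ℕ.+ L) h - ∑ (2 ℕ.+ L) (λ i → binom (K ℕ.+ i) (suc K) * y ^ i)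
      ≈⟨ sub-cong (≈-trans (+-congˡ (∑ (suc L) h) top) (≡⇒≈ (ℤ.+-identityʳ (∑ (suc L) h)))) (≡⇒≈ (trans (∑-head (suc L) _) shifted)) ⟩
    ∑ (suc L) h - y * ∑ (suc L) h
      ≡⟨ collect y (∑ (suc L) h) ⟩
    (1ℤ - y) * ∑ (suc L) h
      ≈⟨ *-congˡ (1ℤ - y) (geometric (suc K) L y (trans (sym (ℕ.+-suc K L)) eq)) ⟩
    (1ℤ - y) ^ suc L ∎
    where
    open ≈-Reasoning
    h : ℕ → ℤ
    h i = binom (suc K ℕ.+ i) (suc K) * y ^ i
    sub : ∀ a b c → a * c ≡ (a + b) * c - b * c
    sub = solve-∀
    pascal : ∀ i → binom (K ℕ.+ i) K * y ^ i ≡ h i - binom (K ℕ.+ i) (suc K) * y ^ i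
    pascal i = trans (sub (binom (K ℕ.+ i) K) (binom (K ℕ.+ i) (suc K)) (y ^ i))
      (cong (λ z → z * y ^ i - binom (K ℕ.+ i) (suc K) * y ^ i) (sym (binom-suc (K ℕ.+ i) K)))
    top : h (suc L) ≈ 0ℤ
    top = *-congʳ (y ^ suc L) (subst (λ n → binom n (suc K) ≈ 0ℤ) (cong suc (sym eq))
      (binom-p≈0 (ℕ.≤-trans (ℕ.m<m+n K (s≤s z≤n)) (ℕ.≤-reflexive eq))))
    collect : ∀ y s → s - y * s ≡ (1ℤ - y) * s
    collect = solve-∀
    move : ∀ a y z → a * (y * z) ≡ y * (a * z)
    move = solve-∀
    shifted : binom (K ℕ.+ 0) (suc K) * 1ℤ + ∑ (suc L) (λ i → binom (K ℕ.+ suc i) (suc K) * y ^ suc i) ≡ y * ∑ (suc L) h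
    shifted = trans (cong₂ (λ a b → a * 1ℤ + b) (binom-> (s≤s (ℕ.≤-reflexive (ℕ.+-identityʳ K))))
        (∑-cong (suc L) (λ i _ → trans (cong (λ n → binom n (suc K) * y ^ suc i) (ℕ.+-suc K i)) (move (binom (suc K ℕ.+ i) (suc K)) y (y ^ i)))))
      (trans (ℤ.+-identityˡ _) (∑-*ˡ (suc L) y h))

  powerSum : ℕ → ℤ
  powerSum e = ∑ p (λ x → (+ x) ^ e)

  -- The differences `(x + 1)^(e + 1) - x^(e + 1)` telescope to `p^(e + 1)`. Expanded, they give a
  -- combination of the power sums up to `e`, in which the last one has the invertible coefficient
  -- `e + 1`. At `e = 0` the convention that `0^0` is 1 makes the sum equal to `p`.
  powerSum-< : ∀ e → e ℕ.< q → powerSum e ≈ 0ℤ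
  powerSum-< = <-rec (λ e → e ℕ.< q → powerSum e ≈ 0ℤ) step
    where
    step : ∀ e → (∀ {j} → j ℕ.< e → j ℕ.< q → powerSum j ≈ 0ℤ) → e ℕ.< q → powerSum e ≈ 0ℤ
    step e rec e<q = *-cancelˡ≈ (small≉0 e<q) (begin
      + suc e * powerSum e
        ≡⟨ cong (_* powerSum e) (sym (trans (binom-pred e) (ℤ.*-identityʳ (+ suc e)))) ⟩
      binom (suc e) e * powerSum e
        ≈⟨ ≈-sym (≈-trans (+-congʳ (binom (suc e) e * powerSum e) (∑-zero≈ e (λ j j<e →
             ≈-trans (*-congˡ (binom (suc e) j) (rec j<e (ℕ.<-trans j<e e<q))) (≡⇒≈ (ℤ.*-zeroʳ (binom (suc e) j))))))
             (≡⇒≈ (ℤ.+-identityˡ _))) ⟩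
      ∑ (suc e) (λ j → binom (suc e) j * powerSum j)
        ≡⟨ ∑-cong (suc e) (λ j _ → sym (∑-*ˡ p (binom (suc e) j) _)) ⟩
      ∑ (suc e) (λ j → ∑ p (λ x → binom (suc e) j * (+ x) ^ j))
        ≡⟨ ∑-swap (suc e) p _ ⟩
      ∑ p (λ x → ∑ (suc e) (λ j → binom (suc e) j * (+ x) ^ j))
        ≡⟨ ∑-cong p (λ x _ → sym (trans (cong (_- (+ x) ^ suc e) (binomial-theorem₁ (+ x) (suc e)))
             (trans (cong (λ c → ∑ (suc e) (λ j → binom (suc e) j * (+ x) ^ j) + c * (+ x) ^ suc e - (+ x) ^ suc e) (binom-self (suc e)))
               (cancel _ ((+ x) ^ suc e))))) ⟩
      ∑ p (λ x → (+ suc x) ^ suc e - (+ x) ^ suc e)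
        ≡⟨ ∑-telescope p (λ x → (+ x) ^ suc e) ⟩
      (+ p) ^ suc e - 0ℤ
        ≈⟨ ≈-trans (≡⇒≈ (ℤ.+-identityʳ ((+ p) ^ suc e))) (^-cong (suc e) p≈0) ⟩
      0ℤ
        ≡⟨ sym (ℤ.*-zeroʳ (+ suc e)) ⟩
      + suc e * 0ℤ ∎)
      where
      open ≈-Reasoning
      cancel : ∀ a b → a + 1ℤ * b - b ≡ a
      cancel = solve-∀
      binom-pred : ∀ e → binom (suc e) e ≡ + suc e * 1ℤ
      binom-pred e = trans (sym (binom-sym 1 e)) (trans (sym (ℤ.*-identityˡ _)) (binom-absorb e 0))

  powerSum-q : powerSum q ≈ -1ℤ
  powerSum-q = begin
    powerSum q                                ≡⟨ ∑-head q _ ⟩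
    0ℤ ^ q + ∑ q (λ x → (+ suc x) ^ q)        ≈⟨ +-cong (≡⇒≈ (0^suc 0<q)) (∑-cong≈ q (λ x x<q → fermat₁ (small≉0 x<q))) ⟩
    0ℤ + ∑ q (λ _ → 1ℤ)                       ≡⟨ trans (ℤ.+-identityˡ _) (trans (∑-const q 1ℤ) (ℤ.*-identityʳ (+ q))) ⟩
    + q                                       ≈⟨ q≈-1 ⟩
    -1ℤ                                       ∎
    where open ≈-Reasoning

  -- Fermat in the form `x^p ≡ x`. The remaining exponent is kept positive because at `x = 0` the
  -- exponents `q` and 0 give different powers.
  powerSum-q+ : ∀ e → powerSum (q ℕ.+ suc e) ≈ powerSum (suc e)
  powerSum-q+ e = ∑-cong≈ p (λ x _ → begin
    (+ x) ^ (q ℕ.+ suc e)      ≡⟨ cong ((+ x) ^_) (ℕ.+-suc q e) ⟩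
    (+ x) ^ (p ℕ.+ e)          ≡⟨ ℤ.^-distribˡ-+-* (+ x) p e ⟩
    (+ x) ^ p * (+ x) ^ e      ≈⟨ *-congʳ ((+ x) ^ e) (fermat (+ x)) ⟩
    (+ x) ^ suc e              ∎)
    where open ≈-Reasoning

  powerSum≈0 : ∀ e → e ≢ q → e ℕ.< q ℕ.+ q → powerSum e ≈ 0ℤ
  powerSum≈0 e e≢q e<2q with ℕ.<-cmp e q
  ... | tri< e<q _ _ = powerSum-< e e<q
  ... | tri≈ _ e≡q _ = ⊥-elim (e≢q e≡q)
  ... | tri> _ _ q<e = subst (λ n → powerSum n ≈ 0ℤ) eq
          (≈-trans (powerSum-q+ s) (powerSum-< (suc s) (ℕ.+-cancelˡ-< q (suc s) q (subst (ℕ._< q ℕ.+ q) (sym eq) e<2q))))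
    where
    s = e ∸ suc q
    eq : q ℕ.+ suc s ≡ e
    eq = trans (ℕ.+-suc q s) (ℕ.m+[n∸m]≡n q<e)

-- Franel numbers.

franel : ℕ → ℤ
franel n = + f n

sumℕ-∑ : ∀ n g → + sumℕ n g ≡ ∑ (suc n) (λ k → + g k)
sumℕ-∑ zero    g = refl
sumℕ-∑ (suc n) g = cong (_+ + g (suc n)) (sumℕ-∑ n g)

sumℤ-∑ : ∀ n g → sumℤ n g ≡ ∑ (suc n) g
sumℤ-∑ zero    g = sym (ℤ.+-identityˡ (g 0))
sumℤ-∑ (suc n) g = cong (_+ g (suc n)) (sumℤ-∑ n g)

pos-^ : ∀ m n → + (m ℕ.^ n) ≡ (+ m) ^ n
pos-^ m zero    = refl
pos-^ m (suc n) = trans (ℤ.pos-* m (m ℕ.^ n)) (cong (+ m *_) (pos-^ m n))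

-- The cofactor of `binom (n + j) j` in MacMahon's formula. It counts the splittings of a set of
-- size `n` into two parts with `j` marked elements in each.
pairs : ℕ → ℕ → ℤ
pairs n j = ∑ (suc n) (λ k → binom n k * binom k j * binom (n ∸ k) j)

-- Two of the three factors of the cube are replaced by `binom-square`, and the sums are exchanged.
-- Terms with `j > n` vanish, so one bound `N` can serve all `n < p` at once.
franel-pairs : ∀ {n N} → n ℕ.< N → franel n ≡ ∑ N (λ j → binom (n ℕ.+ j) j * pairs n j)
franel-pairs {n} {N} n<N = begin
  franel n
    ≡⟨ sumℕ-∑ n _ ⟩
  ∑ (suc n) (λ k → + ((n C k) ℕ.^ 3))
    ≡⟨ ∑-cong (suc n) (λ k k<1+n → trans (pos-^ (n C k) 3) (cong (binom n k *_)
         (trans (cong (binom n k *_) (ℤ.*-identityʳ (binom n k))) (square k (ℕ.≤-pred k<1+n))))) ⟩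
  ∑ (suc n) (λ k → binom n k * ∑ N (λ j → binom k j * binom (n ∸ k) j * binom (n ℕ.+ j) j))
    ≡⟨ ∑-cong (suc n) (λ k _ → sym (∑-*ˡ N (binom n k) _)) ⟩
  ∑ (suc n) (λ k → ∑ N (λ j → binom n k * (binom k j * binom (n ∸ k) j * binom (n ℕ.+ j) j)))
    ≡⟨ ∑-swap (suc n) N _ ⟩
  ∑ N (λ j → ∑ (suc n) (λ k → binom n k * (binom k j * binom (n ∸ k) j * binom (n ℕ.+ j) j)))
    ≡⟨ ∑-cong N (λ j _ → trans (∑-cong (suc n) (λ k _ → regroup (binom n k) (binom k j) (binom (n ∸ k) j) (binom (n ℕ.+ j) j)))
         (∑-*ˡ (suc n) (binom (n ℕ.+ j) j) _)) ⟩
  ∑ N (λ j → binom (n ℕ.+ j) j * pairs n j) ∎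
  where
  open ≡-Reasoning
  regroup : ∀ a b c d → a * (b * c * d) ≡ d * (a * b * c)
  regroup = solve-∀
  square : ∀ k → k ℕ.≤ n →
    binom n k * binom n k ≡ ∑ N (λ j → binom k j * binom (n ∸ k) j * binom (n ℕ.+ j) j)
  square k k≤n = begin
    binom n k * binom n k
      ≡⟨ cong (λ l → binom l k * binom l k) (sym (ℕ.m+[n∸m]≡n k≤n)) ⟩
    binom (k ℕ.+ (n ∸ k)) k * binom (k ℕ.+ (n ∸ k)) k
      ≡⟨ binom-square k (n ∸ k) ⟩
    ∑ (suc (n ∸ k)) (λ j → binom k j * binom (n ∸ k) j * binom (k ℕ.+ (n ∸ k) ℕ.+ j) j)
      ≡⟨ ∑-cong (suc (n ∸ k)) (λ j _ → cong (λ l → binom k j * binom (n ∸ k) j * binom (l ℕ.+ j) j) (ℕ.m+[n∸m]≡n k≤n)) ⟩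
    ∑ (suc (n ∸ k)) (λ j → binom k j * binom (n ∸ k) j * binom (n ℕ.+ j) j)
      ≡⟨ sym (∑-truncate _ (ℕ.≤-trans (s≤s (ℕ.m∸n≤m n k)) n<N) (λ j n-k<j →
           trans (cong (λ z → binom k j * z * binom (n ℕ.+ j) j) (binom-> n-k<j)) (annihilate (binom k j) (binom (n ℕ.+ j) j)))) ⟩
    ∑ N (λ j → binom k j * binom (n ∸ k) j * binom (n ℕ.+ j) j) ∎
    where
    annihilate : ∀ a b → a * 0ℤ * b ≡ 0ℤ
    annihilate = solve-∀

pairs-zero : ∀ {n} j → n ℕ.< j ℕ.+ j → pairs n j ≡ 0ℤ
pairs-zero {n} j n<2j = ∑-zero (suc n) (λ k _ → term k)
  where
  annihilateˡ : ∀ a b → a * 0ℤ * b ≡ 0ℤ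
  annihilateˡ = solve-∀
  term : ∀ k → binom n k * binom k j * binom (n ∸ k) j ≡ 0ℤ
  term k = Sum.[ (λ k<j → trans (cong (λ z → binom n k * z * binom (n ∸ k) j) (binom-> k<j)) (annihilateˡ (binom n k) (binom (n ∸ k) j)))
               , (λ j≤k → trans (cong (binom n k * binom k j *_) (binom-> (ℕ.m<n+o⇒m∸n<o n k {{ℕ.>-nonZero (pos j≤k)}} (ℕ.<-≤-trans n<2j (ℕ.+-monoˡ-≤ j j≤k)))))
                   (ℤ.*-zeroʳ (binom n k * binom k j))) ]′ (ℕ.<-≤-connex k j)
    where
    pos : j ℕ.≤ k → 0 ℕ.< j
    pos _ = ℕ.n≢0⇒n>0 (λ { refl → ℕ.n≮0 n<2j })

-- Choosing the marked elements first leaves `i` unmarked ones, each free to go to either part,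
-- whence `2 ^ i`.
pairs-value : ∀ j i → pairs (j ℕ.+ (j ℕ.+ i)) j ≡ binom (j ℕ.+ (j ℕ.+ i)) j * binom (j ℕ.+ i) j * (+ 2) ^ i
pairs-value j i = begin
  ∑ (suc n) g
    ≡⟨ cong (λ l → ∑ l g) (sym (ℕ.+-suc j (j ℕ.+ i))) ⟩
  ∑ (j ℕ.+ suc (j ℕ.+ i)) g
    ≡⟨ ∑-split j (suc (j ℕ.+ i)) g ⟩
  ∑ j g + ∑ (suc (j ℕ.+ i)) (λ k → g (j ℕ.+ k))
    ≡⟨ cong₂ _+_ (∑-zero j (λ k k<j → trans (cong (λ z → binom n k * z * binom (n ∸ k) j) (binom-> k<j)) (annihilate (binom n k) _)))
         (∑-cong (suc (j ℕ.+ i)) (λ k k<1+j+i → term k (ℕ.≤-pred k<1+j+i))) ⟩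
  0ℤ + ∑ (suc (j ℕ.+ i)) (λ k → binom n j * binom (j ℕ.+ i) j * binom i k)
    ≡⟨ trans (ℤ.+-identityˡ _) (∑-*ˡ (suc (j ℕ.+ i)) (binom n j * binom (j ℕ.+ i) j) (binom i)) ⟩
  binom n j * binom (j ℕ.+ i) j * ∑ (suc (j ℕ.+ i)) (binom i)
    ≡⟨ cong (binom n j * binom (j ℕ.+ i) j *_) (trans (∑-truncate (binom i) (s≤s (ℕ.m≤n+m i j)) (λ k i<k → binom-> i<k)) (∑-binom i)) ⟩
  binom n j * binom (j ℕ.+ i) j * (+ 2) ^ i ∎
  where
  open ≡-Reasoning
  n = j ℕ.+ (j ℕ.+ i)
  g : ℕ → ℤ
  g k = binom n k * binom k j * binom (n ∸ k) j
  annihilate : ∀ a b → a * 0ℤ * b ≡ 0ℤ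
  annihilate = solve-∀
  term : ∀ k → k ℕ.≤ j ℕ.+ i → g (j ℕ.+ k) ≡ binom n j * binom (j ℕ.+ i) j * binom i k
  term k k≤j+i = begin
    binom n (j ℕ.+ k) * binom (j ℕ.+ k) j * binom (n ∸ (j ℕ.+ k)) j
      ≡⟨ cong₂ (λ a l → a * binom l j) (binom-revision j (j ℕ.+ i) k) (ℕ.[m+n]∸[m+o]≡n∸o j (j ℕ.+ i) k) ⟩
    binom n j * binom (j ℕ.+ i) k * binom (j ℕ.+ i ∸ k) j
      ≡⟨ ℤ.*-assoc (binom n j) (binom (j ℕ.+ i) k) (binom (j ℕ.+ i ∸ k) j) ⟩
    binom n j * (binom (j ℕ.+ i) k * binom (j ℕ.+ i ∸ k) j)
      ≡⟨ cong (binom n j *_) (binom-exchange k j k≤j+i (ℕ.m≤m+n j i)) ⟩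
    binom n j * (binom (j ℕ.+ i) j * binom (j ℕ.+ i ∸ j) k)
      ≡⟨ cong (λ l → binom n j * (binom (j ℕ.+ i) j * binom l k)) (ℕ.m+n∸m≡n j i) ⟩
    binom n j * (binom (j ℕ.+ i) j * binom i k)
      ≡⟨ sym (ℤ.*-assoc (binom n j) (binom (j ℕ.+ i) j) (binom i k)) ⟩
    binom n j * binom (j ℕ.+ i) j * binom i k ∎

triple : ℕ → ℕ
triple j = j ℕ.+ (j ℕ.+ j)

trinomial : ℕ → ℤ
trinomial j = binom (triple j) j * binom (j ℕ.+ j) j

-- Both sides are the multinomial coefficient `(3j + i)! / ((j!)³ i!)`.
trinomial-revision : ∀ j i →
  binom (triple j ℕ.+ i) (triple j) * trinomial j
    ≡ binom (j ℕ.+ (j ℕ.+ (j ℕ.+ i))) j * (binom (j ℕ.+ (j ℕ.+ i)) j * binom (j ℕ.+ i) j)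
trinomial-revision j i = begin
  binom (triple j ℕ.+ i) (triple j) * (binom (triple j) j * binom (j ℕ.+ j) j)
    ≡⟨ cong (λ l → binom l (triple j) * (binom (triple j) j * binom (j ℕ.+ j) j))
         (trans (ℕ.+-assoc j (j ℕ.+ j) i) (cong (j ℕ.+_) (ℕ.+-assoc j j i))) ⟩
  binom (j ℕ.+ (j ℕ.+ (j ℕ.+ i))) (triple j) * (binom (triple j) j * binom (j ℕ.+ j) j)
    ≡⟨ sym (ℤ.*-assoc (binom (j ℕ.+ (j ℕ.+ (j ℕ.+ i))) (triple j)) _ _) ⟩
  binom (j ℕ.+ (j ℕ.+ (j ℕ.+ i))) (triple j) * binom (triple j) j * binom (j ℕ.+ j) j
    ≡⟨ cong (_* binom (j ℕ.+ j) j) (binom-revision j (j ℕ.+ (j ℕ.+ i)) (j ℕ.+ j)) ⟩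
  binom (j ℕ.+ (j ℕ.+ (j ℕ.+ i))) j * binom (j ℕ.+ (j ℕ.+ i)) (j ℕ.+ j) * binom (j ℕ.+ j) j
    ≡⟨ ℤ.*-assoc (binom (j ℕ.+ (j ℕ.+ (j ℕ.+ i))) j) _ _ ⟩
  binom (j ℕ.+ (j ℕ.+ (j ℕ.+ i))) j * (binom (j ℕ.+ (j ℕ.+ i)) (j ℕ.+ j) * binom (j ℕ.+ j) j)
    ≡⟨ cong (binom (j ℕ.+ (j ℕ.+ (j ℕ.+ i))) j *_) (binom-revision j (j ℕ.+ i) j) ⟩
  binom (j ℕ.+ (j ℕ.+ (j ℕ.+ i))) j * (binom (j ℕ.+ (j ℕ.+ i)) j * binom (j ℕ.+ i) j) ∎
  where open ≡-Reasoning

-- Isolates the dependence on `i`, where `n = 2j + i`, in the shape that `geometric` sums with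
-- `K = 3j` and `y = 2t`.
slice-term : ∀ t j i →
  binom (j ℕ.+ j ℕ.+ i ℕ.+ j) j * pairs (j ℕ.+ j ℕ.+ i) j * t ^ (j ℕ.+ j ℕ.+ i)
    ≡ trinomial j * (t * t) ^ j * (binom (triple j ℕ.+ i) (triple j) * (+ 2 * t) ^ i)
slice-term t j i = begin
  binom (j ℕ.+ j ℕ.+ i ℕ.+ j) j * pairs (j ℕ.+ j ℕ.+ i) j * t ^ (j ℕ.+ j ℕ.+ i)
    ≡⟨ cong₂ _*_ (cong₂ (λ l m → binom l j * pairs m j) (assoc₂ j i) (ℕ.+-assoc j j i)) (power i) ⟩
  binom (j ℕ.+ (j ℕ.+ (j ℕ.+ i))) j * pairs (j ℕ.+ (j ℕ.+ i)) j * ((t * t) ^ j * t ^ i)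
    ≡⟨ cong (λ z → binom (j ℕ.+ (j ℕ.+ (j ℕ.+ i))) j * z * ((t * t) ^ j * t ^ i)) (pairs-value j i) ⟩
  binom (j ℕ.+ (j ℕ.+ (j ℕ.+ i))) j * (binom (j ℕ.+ (j ℕ.+ i)) j * binom (j ℕ.+ i) j * (+ 2) ^ i) * ((t * t) ^ j * t ^ i)
    ≡⟨ regroup (binom (j ℕ.+ (j ℕ.+ (j ℕ.+ i))) j) (binom (j ℕ.+ (j ℕ.+ i)) j) (binom (j ℕ.+ i) j) ((+ 2) ^ i) ((t * t) ^ j) (t ^ i) ⟩
  binom (j ℕ.+ (j ℕ.+ (j ℕ.+ i))) j * (binom (j ℕ.+ (j ℕ.+ i)) j * binom (j ℕ.+ i) j) * (t * t) ^ j * ((+ 2) ^ i * t ^ i)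
    ≡⟨ cong₂ (λ a b → a * (t * t) ^ j * b) (sym (trinomial-revision j i)) (sym (^-distribʳ-* (+ 2) t i)) ⟩
  binom (triple j ℕ.+ i) (triple j) * trinomial j * (t * t) ^ j * (+ 2 * t) ^ i
    ≡⟨ regroup′ (binom (triple j ℕ.+ i) (triple j)) (trinomial j) ((t * t) ^ j) ((+ 2 * t) ^ i) ⟩
  trinomial j * (t * t) ^ j * (binom (triple j ℕ.+ i) (triple j) * (+ 2 * t) ^ i) ∎
  where
  open ≡-Reasoning
  power : ∀ i → t ^ (j ℕ.+ j ℕ.+ i) ≡ (t * t) ^ j * t ^ i
  power i = trans (ℤ.^-distribˡ-+-* t (j ℕ.+ j) i)
    (cong (_* t ^ i) (trans (ℤ.^-distribˡ-+-* t j j) (sym (^-distribʳ-* t t j))))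
  regroup : ∀ a b c u v w → a * (b * c * u) * (v * w) ≡ a * (b * c) * v * (u * w)
  regroup = solve-∀
  regroup′ : ∀ a b v w → a * b * v * w ≡ b * v * (a * w)
  regroup′ = solve-∀
  assoc₂ : ∀ j i → j ℕ.+ j ℕ.+ i ℕ.+ j ≡ j ℕ.+ (j ℕ.+ (j ℕ.+ i))
  assoc₂ = ℕ-Solver.solve-∀

-- Reduction of the sums over `Q` to Franel sums, and of these to trinomial sums.

module FranelSums (q : ℕ) (p-prime : Prime (suc q)) where

  open PrimeModulus q p-prime

  inverse-power : ∀ {e d k} → e * d ≈ 1ℤ → k ℕ.≤ q → d ^ (q ∸ k) ≈ e ^ k
  inverse-power {e} {d} {k} inverse k≤q = begin
    d ^ (q ∸ k)                      ≡⟨ sym (ℤ.*-identityˡ (d ^ (q ∸ k))) ⟩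
    1ℤ * d ^ (q ∸ k)                 ≡⟨ cong (_* d ^ (q ∸ k)) (sym (ℤ.^-zeroˡ k)) ⟩
    1ℤ ^ k * d ^ (q ∸ k)             ≈⟨ *-congʳ (d ^ (q ∸ k)) (^-cong k (≈-sym inverse)) ⟩
    (e * d) ^ k * d ^ (q ∸ k)        ≡⟨ cong (_* d ^ (q ∸ k)) (^-distribʳ-* e d k) ⟩
    e ^ k * d ^ k * d ^ (q ∸ k)      ≡⟨ ℤ.*-assoc (e ^ k) (d ^ k) (d ^ (q ∸ k)) ⟩
    e ^ k * (d ^ k * d ^ (q ∸ k))    ≡⟨ cong (e ^ k *_) (trans (sym (ℤ.^-distribˡ-+-* d k (q ∸ k))) (cong (d ^_) (ℕ.m+[n∸m]≡n k≤q))) ⟩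
    e ^ k * d ^ q                    ≈⟨ *-congˡ (e ^ k) (fermat₁ d≉0) ⟩
    e ^ k * 1ℤ                       ≡⟨ ℤ.*-identityʳ (e ^ k) ⟩
    e ^ k                            ∎
    where
    open ≈-Reasoning
    d≉0 : d ≉ 0ℤ
    d≉0 d≈0 = 1≉0 (≈-trans (≈-sym inverse) (≈-trans (*-congˡ e d≈0) (≡⇒≈ (ℤ.*-zeroʳ e))))

  -- For fixed `k` the sum over `n` is `x^k (1 + 8x)^(q - k)` by `geometric`. As `e` inverts
  -- `1 + 8x` and `(1 + 8x)^q ≡ 1`, this is `(e x)^k`.
  Q-sum : ∀ x e → e * (1ℤ + + 8 * x) ≈ 1ℤ → ∑ p (λ n → Q n * x ^ n) ≈ ∑ p (λ k → franel k * (e * x) ^ k)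
  Q-sum x e inverse = begin
    ∑ p (λ n → Q n * x ^ n)
      ≡⟨ ∑-cong p (λ n n<p → expand n n<p) ⟩
    ∑ p (λ n → ∑ p (λ k → franel k * (binom n k * (- + 8) ^ (n ∸ k) * x ^ n)))
      ≡⟨ ∑-swap p p _ ⟩
    ∑ p (λ k → ∑ p (λ n → franel k * (binom n k * (- + 8) ^ (n ∸ k) * x ^ n)))
      ≡⟨ ∑-cong p (λ k _ → ∑-*ˡ p (franel k) _) ⟩
    ∑ p (λ k → franel k * ∑ p (λ n → binom n k * (- + 8) ^ (n ∸ k) * x ^ n))
      ≈⟨ ∑-cong≈ p (λ k k<p → *-congˡ (franel k) (column k (ℕ.≤-pred k<p))) ⟩
    ∑ p (λ k → franel k * (e * x) ^ k) ∎
    where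
    open ≈-Reasoning
    y d : ℤ
    y = - + 8 * x
    d = 1ℤ + + 8 * x
    regroup : ∀ a b c u → a * b * c * u ≡ c * (a * b * u)
    regroup = solve-∀
    annihilate : ∀ b c u → c * (0ℤ * b * u) ≡ 0ℤ
    annihilate = solve-∀
    expand : ∀ n → n ℕ.< p → Q n * x ^ n ≡ ∑ p (λ k → franel k * (binom n k * (- + 8) ^ (n ∸ k) * x ^ n))
    expand n n<p = trans (cong (_* x ^ n) (sumℤ-∑ n _)) (trans (sym (∑-*ʳ (suc n) (x ^ n) _))
      (trans (∑-cong (suc n) (λ k _ → regroup (binom n k) ((- + 8) ^ (n ∸ k)) (franel k) (x ^ n)))
        (sym (∑-truncate _ n<p (λ k n<k → trans (cong (λ z → franel k * (z * (- + 8) ^ (n ∸ k) * x ^ n)) (binom-> n<k))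
          (annihilate ((- + 8) ^ (n ∸ k)) (franel k) (x ^ n)))))))
    column : ∀ k → k ℕ.≤ q → ∑ p (λ n → binom n k * (- + 8) ^ (n ∸ k) * x ^ n) ≈ (e * x) ^ k
    column k k≤q = begin
      ∑ p g
        ≡⟨ cong (λ l → ∑ l g) (sym (trans (ℕ.+-suc k (q ∸ k)) (cong suc (ℕ.m+[n∸m]≡n k≤q)))) ⟩
      ∑ (k ℕ.+ suc (q ∸ k)) g
        ≡⟨ ∑-split k (suc (q ∸ k)) g ⟩
      ∑ k g + ∑ (suc (q ∸ k)) (λ i → g (k ℕ.+ i))
        ≡⟨ cong₂ _+_ (∑-zero k (λ n n<k → cong (λ z → z * (- + 8) ^ (n ∸ k) * x ^ n) (binom-> n<k)))
             (∑-cong (suc (q ∸ k)) (λ i _ → term i)) ⟩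
      0ℤ + ∑ (suc (q ∸ k)) (λ i → x ^ k * (binom (k ℕ.+ i) k * y ^ i))
        ≡⟨ trans (ℤ.+-identityˡ _) (∑-*ˡ (suc (q ∸ k)) (x ^ k) _) ⟩
      x ^ k * ∑ (suc (q ∸ k)) (λ i → binom (k ℕ.+ i) k * y ^ i)
        ≈⟨ *-congˡ (x ^ k) (geometric k (q ∸ k) y (ℕ.m+[n∸m]≡n k≤q)) ⟩
      x ^ k * (1ℤ - y) ^ (q ∸ k)
        ≡⟨ cong (λ z → x ^ k * z ^ (q ∸ k)) (double-neg x) ⟩
      x ^ k * d ^ (q ∸ k)
        ≈⟨ *-congˡ (x ^ k) (inverse-power inverse k≤q) ⟩
      x ^ k * e ^ k
        ≡⟨ trans (ℤ.*-comm (x ^ k) (e ^ k)) (sym (^-distribʳ-* e x k)) ⟩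
      (e * x) ^ k ∎
      where
      g : ℕ → ℤ
      g n = binom n k * (- + 8) ^ (n ∸ k) * x ^ n
      double-neg : ∀ x → 1ℤ - - + 8 * x ≡ 1ℤ + + 8 * x
      double-neg = solve-∀
      regroup′ : ∀ a b c d → a * b * (c * d) ≡ c * (a * (b * d))
      regroup′ = solve-∀
      term : ∀ i → g (k ℕ.+ i) ≡ x ^ k * (binom (k ℕ.+ i) k * y ^ i)
      term i = trans (cong₂ (λ l z → binom (k ℕ.+ i) k * (- + 8) ^ l * z) (ℕ.m+n∸m≡n k i) (ℤ.^-distribˡ-+-* x k i))
        (trans (regroup′ (binom (k ℕ.+ i) k) ((- + 8) ^ i) (x ^ k) (x ^ i))
          (cong (λ z → x ^ k * (binom (k ℕ.+ i) k * z)) (sym (^-distribʳ-* (- + 8) x i))))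

  slice : ℤ → ℕ → ℤ
  slice t j = ∑ p (λ n → binom (n ℕ.+ j) j * pairs n j * t ^ n)

  -- A nonzero term needs `n ≥ 2j`, hence `n + j ≥ 3j ≥ p`. Then `n + j = p + r` with `r < j`, and
  -- `binom≈0` applies.
  slice-large : ∀ t j → j ℕ.< p → q ℕ.< triple j → slice t j ≈ 0ℤ
  slice-large t j j<p q<3j = ∑-zero≈ p (λ n n<p →
    Sum.[ (λ n<2j → ≡⇒≈ (cong (_* t ^ n) (trans (cong (binom (n ℕ.+ j) j *_) (pairs-zero j n<2j)) (ℤ.*-zeroʳ (binom (n ℕ.+ j) j)))))
        , (λ 2j≤n → *-congʳ (t ^ n) (*-congʳ (pairs n j) (vanish n n<p 2j≤n))) ]′ (ℕ.<-≤-connex n (j ℕ.+ j)))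
    where
    vanish : ∀ n → n ℕ.< p → j ℕ.+ j ℕ.≤ n → binom (n ℕ.+ j) j ≈ 0ℤ
    vanish n n<p 2j≤n = subst (λ l → binom l j ≈ 0ℤ) eq (binom≈0 r<j j<p)
      where
      p≤n+j : p ℕ.≤ n ℕ.+ j
      p≤n+j = ℕ.≤-trans q<3j (ℕ.≤-trans (ℕ.≤-reflexive (ℕ.+-comm j (j ℕ.+ j))) (ℕ.+-monoˡ-≤ j 2j≤n))
      eq : p ℕ.+ (n ℕ.+ j ∸ p) ≡ n ℕ.+ j
      eq = ℕ.m+[n∸m]≡n p≤n+j
      r<j : n ℕ.+ j ∸ p ℕ.< j
      r<j = ℕ.+-cancelˡ-< p _ _ (subst (ℕ._< p ℕ.+ j) (sym eq) (ℕ.+-monoˡ-< j n<p))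

  -- The indices `n` fall into three ranges: below `2j` there are no pairs, the next `L + 1` values
  -- form the sum of `geometric`, and for the last `j` values `n + j` is at least `p`, so that
  -- `binom≈0` removes them.
  slice-small : ∀ t j L → j ℕ.< p → triple j ℕ.+ L ≡ q → slice t j ≈ trinomial j * (t * t) ^ j * (1ℤ - + 2 * t) ^ L
  slice-small t j L j<p 3j+L≡q = begin
    ∑ p g
      ≡⟨ cong (λ l → ∑ l g) (trans (cong suc (sym 3j+L≡q)) (arrange j L)) ⟩
    ∑ (j ℕ.+ j ℕ.+ (suc L ℕ.+ j)) g
      ≡⟨ ∑-split (j ℕ.+ j) (suc L ℕ.+ j) g ⟩
    ∑ (j ℕ.+ j) g + ∑ (suc L ℕ.+ j) (λ i → g (j ℕ.+ j ℕ.+ i))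
      ≡⟨ cong₂ _+_ (∑-zero (j ℕ.+ j) (λ n n<2j → cong (_* t ^ n) (trans (cong (binom (n ℕ.+ j) j *_) (pairs-zero j n<2j)) (ℤ.*-zeroʳ (binom (n ℕ.+ j) j)))))
           (∑-split (suc L) j (λ i → g (j ℕ.+ j ℕ.+ i))) ⟩
    0ℤ + (∑ (suc L) (λ i → g (j ℕ.+ j ℕ.+ i)) + ∑ j (λ i → g (j ℕ.+ j ℕ.+ (suc L ℕ.+ i))))
      ≈⟨ ≈-trans (≡⇒≈ (ℤ.+-identityˡ _)) (+-cong (≡⇒≈ (∑-cong (suc L) (λ i _ → slice-term t j i))) (∑-zero≈ j (λ i i<j → tail i i<j))) ⟩
    ∑ (suc L) (λ i → trinomial j * (t * t) ^ j * (binom (triple j ℕ.+ i) (triple j) * (+ 2 * t) ^ i)) + 0ℤ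
      ≡⟨ trans (ℤ.+-identityʳ _) (∑-*ˡ (suc L) (trinomial j * (t * t) ^ j) _) ⟩
    trinomial j * (t * t) ^ j * ∑ (suc L) (λ i → binom (triple j ℕ.+ i) (triple j) * (+ 2 * t) ^ i)
      ≈⟨ *-congˡ (trinomial j * (t * t) ^ j) (geometric (triple j) L (+ 2 * t) 3j+L≡q) ⟩
    trinomial j * (t * t) ^ j * (1ℤ - + 2 * t) ^ L ∎
    where
    open ≈-Reasoning
    g : ℕ → ℤ
    g n = binom (n ℕ.+ j) j * pairs n j * t ^ n
    arrange : ∀ j L → 1 ℕ.+ (j ℕ.+ (j ℕ.+ j) ℕ.+ L) ≡ j ℕ.+ j ℕ.+ (1 ℕ.+ L ℕ.+ j)
    arrange = ℕ-Solver.solve-∀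
    carry : ∀ j L i → j ℕ.+ j ℕ.+ (1 ℕ.+ L ℕ.+ i) ℕ.+ j ≡ 1 ℕ.+ (j ℕ.+ (j ℕ.+ j) ℕ.+ L) ℕ.+ i
    carry = ℕ-Solver.solve-∀
    tail : ∀ i → i ℕ.< j → g (j ℕ.+ j ℕ.+ (suc L ℕ.+ i)) ≈ 0ℤ
    tail i i<j = *-congʳ (t ^ (j ℕ.+ j ℕ.+ (suc L ℕ.+ i))) (*-congʳ (pairs (j ℕ.+ j ℕ.+ (suc L ℕ.+ i)) j)
      (subst (λ l → binom l j ≈ 0ℤ) (sym (trans (carry j L i) (cong (λ l → suc l ℕ.+ i) 3j+L≡q))) (binom≈0 i<j j<p)))

  franel-sum : ∀ t a → triple a ℕ.≤ q → q ℕ.< triple (suc a) →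
    ∑ p (λ n → franel n * t ^ n) ≈ ∑ (suc a) (λ j → trinomial j * (t * t) ^ j * (1ℤ - + 2 * t) ^ (q ∸ triple j))
  franel-sum t a 3a≤q q<3a+3 = begin
    ∑ p (λ n → franel n * t ^ n)
      ≡⟨ ∑-cong p (λ n n<p → trans (cong (_* t ^ n) (franel-pairs n<p)) (sym (∑-*ʳ p (t ^ n) _))) ⟩
    ∑ p (λ n → ∑ p (λ j → binom (n ℕ.+ j) j * pairs n j * t ^ n))
      ≡⟨ ∑-swap p p _ ⟩
    ∑ p (slice t)
      ≡⟨ cong (λ l → ∑ l (slice t)) (sym (ℕ.m+[n∸m]≡n a<p)) ⟩
    ∑ (suc a ℕ.+ (p ∸ suc a)) (slice t)
      ≡⟨ ∑-split (suc a) (p ∸ suc a) (slice t) ⟩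
    ∑ (suc a) (slice t) + ∑ (p ∸ suc a) (λ i → slice t (suc a ℕ.+ i))
      ≈⟨ +-cong (∑-cong≈ (suc a) (λ j j≤a → small j (ℕ.≤-pred j≤a))) (∑-zero≈ (p ∸ suc a) (λ i i< → large i i<)) ⟩
    ∑ (suc a) (λ j → trinomial j * (t * t) ^ j * (1ℤ - + 2 * t) ^ (q ∸ triple j)) + 0ℤ
      ≡⟨ ℤ.+-identityʳ _ ⟩
    ∑ (suc a) (λ j → trinomial j * (t * t) ^ j * (1ℤ - + 2 * t) ^ (q ∸ triple j)) ∎
    where
    open ≈-Reasoning
    a<p : a ℕ.< p
    a<p = s≤s (ℕ.≤-trans (ℕ.m≤m+n a (a ℕ.+ a)) 3a≤q)
    triple-mono : ∀ {i j} → i ℕ.≤ j → triple i ℕ.≤ triple j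
    triple-mono i≤j = ℕ.+-mono-≤ i≤j (ℕ.+-mono-≤ i≤j i≤j)
    small : ∀ j → j ℕ.≤ a → slice t j ≈ trinomial j * (t * t) ^ j * (1ℤ - + 2 * t) ^ (q ∸ triple j)
    small j j≤a = slice-small t j (q ∸ triple j) (ℕ.≤-<-trans j≤a a<p) (ℕ.m+[n∸m]≡n (ℕ.≤-trans (triple-mono j≤a) 3a≤q))
    large : ∀ i → i ℕ.< p ∸ suc a → slice t (suc a ℕ.+ i) ≈ 0ℤ
    large i i< = slice-large t (suc a ℕ.+ i) (subst (suc a ℕ.+ i ℕ.<_) (ℕ.m+[n∸m]≡n a<p) (ℕ.+-monoʳ-< (suc a) i<))
      (ℕ.<-≤-trans q<3a+3 (triple-mono (ℕ.m≤m+n (suc a) i)))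

-- Recurrences of central binomial and trinomial coefficients.

binom-up : ∀ n k → (+ suc n - + k) * binom (suc n) k ≡ + suc n * binom n k
binom-up n k = trans (sym (binom-step (suc n) k)) (binom-absorb n k)

central-step : ∀ j → + suc j * binom (suc j ℕ.+ suc j) (suc j) ≡ + 2 * (+ j + + j + 1ℤ) * binom (j ℕ.+ j) j
central-step j = ℤ.*-cancelˡ-≡ (+ suc j) _ _ (begin
  + suc j * (+ suc j * binom (suc j ℕ.+ suc j) (suc j))
    ≡⟨ cong (λ n → + suc j * (+ suc j * binom (suc n) (suc j))) (ℕ.+-suc j j) ⟩
  + suc j * (+ suc j * binom (2 ℕ.+ (j ℕ.+ j)) (suc j))
    ≡⟨ cong (+ suc j *_) (binom-absorb (suc (j ℕ.+ j)) j) ⟩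
  + suc j * ((1ℤ + (1ℤ + (J + J))) * binom (suc (j ℕ.+ j)) j)
    ≡⟨ regroup J (binom (suc (j ℕ.+ j)) j) ⟩
  (1ℤ + (1ℤ + (J + J))) * ((1ℤ + (J + J) - J) * binom (suc (j ℕ.+ j)) j)
    ≡⟨ cong ((1ℤ + (1ℤ + (J + J))) *_) (binom-up (j ℕ.+ j) j) ⟩
  (1ℤ + (1ℤ + (J + J))) * ((1ℤ + (J + J)) * binom (j ℕ.+ j) j)
    ≡⟨ factor J (binom (j ℕ.+ j) j) ⟩
  + suc j * (+ 2 * (J + J + 1ℤ) * binom (j ℕ.+ j) j) ∎)
  where
  open ≡-Reasoning
  J = + j
  regroup : ∀ J c → (1ℤ + J) * ((1ℤ + (1ℤ + (J + J))) * c) ≡ (1ℤ + (1ℤ + (J + J))) * ((1ℤ + (J + J) - J) * c)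
  regroup = solve-∀
  factor : ∀ J c → (1ℤ + (1ℤ + (J + J))) * ((1ℤ + (J + J)) * c) ≡ (1ℤ + J) * (+ 2 * (J + J + 1ℤ) * c)
  factor = solve-∀

triple-binom-step : ∀ j → + suc j * (+ 2 * (+ j + + j + 1ℤ)) * binom (triple (suc j)) (suc j)
  ≡ + 3 * ((+ 3 * + j + 1ℤ) * (+ 3 * + j + + 2)) * binom (triple j) j
triple-binom-step j = ℤ.*-cancelˡ-≡ (+ suc j) _ _ (begin
  + suc j * (+ suc j * (+ 2 * (J + J + 1ℤ)) * binom (triple (suc j)) (suc j))
    ≡⟨ regroup₁ J (binom (triple (suc j)) (suc j)) ⟩
  d₁ * (d₂ * (+ suc j * binom (triple (suc j)) (suc j)))
    ≡⟨ cong (λ n → d₁ * (d₂ * (+ suc j * binom n (suc j)))) (triple-suc j) ⟩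
  d₁ * (d₂ * (+ suc j * binom (3 ℕ.+ triple j) (suc j)))
    ≡⟨ cong (λ z → d₁ * (d₂ * z)) (binom-absorb (2 ℕ.+ triple j) j) ⟩
  d₁ * (d₂ * (n₃ * binom (2 ℕ.+ triple j) j))
    ≡⟨ swap₁ d₁ d₂ n₃ _ ⟩
  n₃ * (d₁ * (d₂ * binom (2 ℕ.+ triple j) j))
    ≡⟨ cong (λ z → n₃ * (d₁ * z)) (binom-up (1 ℕ.+ triple j) j) ⟩
  n₃ * (d₁ * (n₂ * binom (1 ℕ.+ triple j) j))
    ≡⟨ cong (n₃ *_) (swap₂ d₁ n₂ _) ⟩
  n₃ * (n₂ * (d₁ * binom (1 ℕ.+ triple j) j))
    ≡⟨ cong (λ z → n₃ * (n₂ * z)) (binom-up (triple j) j) ⟩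
  n₃ * (n₂ * (n₁ * binom (triple j) j))
    ≡⟨ regroup₂ J (binom (triple j) j) ⟩
  + suc j * (+ 3 * ((+ 3 * J + 1ℤ) * (+ 3 * J + + 2)) * binom (triple j) j) ∎)
  where
  open ≡-Reasoning
  J n₁ n₂ n₃ d₁ d₂ : ℤ
  J = + j
  n₁ = 1ℤ + (J + (J + J))
  n₂ = 1ℤ + (1ℤ + (J + (J + J)))
  n₃ = 1ℤ + (1ℤ + (1ℤ + (J + (J + J))))
  d₁ = n₁ - J
  d₂ = n₂ - J
  triple-suc : ∀ j → (1 ℕ.+ j) ℕ.+ ((1 ℕ.+ j) ℕ.+ (1 ℕ.+ j)) ≡ 3 ℕ.+ (j ℕ.+ (j ℕ.+ j))
  triple-suc = ℕ-Solver.solve-∀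
  regroup₁ : ∀ J c → (1ℤ + J) * ((1ℤ + J) * (+ 2 * (J + J + 1ℤ)) * c)
    ≡ (1ℤ + (J + (J + J)) - J) * ((1ℤ + (1ℤ + (J + (J + J))) - J) * ((1ℤ + J) * c))
  regroup₁ = solve-∀
  regroup₂ : ∀ J c → (1ℤ + (1ℤ + (1ℤ + (J + (J + J))))) * ((1ℤ + (1ℤ + (J + (J + J)))) * ((1ℤ + (J + (J + J))) * c))
    ≡ (1ℤ + J) * (+ 3 * ((+ 3 * J + 1ℤ) * (+ 3 * J + + 2)) * c)
  regroup₂ = solve-∀
  swap₁ : ∀ a b c d → a * (b * (c * d)) ≡ c * (a * (b * d))
  swap₁ = solve-∀
  swap₂ : ∀ a b c → a * (b * c) ≡ b * (a * c)
  swap₂ = solve-∀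

trinomial-step : ∀ j → + suc j * + suc j * trinomial (suc j) ≡ + 3 * ((+ 3 * + j + 1ℤ) * (+ 3 * + j + + 2)) * trinomial j
-- The cancelled factor is `2(2j + 1)`, which the recurrences of the two binomial factors bring in
-- on opposite sides; as a successor it is visibly nonzero.
trinomial-step j = ℤ.*-cancelˡ-≡ (+ suc (suc (j ℕ.+ j ℕ.+ (j ℕ.+ j)))) _ _ (begin
  + suc (suc (j ℕ.+ j ℕ.+ (j ℕ.+ j))) * (+ suc j * + suc j * (x * y))
    ≡⟨ split (+ j) x y ⟩
  (+ suc j * (+ 2 * (+ j + + j + 1ℤ)) * x) * (+ suc j * y)
    ≡⟨ cong₂ _*_ (triple-binom-step j) (central-step j) ⟩
  (+ 3 * ((+ 3 * + j + 1ℤ) * (+ 3 * + j + + 2)) * binom (triple j) j) * (+ 2 * (+ j + + j + 1ℤ) * binom (j ℕ.+ j) j)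
    ≡⟨ join (+ j) (binom (triple j) j) (binom (j ℕ.+ j) j) ⟩
  + suc (suc (j ℕ.+ j ℕ.+ (j ℕ.+ j))) * (+ 3 * ((+ 3 * + j + 1ℤ) * (+ 3 * + j + + 2)) * trinomial j) ∎)
  where
  open ≡-Reasoning
  x y : ℤ
  x = binom (triple (suc j)) (suc j)
  y = binom (suc j ℕ.+ suc j) (suc j)
  split : ∀ J x y → (1ℤ + (1ℤ + (J + J + (J + J)))) * ((1ℤ + J) * (1ℤ + J) * (x * y))
    ≡ ((1ℤ + J) * (+ 2 * (J + J + 1ℤ)) * x) * ((1ℤ + J) * y)
  split = solve-∀
  join : ∀ J x y → (+ 3 * ((+ 3 * J + 1ℤ) * (+ 3 * J + + 2)) * x) * (+ 2 * (J + J + 1ℤ) * y)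
    ≡ (1ℤ + (1ℤ + (J + J + (J + J)))) * (+ 3 * ((+ 3 * J + 1ℤ) * (+ 3 * J + + 2)) * (x * y))
  join = solve-∀

-- Trinomial and central coefficients modulo p; a Legendre polynomial at 0.

module BinomialCongruences (q : ℕ) (p-prime : Prime (suc q)) where

  open PrimeModulus q p-prime

  -- The two hypotheses say that `a` and `b` are -1/3 and -2/3 modulo `p` in some order. So
  -- `27 (a - j)(b - j)` agrees with `3 (3j + 1)(3j + 2)`, and both sides satisfy the same
  -- recurrence. Stating the hypothesis as a product covers both classes of `p` modulo 3.
  trinomial≈ : ∀ a b → a ℕ.+ b ≡ q → (+ 3 * + a + 1ℤ) * (+ 3 * + a + + 2) ≈ 0ℤ →
    ∀ j → j ℕ.< p → trinomial j ≈ binom a j * binom b j * (+ 27) ^ j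
  trinomial≈ a b a+b≡q third zero    j<p = ≡⇒≈ refl
  trinomial≈ a b a+b≡q third (suc j) (s≤s j<q) = *-cancelˡ≈ (*-≉0 (small≉0 j<q) (small≉0 j<q)) (begin
    + suc j * + suc j * trinomial (suc j)
      ≡⟨ trinomial-step j ⟩
    + 3 * ((+ 3 * + j + 1ℤ) * (+ 3 * + j + + 2)) * trinomial j
      ≈⟨ *-cong coefficient (trinomial≈ a b a+b≡q third j (s≤s (ℕ.<⇒≤ j<q))) ⟩
    + 27 * ((+ a - + j) * (+ b - + j)) * (binom a j * binom b j * (+ 27) ^ j)
      ≡⟨ regroup (+ a - + j) (+ b - + j) (binom a j) (binom b j) ((+ 27) ^ j) ⟩
    ((+ a - + j) * binom a j) * ((+ b - + j) * binom b j) * (+ 27 * (+ 27) ^ j)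
      ≡⟨ cong₂ (λ u v → u * v * (+ 27 * (+ 27) ^ j)) (sym (binom-step a j)) (sym (binom-step b j)) ⟩
    (+ suc j * binom a (suc j)) * (+ suc j * binom b (suc j)) * (+ 27 * (+ 27) ^ j)
      ≡⟨ regroup′ (+ suc j) (binom a (suc j)) (binom b (suc j)) (+ 27 * (+ 27) ^ j) ⟩
    + suc j * + suc j * (binom a (suc j) * binom b (suc j) * (+ 27) ^ suc j) ∎)
    where
    open ≈-Reasoning
    regroup : ∀ u v x y z → + 27 * (u * v) * (x * y * z) ≡ (u * x) * (v * y) * (+ 27 * z)
    regroup = solve-∀
    regroup′ : ∀ s x y z → (s * x) * (s * y) * z ≡ s * s * (x * y * z)
    regroup′ = solve-∀
    -- The difference of the two coefficients as an explicit combination of the quantities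
    -- `(3a + 1)(3a + 2)` and `a + b + 1`, both of which vanish modulo `p`.
    complete : ∀ a b j → + 27 * ((a - j) * (b - j))
      ≡ + 3 * ((+ 3 * j + 1ℤ) * (+ 3 * j + + 2)) + (- + 3 * ((+ 3 * a + 1ℤ) * (+ 3 * a + + 2)) + + 27 * (a - j) * (a + b + 1ℤ))
    complete = solve-∀
    coefficient : + 3 * ((+ 3 * + j + 1ℤ) * (+ 3 * + j + + 2)) ≈ + 27 * ((+ a - + j) * (+ b - + j))
    coefficient = ≈-sym (begin
      + 27 * ((+ a - + j) * (+ b - + j))
        ≡⟨ complete (+ a) (+ b) (+ j) ⟩
      c + (- + 3 * ((+ 3 * + a + 1ℤ) * (+ 3 * + a + + 2)) + + 27 * (+ a - + j) * (+ (a ℕ.+ b) + 1ℤ))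
        ≈⟨ +-congˡ c (+-cong (*-congˡ (- + 3) third) (*-congˡ (+ 27 * (+ a - + j)) (≈-trans (≡⇒≈ (cong (λ n → + n + 1ℤ) a+b≡q)) (+-congʳ 1ℤ q≈-1)))) ⟩
      c + (- + 3 * 0ℤ + + 27 * (+ a - + j) * 0ℤ)
        ≡⟨ cong (λ z → c + z) (cong (λ z → - + 3 * 0ℤ + z) (ℤ.*-zeroʳ (+ 27 * (+ a - + j)))) ⟩
      c + 0ℤ
        ≡⟨ ℤ.+-identityʳ c ⟩
      c ∎)
      where
      c = + 3 * ((+ 3 * + j + 1ℤ) * (+ 3 * + j + + 2))

  -- The identity `C(2k, k) = (-4)^k C(-1/2, k)`, with `n` in the place of -1/2.
  central≈ : ∀ n → + 2 * + n ≈ -1ℤ → ∀ k → k ℕ.< p → binom (k ℕ.+ k) k ≈ (- + 4) ^ k * binom n k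
  central≈ n half zero    k<p = ≡⇒≈ refl
  central≈ n half (suc k) (s≤s k<q) = *-cancelˡ≈ (small≉0 k<q) (begin
    + suc k * binom (suc k ℕ.+ suc k) (suc k)
      ≡⟨ central-step k ⟩
    + 2 * (+ k + + k + 1ℤ) * binom (k ℕ.+ k) k
      ≈⟨ *-cong coefficient (central≈ n half k (s≤s (ℕ.<⇒≤ k<q))) ⟩
    - + 4 * (+ n - + k) * ((- + 4) ^ k * binom n k)
      ≡⟨ regroup (+ n - + k) ((- + 4) ^ k) (binom n k) ⟩
    - + 4 * (- + 4) ^ k * ((+ n - + k) * binom n k)
      ≡⟨ cong (- + 4 * (- + 4) ^ k *_) (sym (binom-step n k)) ⟩
    - + 4 * (- + 4) ^ k * (+ suc k * binom n (suc k))
      ≡⟨ regroup′ (- + 4 * (- + 4) ^ k) (+ suc k) (binom n (suc k)) ⟩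
    + suc k * ((- + 4) ^ suc k * binom n (suc k)) ∎)
    where
    open ≈-Reasoning
    regroup : ∀ u v w → - + 4 * u * (v * w) ≡ - + 4 * v * (u * w)
    regroup = solve-∀
    regroup′ : ∀ u v w → u * (v * w) ≡ v * (u * w)
    regroup′ = solve-∀
    complete : ∀ n k → - + 4 * (n - k) ≡ - + 2 * (+ 2 * n) + + 4 * k
    complete = solve-∀
    collect : ∀ k → - + 2 * -1ℤ + + 4 * k ≡ + 2 * (k + k + 1ℤ)
    collect = solve-∀
    coefficient : + 2 * (+ k + + k + 1ℤ) ≈ - + 4 * (+ n - + k)
    coefficient = ≈-sym (begin
      - + 4 * (+ n - + k)               ≡⟨ complete (+ n) (+ k) ⟩
      - + 2 * (+ 2 * + n) + + 4 * + k   ≈⟨ +-congʳ (+ 4 * + k) (*-congˡ (- + 2) half) ⟩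
      - + 2 * -1ℤ + + 4 * + k           ≡⟨ collect (+ k) ⟩
      + 2 * (+ k + + k + 1ℤ)            ∎)

  -- A shift by one changes the sum by `g (p + h) - g h`, which vanishes modulo `p`.
  ∑-translate : (g : ℤ → ℤ) → (∀ {x y} → x ≈ y → g x ≈ g y) → ∀ h → ∑ p (λ x → g (+ (x ℕ.+ h))) ≈ ∑ p (λ x → g (+ x))
  ∑-translate g resp zero    = ≡⇒≈ (∑-cong p (λ x _ → cong (λ y → g (+ y)) (ℕ.+-identityʳ x)))
  ∑-translate g resp (suc h) = ≈-trans (-≈0⇒≈ (begin
    ∑ p (λ x → g (+ (x ℕ.+ suc h))) - ∑ p (λ x → g (+ (x ℕ.+ h)))
      ≡⟨ cong (_- ∑ p (λ x → g (+ (x ℕ.+ h)))) (∑-cong p (λ x _ → cong (λ y → g (+ y)) (ℕ.+-suc x h))) ⟩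
    ∑ p (λ x → g (+ (suc x ℕ.+ h))) - ∑ p (λ x → g (+ (x ℕ.+ h)))
      ≡⟨ sym (∑-sub p (λ x → g (+ (suc x ℕ.+ h))) (λ x → g (+ (x ℕ.+ h)))) ⟩
    ∑ p (λ x → g (+ (suc x ℕ.+ h)) - g (+ (x ℕ.+ h)))
      ≡⟨ ∑-telescope p (λ x → g (+ (x ℕ.+ h))) ⟩
    g (+ (p ℕ.+ h)) - g (+ h)
      ≈⟨ ≈⇒-≈0 (resp (≈-trans (+-congʳ (+ h) p≈0) (≡⇒≈ (ℤ.+-identityˡ (+ h))))) ⟩
    0ℤ ∎)) (∑-translate g resp h)
    where open ≈-Reasoning

  -- When `a + b = q`, `binom b j` is `(-1)^j C(a + j, j)` modulo `p`, so this is the Legendre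
  -- polynomial of degree `a` at `1 - 2h`; the case of interest is `2h ≡ 1`.
  twisted : ℕ → ℕ → ℕ → ℤ
  twisted h a b = ∑ (suc a) (λ j → binom a j * binom b j * (+ h) ^ j)

  -- Only the coefficient of the q-th power survives summation over all residues, and both
  -- sums below are over the same polynomial, written in x and in x + h.
  module _ (h a b : ℕ) (2h≈1 : + 2 * + h ≈ 1ℤ) (a+b≡q : a ℕ.+ b ≡ q) (a≤b : a ℕ.≤ b) (0<a : 0 ℕ.< a) where

    private
      H : ℤ
      H = + h

      a<q : a ℕ.< q
      a<q = ℕ.≤-trans (ℕ.m<m+n a (ℕ.<-≤-trans 0<a a≤b)) (ℕ.≤-reflexive a+b≡q)

    -- The exponent `a + i + (b - j)` is `q` exactly when `i = j`, and it never reaches `2q`, so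
    -- only the diagonal of the double expansion remains.
    expanded-sum : ∑ p (λ x → (+ x) ^ a * (1ℤ + + x) ^ a * (+ x + H) ^ b) ≈ - twisted h a b
    expanded-sum = begin
      ∑ p (λ x → (+ x) ^ a * (1ℤ + + x) ^ a * (+ x + H) ^ b)
        ≡⟨ ∑-cong p (λ x _ → expand x) ⟩
      ∑ p (λ x → ∑ (suc a) (λ i → ∑ (suc b) (λ j → c i j * (+ x) ^ e i j)))
        ≡⟨ ∑-swap p (suc a) _ ⟩
      ∑ (suc a) (λ i → ∑ p (λ x → ∑ (suc b) (λ j → c i j * (+ x) ^ e i j)))
        ≡⟨ ∑-cong (suc a) (λ i _ → trans (∑-swap p (suc b) _) (∑-cong (suc b) (λ j _ → ∑-*ˡ p (c i j) _))) ⟩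
      ∑ (suc a) (λ i → ∑ (suc b) (λ j → c i j * powerSum (e i j)))
        ≈⟨ ∑-cong≈ (suc a) (λ i i≤a → diagonal i (ℕ.≤-pred i≤a)) ⟩
      ∑ (suc a) (λ i → - (binom a i * binom b i * H ^ i))
        ≡⟨ ∑-neg (suc a) _ ⟩
      - twisted h a b ∎
      where
      open ≈-Reasoning
      c : ℕ → ℕ → ℤ
      c i j = binom a i * (binom b j * H ^ j)
      e : ℕ → ℕ → ℕ
      e i j = a ℕ.+ i ℕ.+ (b ∸ j)
      regroup : ∀ u v w x y z → u * (v * w * (x * (y * z))) ≡ v * (x * y) * (u * w * z)
      regroup = solve-∀
      expand : ∀ x → (+ x) ^ a * (1ℤ + + x) ^ a * (+ x + H) ^ b ≡ ∑ (suc a) (λ i → ∑ (suc b) (λ j → c i j * (+ x) ^ e i j))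
      expand x = trans (cong₂ (λ u v → X ^ a * u * v) (binomial-theorem₁ X a) (binomial-theorem X H b))
        (trans (ℤ.*-assoc (X ^ a) _ _) (trans (cong (X ^ a *_) (∑-* (suc a) (suc b) _ _))
        (trans (sym (∑-*ˡ (suc a) (X ^ a) _)) (∑-cong (suc a) (λ i _ → trans (sym (∑-*ˡ (suc b) (X ^ a) _)) (∑-cong (suc b) (λ j _ →
          trans (regroup (X ^ a) (binom a i) (X ^ i) (binom b j) (H ^ j) (X ^ (b ∸ j)))
            (cong (c i j *_) (sym (trans (ℤ.^-distribˡ-+-* X (a ℕ.+ i) (b ∸ j)) (cong (_* X ^ (b ∸ j)) (ℤ.^-distribˡ-+-* X a i))))))))))))
        where
        X = + x
      diagonal : ∀ i → i ℕ.≤ a → ∑ (suc b) (λ j → c i j * powerSum (e i j)) ≈ - (binom a i * binom b i * H ^ i)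
      diagonal i i≤a = begin
        ∑ (suc b) (λ j → c i j * powerSum (e i j))
          ≈⟨ ∑-single≈ _ (s≤s i≤b) off-diagonal ⟩
        c i i * powerSum (e i i)
          ≈⟨ *-congˡ (c i i) (≈-trans (≡⇒≈ (cong powerSum e-diagonal)) powerSum-q) ⟩
        c i i * -1ℤ
          ≡⟨ negate (binom a i) (binom b i) (H ^ i) ⟩
        - (binom a i * binom b i * H ^ i) ∎
        where
        i≤b : i ℕ.≤ b
        i≤b = ℕ.≤-trans i≤a a≤b
        negate : ∀ x y z → x * (y * z) * -1ℤ ≡ - (x * y * z)
        negate = solve-∀
        e-diagonal : e i i ≡ q
        e-diagonal = trans (ℕ.+-assoc a i (b ∸ i)) (trans (cong (a ℕ.+_) (ℕ.m+[n∸m]≡n i≤b)) a+b≡q)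
        off-diagonal : ∀ j → j ℕ.< suc b → j ≢ i → c i j * powerSum (e i j) ≈ 0ℤ
        off-diagonal j j<1+b j≢i = ≈-trans (*-congˡ (c i j) (powerSum≈0 (e i j) e≢q e<2q)) (≡⇒≈ (ℤ.*-zeroʳ (c i j)))
          where
          j≤b = ℕ.≤-pred j<1+b
          e≢q : e i j ≢ q
          e≢q eq = j≢i (sym (ℕ.+-cancelʳ-≡ (b ∸ j) i j (trans (ℕ.+-cancelˡ-≡ a _ _ (trans (sym (ℕ.+-assoc a i (b ∸ j))) (trans eq (sym a+b≡q))))
            (sym (ℕ.m+[n∸m]≡n j≤b)))))
          e<2q : e i j ℕ.< q ℕ.+ q
          e<2q = ℕ.≤-<-trans (ℕ.+-mono-≤ (ℕ.+-monoʳ-≤ a i≤a) (ℕ.m∸n≤m b j))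
            (subst (ℕ._< q ℕ.+ q) (trans (cong (a ℕ.+_) (sym a+b≡q)) (sym (ℕ.+-assoc a a b))) (ℕ.+-monoˡ-< q a<q))

    -- Since `1 ≡ 2h`, the product `x (1 + x)` becomes `z² - h²` in `z = x + h`. Only the exponents
    -- `b + 2(a - i)` occur, and one of them is `q` only if `a` is even.
    shifted-sum : ∑ p (λ x → (+ x) ^ a * (1ℤ + + x) ^ a * (+ x + H) ^ b)
      ≈ ∑ (suc a) (λ i → binom a i * (- (H * H)) ^ i * powerSum (b ℕ.+ ((a ∸ i) ℕ.+ (a ∸ i))))
    shifted-sum = begin
      ∑ p (λ x → (+ x) ^ a * (1ℤ + + x) ^ a * (+ x + H) ^ b)
        ≈⟨ ∑-cong≈ p (λ x _ → shift (+ x)) ⟩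
      ∑ p (λ x → g (+ (x ℕ.+ h)))
        ≈⟨ ∑-translate g (λ x≈y → *-cong (^-cong b x≈y) (^-cong a (+-congʳ (- (H * H)) (*-cong x≈y x≈y)))) h ⟩
      ∑ p (λ x → g (+ x))
        ≡⟨ ∑-cong p (λ x _ → expand (+ x)) ⟩
      ∑ p (λ x → ∑ (suc a) (λ i → binom a i * (- (H * H)) ^ i * (+ x) ^ (b ℕ.+ ((a ∸ i) ℕ.+ (a ∸ i)))))
        ≡⟨ trans (∑-swap p (suc a) _) (∑-cong (suc a) (λ i _ → ∑-*ˡ p (binom a i * (- (H * H)) ^ i) _)) ⟩
      ∑ (suc a) (λ i → binom a i * (- (H * H)) ^ i * powerSum (b ℕ.+ ((a ∸ i) ℕ.+ (a ∸ i)))) ∎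
      where
      open ≈-Reasoning
      g : ℤ → ℤ
      g z = z ^ b * (z * z + - (H * H)) ^ a
      difference-of-squares : ∀ x h → x * (x + + 2 * h) ≡ (x + h) * (x + h) + - (h * h)
      difference-of-squares = solve-∀
      shift : ∀ x → x ^ a * (1ℤ + x) ^ a * (x + H) ^ b ≈ g (x + H)
      shift x = ≈-trans (≡⇒≈ (trans (cong (_* (x + H) ^ b) (sym (^-distribʳ-* x (1ℤ + x) a))) (ℤ.*-comm _ ((x + H) ^ b))))
        (*-congˡ ((x + H) ^ b) (^-cong a (≈-trans (*-congˡ x (≈-trans (≡⇒≈ (ℤ.+-comm 1ℤ x)) (+-congˡ x (≈-sym 2h≈1))))
          (≡⇒≈ (difference-of-squares x H)))))
      regroup : ∀ u v w z → u * (v * (w * z)) ≡ v * w * (u * z)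
      regroup = solve-∀
      expand : ∀ z → g z ≡ ∑ (suc a) (λ i → binom a i * (- (H * H)) ^ i * z ^ (b ℕ.+ ((a ∸ i) ℕ.+ (a ∸ i))))
      expand z = trans (cong (z ^ b *_) (binomial-theorem (z * z) (- (H * H)) a)) (trans (sym (∑-*ˡ (suc a) (z ^ b) _))
        (∑-cong (suc a) (λ i _ → trans (regroup (z ^ b) (binom a i) ((- (H * H)) ^ i) ((z * z) ^ (a ∸ i)))
          (cong (binom a i * (- (H * H)) ^ i *_) (sym (trans (ℤ.^-distribˡ-+-* z b _) (cong (z ^ b *_)
            (trans (ℤ.^-distribˡ-+-* z (a ∸ i) (a ∸ i)) (sym (^-distribʳ-* z z (a ∸ i)))))))))))

    private
      power≈0 : ∀ i → a ∸ i ℕ.+ (a ∸ i) ≢ a → powerSum (b ℕ.+ ((a ∸ i) ℕ.+ (a ∸ i))) ≈ 0ℤ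
      power≈0 i 2[a-i]≢a = powerSum≈0 _ (λ eq → 2[a-i]≢a (ℕ.+-cancelˡ-≡ b _ _ (trans eq (trans (sym a+b≡q) (ℕ.+-comm a b)))))
        (ℕ.≤-<-trans (ℕ.+-monoʳ-≤ b (ℕ.+-mono-≤ (ℕ.m∸n≤m a i) (ℕ.m∸n≤m a i)))
          (subst (ℕ._< q ℕ.+ q) (trans (ℕ.+-comm q a) (trans (cong (a ℕ.+_) (trans (sym a+b≡q) (ℕ.+-comm a b))) (swap a b))) (ℕ.+-monoʳ-< q a<q)))
        where
        swap : ∀ a b → a ℕ.+ (b ℕ.+ a) ≡ b ℕ.+ (a ℕ.+ a)
        swap = ℕ-Solver.solve-∀

      term≈0 : ∀ i → a ∸ i ℕ.+ (a ∸ i) ≢ a → binom a i * (- (H * H)) ^ i * powerSum (b ℕ.+ ((a ∸ i) ℕ.+ (a ∸ i))) ≈ 0ℤ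
      term≈0 i 2[a-i]≢a = ≈-trans (*-congˡ (binom a i * (- (H * H)) ^ i) (power≈0 i 2[a-i]≢a)) (≡⇒≈ (ℤ.*-zeroʳ (binom a i * (- (H * H)) ^ i)))

      neg-injective : ∀ {x y} → - x ≈ - y → x ≈ y
      neg-injective {x} {y} eq = ≈-trans (≡⇒≈ (sym (ℤ.neg-involutive x))) (≈-trans (neg-cong eq) (≡⇒≈ (ℤ.neg-involutive y)))

    twisted-odd : (∀ i → i ℕ.+ i ≢ a) → twisted h a b ≈ 0ℤ
    twisted-odd odd = neg-injective (≈-trans (≈-sym expanded-sum) (≈-trans shifted-sum
      (∑-zero≈ (suc a) (λ i _ → term≈0 i (odd (a ∸ i))))))

    twisted-even : ∀ m → m ℕ.+ m ≡ a → twisted h a b ≈ binom a m * (- (H * H)) ^ m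
    twisted-even m 2m≡a = neg-injective (begin
      - twisted h a b
        ≈⟨ ≈-trans (≈-sym expanded-sum) shifted-sum ⟩
      ∑ (suc a) (λ i → binom a i * (- (H * H)) ^ i * powerSum (b ℕ.+ ((a ∸ i) ℕ.+ (a ∸ i))))
        ≈⟨ ∑-single≈ _ (s≤s m≤a) (λ i i<1+a i≢m → term≈0 i (λ eq → i≢m (only i (ℕ.≤-pred i<1+a) eq))) ⟩
      binom a m * (- (H * H)) ^ m * powerSum (b ℕ.+ ((a ∸ m) ℕ.+ (a ∸ m)))
        ≈⟨ *-congˡ (binom a m * (- (H * H)) ^ m) (≈-trans (≡⇒≈ (cong powerSum exponent)) powerSum-q) ⟩
      binom a m * (- (H * H)) ^ m * -1ℤ
        ≡⟨ trans (ℤ.*-comm _ -1ℤ) (ℤ.-1*i≡-i _) ⟩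
      - (binom a m * (- (H * H)) ^ m) ∎)
      where
      open ≈-Reasoning
      m≤a : m ℕ.≤ a
      m≤a = ℕ.≤-trans (ℕ.m≤m+n m m) (ℕ.≤-reflexive 2m≡a)
      a-m≡m : a ∸ m ≡ m
      a-m≡m = trans (cong (_∸ m) (sym 2m≡a)) (ℕ.m+n∸n≡m m m)
      exponent : b ℕ.+ ((a ∸ m) ℕ.+ (a ∸ m)) ≡ q
      exponent = trans (cong (b ℕ.+_) (trans (cong₂ ℕ._+_ a-m≡m a-m≡m) 2m≡a)) (trans (ℕ.+-comm b a) a+b≡q)
      double-injective : ∀ i j → i ℕ.+ i ≡ j ℕ.+ j → i ≡ j
      double-injective i j eq = ℕ.*-cancelˡ-≡ i j 2 (trans (cong (i ℕ.+_) (ℕ.+-identityʳ i)) (trans eq (cong (j ℕ.+_) (sym (ℕ.+-identityʳ j)))))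
      only : ∀ i → i ℕ.≤ a → a ∸ i ℕ.+ (a ∸ i) ≡ a → i ≡ m
      only i i≤a eq = ℕ.+-cancelʳ-≡ m i m (trans (cong (i ℕ.+_) (sym (double-injective (a ∸ i) m (trans eq (sym 2m≡a)))))
        (trans (ℕ.m+[n∸m]≡n i≤a) (sym 2m≡a)))

-- The Franel sum at 1/2 and at -1/4.

module FranelValues (q : ℕ) (p-prime : Prime (suc q)) (2<q : 2 ℕ.< q) where

  open PrimeModulus q p-prime
  open FranelSums q p-prime
  open BinomialCongruences q p-prime

  3≉0 : + 3 ≉ 0ℤ
  3≉0 = small≉0 2<q

  zero-power : ∀ {d} n → d ≈ 0ℤ → 0 ℕ.< n → d ^ n ≈ 0ℤ
  zero-power n d≈0 0<n = ≈-trans (^-cong n d≈0) (≡⇒≈ (0^suc 0<n))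

  one-power : ∀ {d} n → d ≈ 1ℤ → d ^ n ≈ 1ℤ
  one-power n d≈1 = ≈-trans (^-cong n d≈1) (≡⇒≈ (ℤ.^-zeroˡ n))

  1-2t≈0 : ∀ {t} → + 2 * t ≈ 1ℤ → 1ℤ - + 2 * t ≈ 0ℤ
  1-2t≈0 {t} 2t≈1 = ≈⇒-≈0 (≈-sym 2t≈1)

  27-power : ∀ a → triple a ≡ q → (+ 27) ^ a ≈ 1ℤ
  27-power a 3a≡q = ≈-trans (≡⇒≈ (trans (ℤ.^-*-assoc (+ 3) 3 a) (cong ((+ 3) ^_) (trans (thrice a) 3a≡q)))) (fermat₁ 3≉0)
    where
    thrice : ∀ a → 3 ℕ.* a ≡ a ℕ.+ (a ℕ.+ a)
    thrice = ℕ-Solver.solve-∀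

  -- With d = 1 - 2t ≡ 3/2 and h = -2t, the factor 27 t² equals d³ h, so the powers of d combine to d^q ≡ 1.
  quarter-sum : ∀ t h a b → - + 4 * t ≈ 1ℤ → + h ≈ - + 2 * t → a ℕ.+ b ≡ q →
    (+ 3 * + a + 1ℤ) * (+ 3 * + a + + 2) ≈ 0ℤ → triple a ℕ.≤ q → q ℕ.< triple (suc a) →
    ∑ p (λ n → franel n * t ^ n) ≈ twisted h a b
  quarter-sum t h a b -4t≈1 h≈-2t a+b≡q third 3a≤q q<3a+3 =
    ≈-trans (franel-sum t a 3a≤q q<3a+3) (∑-cong≈ (suc a) (λ j j≤a → term j (ℕ.≤-pred j≤a)))
    where
    open ≈-Reasoning
    d H : ℤ
    d = 1ℤ - + 2 * t
    H = + h
    2d≈3 : + 2 * d ≈ + 3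
    2d≈3 = ≈-trans (≡⇒≈ (expand t)) (+-congˡ (+ 2) -4t≈1)
      where
      expand : ∀ t → + 2 * (1ℤ - + 2 * t) ≡ + 2 + - + 4 * t
      expand = solve-∀
    d≉0 : d ≉ 0ℤ
    d≉0 d≈0 = 3≉0 (≈-trans (≈-sym 2d≈3) (*-congˡ (+ 2) d≈0))
    base : + 27 * (t * t) ≈ d * (d * d) * H
    base = begin
      + 3 * (+ 3 * + 3) * (t * t)
        ≈⟨ *-congʳ (t * t) (*-cong (≈-sym 2d≈3) (*-cong (≈-sym 2d≈3) (≈-sym 2d≈3))) ⟩
      + 2 * d * (+ 2 * d * (+ 2 * d)) * (t * t)
        ≡⟨ regroup d t ⟩
      d * (d * d) * (- + 4 * t * (- + 2 * t))
        ≈⟨ *-congˡ (d * (d * d)) (*-cong -4t≈1 (≈-sym h≈-2t)) ⟩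
      d * (d * d) * (1ℤ * H)
        ≡⟨ cong (d * (d * d) *_) (ℤ.*-identityˡ H) ⟩
      d * (d * d) * H ∎
      where
      regroup : ∀ d t → + 2 * d * (+ 2 * d * (+ 2 * d)) * (t * t) ≡ d * (d * d) * (- + 4 * t * (- + 2 * t))
      regroup = solve-∀
    cube-power : ∀ j → (d * (d * d)) ^ j ≡ d ^ triple j
    cube-power j = trans (^-distribʳ-* d (d * d) j) (trans (cong (d ^ j *_) (^-distribʳ-* d d j))
      (sym (trans (ℤ.^-distribˡ-+-* d j (j ℕ.+ j)) (cong (d ^ j *_) (ℤ.^-distribˡ-+-* d j j)))))
    regroup₁ : ∀ c x y z → c * x * y * z ≡ c * (x * y * z)
    regroup₁ = solve-∀
    regroup₂ : ∀ x y z → x * y * z ≡ y * (x * z)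
    regroup₂ = solve-∀
    term : ∀ j → j ℕ.≤ a → trinomial j * (t * t) ^ j * d ^ (q ∸ triple j) ≈ binom a j * binom b j * H ^ j
    term j j≤a = begin
      trinomial j * (t * t) ^ j * d ^ (q ∸ triple j)
        ≈⟨ *-congʳ (d ^ (q ∸ triple j)) (*-congʳ ((t * t) ^ j) (trinomial≈ a b a+b≡q third j (s≤s (ℕ.≤-trans (ℕ.m≤m+n j (j ℕ.+ j)) 3j≤q)))) ⟩
      c * (+ 27) ^ j * (t * t) ^ j * d ^ (q ∸ triple j)
        ≡⟨ trans (regroup₁ c ((+ 27) ^ j) ((t * t) ^ j) (d ^ (q ∸ triple j)))
             (cong (λ z → c * (z * d ^ (q ∸ triple j))) (sym (^-distribʳ-* (+ 27) (t * t) j))) ⟩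
      c * ((+ 27 * (t * t)) ^ j * d ^ (q ∸ triple j))
        ≈⟨ *-congˡ c (*-congʳ (d ^ (q ∸ triple j)) (^-cong j base)) ⟩
      c * ((d * (d * d) * H) ^ j * d ^ (q ∸ triple j))
        ≡⟨ cong (λ z → c * (z * d ^ (q ∸ triple j))) (trans (^-distribʳ-* (d * (d * d)) H j) (cong (_* H ^ j) (cube-power j))) ⟩
      c * (d ^ triple j * H ^ j * d ^ (q ∸ triple j))
        ≡⟨ cong (c *_) (trans (regroup₂ (d ^ triple j) (H ^ j) (d ^ (q ∸ triple j)))
             (cong (H ^ j *_) (trans (sym (ℤ.^-distribˡ-+-* d (triple j) (q ∸ triple j))) (cong (d ^_) (ℕ.m+[n∸m]≡n 3j≤q))))) ⟩
      c * (H ^ j * d ^ q)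
        ≈⟨ *-congˡ c (*-congˡ (H ^ j) (fermat₁ d≉0)) ⟩
      c * (H ^ j * 1ℤ)
        ≡⟨ cong (c *_) (ℤ.*-identityʳ (H ^ j)) ⟩
      c * H ^ j ∎
      where
      c = binom a j * binom b j
      3j≤q : triple j ℕ.≤ q
      3j≤q = ℕ.≤-trans (ℕ.+-mono-≤ j≤a (ℕ.+-mono-≤ j≤a j≤a)) 3a≤q

  -- Here `-2t` is 1/2 modulo `p`. A natural representative is taken because the translation by `h`
  -- in the Legendre sum is by a natural number.
  half-residue : ∀ t → - + 4 * t ≈ 1ℤ → ∃ λ h → (+ h ≈ - + 2 * t) × (+ 2 * + h ≈ 1ℤ)
  half-residue t -4t≈1 with h , _ , -2t≈h ← residue (- + 2 * t) =
    h , ≈-sym -2t≈h , ≈-trans (*-congˡ (+ 2) (≈-sym -2t≈h)) (≈-trans (≡⇒≈ (quadruple t)) -4t≈1)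
    where
    quadruple : ∀ t → + 2 * (- + 2 * t) ≡ - + 4 * t
    quadruple = solve-∀

  -- The case p = 6m + 1, with `a = (p - 1)/3` and `n = (p - 1)/2`.

  module Split (m : ℕ) (6m≡q : triple (m ℕ.+ m) ≡ q) where

    a n : ℕ
    a = m ℕ.+ m
    n = m ℕ.+ (m ℕ.+ m)

    third : (+ 3 * + a + 1ℤ) * (+ 3 * + a + + 2) ≈ 0ℤ
    third = *-congʳ (+ 3 * + a + + 2) (≈-trans (≡⇒≈ (thrice (+ a)))
      (≈-trans (≡⇒≈ (cong (λ z → 1ℤ + + z) 6m≡q)) p≈0))
      where
      thrice : ∀ a → + 3 * a + 1ℤ ≡ 1ℤ + (a + (a + a))
      thrice = solve-∀

    q<3a+3 : q ℕ.< triple (suc a)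
    q<3a+3 = subst (ℕ._< triple (suc a)) 6m≡q (ℕ.+-mono-<-≤ (ℕ.n<1+n a) (ℕ.+-mono-≤ (ℕ.n≤1+n a) (ℕ.n≤1+n a)))

    2n≈-1 : + 2 * + n ≈ -1ℤ
    2n≈-1 = ≈-trans (≡⇒≈ (trans (twice (+ m)) (cong +_ 6m≡q))) q≈-1
      where
      twice : ∀ m → + 2 * (m + (m + m)) ≡ (m + m) + ((m + m) + (m + m))
      twice = solve-∀

    a≤q : a ℕ.≤ q
    a≤q = ℕ.≤-trans (ℕ.m≤m+n a (a ℕ.+ a)) (ℕ.≤-reflexive 6m≡q)

    0<a : 0 ℕ.< a
    0<a = ℕ.n≢0⇒n>0 (λ a≡0 → ℕ.<⇒≢ 0<q (trans (sym (cong triple a≡0)) 6m≡q))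

    -- The surviving term is `j = a`, where `27^a = 3^q ≡ 1` and `C(2a, a) ≡ (-4)^a C(n, a)`. What
    -- is left, `(-4t²)^a`, is an even power of -1, and `C(n, a) = C(n, m)` by symmetry.
    half-split : ∀ t → + 2 * t ≈ 1ℤ → ∑ p (λ k → franel k * t ^ k) ≈ binom n m
    half-split t 2t≈1 = begin
      ∑ p (λ k → franel k * t ^ k)
        ≈⟨ franel-sum t a (ℕ.≤-reflexive 6m≡q) q<3a+3 ⟩
      ∑ a g + g a
        ≈⟨ +-congʳ (g a) (∑-zero≈ a (λ j j<a → ≈-trans (*-congˡ (trinomial j * (t * t) ^ j) (zero-power (q ∸ triple j) (1-2t≈0 2t≈1) (ℕ.m<n⇒0<n∸m (3j<q j<a))))
             (≡⇒≈ (ℤ.*-zeroʳ (trinomial j * (t * t) ^ j))))) ⟩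
      0ℤ + trinomial a * (t * t) ^ a * (1ℤ - + 2 * t) ^ (q ∸ triple a)
        ≡⟨ trans (ℤ.+-identityˡ _) (trans (cong (λ l → trinomial a * (t * t) ^ a * (1ℤ - + 2 * t) ^ l) (trans (cong (q ∸_) 6m≡q) (ℕ.n∸n≡0 q)))
             (ℤ.*-identityʳ (trinomial a * (t * t) ^ a))) ⟩
      trinomial a * (t * t) ^ a
        ≈⟨ *-congʳ ((t * t) ^ a) (trinomial≈ a (a ℕ.+ a) 6m≡q third a (s≤s a≤q)) ⟩
      binom a a * binom (a ℕ.+ a) a * (+ 27) ^ a * (t * t) ^ a
        ≈⟨ *-congʳ ((t * t) ^ a) (*-cong (*-cong (≡⇒≈ (binom-self a)) (central≈ n 2n≈-1 a (s≤s a≤q))) (27-power a 6m≡q)) ⟩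
      1ℤ * ((- + 4) ^ a * binom n a) * 1ℤ * (t * t) ^ a
        ≡⟨ trans (regroup ((- + 4) ^ a) (binom n a) ((t * t) ^ a)) (cong₂ _*_ (sym (^-distribʳ-* (- + 4) (t * t) a)) (sym (binom-sym m (m ℕ.+ m)))) ⟩
      (- + 4 * (t * t)) ^ a * binom n m
        ≡⟨ cong (_* binom n m) (trans (ℤ.^-distribˡ-+-* (- + 4 * (t * t)) m m) (sym (^-distribʳ-* (- + 4 * (t * t)) (- + 4 * (t * t)) m))) ⟩
      (- + 4 * (t * t) * (- + 4 * (t * t))) ^ m * binom n m
        ≈⟨ *-congʳ (binom n m) (one-power m (≈-trans (≡⇒≈ (fourth t)) (*-cong (*-cong 2t≈1 2t≈1) (*-cong 2t≈1 2t≈1)))) ⟩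
      1ℤ * binom n m
        ≡⟨ ℤ.*-identityˡ (binom n m) ⟩
      binom n m ∎
      where
      open ≈-Reasoning
      g : ℕ → ℤ
      g j = trinomial j * (t * t) ^ j * (1ℤ - + 2 * t) ^ (q ∸ triple j)
      3j<q : ∀ {j} → j ℕ.< a → triple j ℕ.< q
      3j<q {j} j<a = subst (triple j ℕ.<_) 6m≡q (ℕ.+-mono-<-≤ j<a (ℕ.+-mono-≤ (ℕ.<⇒≤ j<a) (ℕ.<⇒≤ j<a)))
      regroup : ∀ x y z → 1ℤ * (x * y) * 1ℤ * z ≡ x * z * y
      regroup = solve-∀
      fourth : ∀ t → - + 4 * (t * t) * (- + 4 * (t * t)) ≡ + 2 * t * (+ 2 * t) * (+ 2 * t * (+ 2 * t))
      fourth = solve-∀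

    -- The Legendre value is `C(2m, m) (-h²)^m` with `h` equal to 1/2, and
    -- `C(2m, m) ≡ (-4)^m C(n, m)` absorbs the power.
    quarter-split : ∀ t → - + 4 * t ≈ 1ℤ → ∑ p (λ k → franel k * t ^ k) ≈ binom n m
    quarter-split t -4t≈1 with h , h≈-2t , 2h≈1 ← half-residue t -4t≈1 = begin
      ∑ p (λ k → franel k * t ^ k)
        ≈⟨ quarter-sum t h a (a ℕ.+ a) -4t≈1 h≈-2t 6m≡q third (ℕ.≤-reflexive 6m≡q) q<3a+3 ⟩
      twisted h a (a ℕ.+ a)
        ≈⟨ twisted-even h a (a ℕ.+ a) 2h≈1 6m≡q (ℕ.m≤m+n a a) 0<a m refl ⟩
      binom a m * (- (+ h * + h)) ^ m
        ≈⟨ *-congʳ ((- (+ h * + h)) ^ m) (central≈ n 2n≈-1 m (s≤s (ℕ.≤-trans (ℕ.m≤m+n m m) a≤q))) ⟩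
      (- + 4) ^ m * binom n m * (- (+ h * + h)) ^ m
        ≡⟨ trans (regroup ((- + 4) ^ m) (binom n m) ((- (+ h * + h)) ^ m)) (cong (_* binom n m) (sym (^-distribʳ-* (- + 4) (- (+ h * + h)) m))) ⟩
      (- + 4 * - (+ h * + h)) ^ m * binom n m
        ≈⟨ *-congʳ (binom n m) (one-power m (≈-trans (≡⇒≈ (square (+ h))) (*-cong 2h≈1 2h≈1))) ⟩
      1ℤ * binom n m
        ≡⟨ ℤ.*-identityˡ (binom n m) ⟩
      binom n m ∎
      where
      open ≈-Reasoning
      regroup : ∀ x y z → x * y * z ≡ x * z * y
      regroup = solve-∀
      square : ∀ h → - + 4 * - (h * h) ≡ + 2 * h * (+ 2 * h)
      square = solve-∀

  -- The case p = 6m + 5, with `a = (p - 2)/3` odd.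

  module Inert (m : ℕ) (6m+4≡q : suc (triple (suc (m ℕ.+ m))) ≡ q) where

    a b : ℕ
    a = suc (m ℕ.+ m)
    b = suc (a ℕ.+ a)

    a+b≡q : a ℕ.+ b ≡ q
    a+b≡q = trans (ℕ.+-suc a (a ℕ.+ a)) 6m+4≡q

    third : (+ 3 * + a + 1ℤ) * (+ 3 * + a + + 2) ≈ 0ℤ
    third = ≈-trans (*-congˡ (+ 3 * + a + 1ℤ) (≈-trans (≡⇒≈ (thrice (+ a)))
      (≈-trans (≡⇒≈ (cong (λ z → 1ℤ + + z) 6m+4≡q)) p≈0))) (≡⇒≈ (ℤ.*-zeroʳ (+ 3 * + a + 1ℤ)))
      where
      thrice : ∀ a → + 3 * a + + 2 ≡ 1ℤ + (1ℤ + (a + (a + a)))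
      thrice = solve-∀

    3a<q : triple a ℕ.< q
    3a<q = ℕ.≤-reflexive 6m+4≡q

    q<3a+3 : q ℕ.< triple (suc a)
    q<3a+3 = subst (ℕ._< triple (suc a)) 6m+4≡q
      (s≤s (subst (suc (triple a) ℕ.≤_) (sym (arrange a)) (ℕ.n≤1+n (1 ℕ.+ triple a))))
      where
      arrange : ∀ a → a ℕ.+ (1 ℕ.+ a ℕ.+ (1 ℕ.+ a)) ≡ 2 ℕ.+ (a ℕ.+ (a ℕ.+ a))
      arrange = ℕ-Solver.solve-∀

    -- As `q = 3a + 1`, the exponent of `1 - 2t ≡ 0` is positive in every term.
    half-inert : ∀ t → + 2 * t ≈ 1ℤ → ∑ p (λ k → franel k * t ^ k) ≈ 0ℤ
    half-inert t 2t≈1 = ≈-trans (franel-sum t a (ℕ.<⇒≤ 3a<q) q<3a+3) (∑-zero≈ (suc a) (λ j j≤a →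
      ≈-trans (*-congˡ (trinomial j * (t * t) ^ j) (zero-power (q ∸ triple j) (1-2t≈0 2t≈1) (ℕ.m<n⇒0<n∸m (3j<q (ℕ.≤-pred j≤a)))))
        (≡⇒≈ (ℤ.*-zeroʳ (trinomial j * (t * t) ^ j)))))
      where
      3j<q : ∀ {j} → j ℕ.≤ a → triple j ℕ.< q
      3j<q j≤a = ℕ.≤-<-trans (ℕ.+-mono-≤ j≤a (ℕ.+-mono-≤ j≤a j≤a)) 3a<q

    quarter-inert : ∀ t → - + 4 * t ≈ 1ℤ → ∑ p (λ k → franel k * t ^ k) ≈ 0ℤ
    quarter-inert t -4t≈1 with h , h≈-2t , 2h≈1 ← half-residue t -4t≈1 =
      ≈-trans (quarter-sum t h a b -4t≈1 h≈-2t a+b≡q third (ℕ.<⇒≤ 3a<q) q<3a+3)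
        (twisted-odd h a b 2h≈1 a+b≡q (ℕ.≤-trans (ℕ.m≤m+n a a) (ℕ.n≤1+n (a ℕ.+ a))) (s≤s z≤n) (λ i eq → odd i m eq))
      where
      odd : ∀ i m → i ℕ.+ i ≢ suc (m ℕ.+ m)
      odd (suc i) zero    eq with () ← trans (sym (ℕ.+-suc i i)) (ℕ.suc-injective eq)
      odd (suc i) (suc m) eq = odd i m (ℕ.suc-injective (trans (sym (ℕ.+-suc i i)) (trans (ℕ.suc-injective eq) (cong suc (ℕ.+-suc m m)))))

-- Exact integer sums over residue classes.

indicator : ∀ {A : Set} → Dec A → ℤ
indicator (yes _) = 1ℤ
indicator (no  _) = 0ℤ

indicator-yes : ∀ {A : Set} (A? : Dec A) → A → indicator A? ≡ 1ℤ
indicator-yes (yes _) x = refl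
indicator-yes (no ¬x) x = ⊥-elim (¬x x)

indicator-no : ∀ {A : Set} (A? : Dec A) → ¬ A → indicator A? ≡ 0ℤ
indicator-no (yes x) ¬x = ⊥-elim (¬x x)
indicator-no (no _)  ¬x = refl

indicator-iff : ∀ {A B : Set} (A? : Dec A) (B? : Dec B) → (A → B) → (B → A) → indicator A? ≡ indicator B?
indicator-iff (yes x) B? to from = sym (indicator-yes B? (to x))
indicator-iff (no ¬x) B? to from = sym (indicator-no B? (λ y → ¬x (from y)))

module Residues (q : ℕ) (p-prime : Prime (suc q)) where

  open PrimeModulus q p-prime

  δ : ℤ → ℤ → ℤ
  δ x y = indicator (x ≈? y)

  δ-yes : ∀ {x y} → x ≈ y → δ x y ≡ 1ℤ
  δ-yes {x} {y} = indicator-yes (x ≈? y)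

  δ-no : ∀ {x y} → x ≉ y → δ x y ≡ 0ℤ
  δ-no {x} {y} = indicator-no (x ≈? y)

  δ-iff : ∀ {x y x′ y′} → (x ≈ y → x′ ≈ y′) → (x′ ≈ y′ → x ≈ y) → δ x y ≡ δ x′ y′
  δ-iff {x} {y} {x′} {y′} = indicator-iff (x ≈? y) (x′ ≈? y′)

  δ-congˡ : ∀ {x x′} y → x ≈ x′ → δ x y ≡ δ x′ y
  δ-congˡ y x≈x′ = δ-iff (≈-trans (≈-sym x≈x′)) (≈-trans x≈x′)

  -- The values agree as integers and not merely modulo `p`, since the character sums are evaluated
  -- exactly.
  Invariant : (ℤ → ℤ) → Set
  Invariant g = ∀ {x y} → x ≈ y → g x ≡ g y

  ∑-δ : ∀ g → Invariant g → ∀ c → ∑ p (λ x → δ (+ x) c * g (+ x)) ≡ g c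
  ∑-δ g inv c with r , r<p , c≈r ← residue c = trans (∑-single _ r<p off)
    (trans (cong₂ _*_ (δ-yes (≈-sym c≈r)) (inv (≈-sym c≈r))) (ℤ.*-identityˡ (g c)))
    where
    distinct : ∀ {i j} → i ℕ.< p → j ℕ.< p → + i ≈ + j → i ℕ.≤ j → i ≡ j
    distinct {i} {j} i<p j<p i≈j i≤j = ℕ.≤-antisym i≤j (ℕ.m∸n≡0⇒m≤n (≈0⇒small (ℕ.≤-<-trans (ℕ.m∸n≤m j i) j<p)
      (≈-trans (≡⇒≈ (trans (sym (ℤ.⊖-≥ i≤j)) (sym (ℤ.m-n≡m⊖n j i)))) (≈⇒-≈0 (≈-sym i≈j)))))
    off : ∀ i → i ℕ.< p → i ≢ r → δ (+ i) c * g (+ i) ≡ 0ℤ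
    off i i<p i≢r = cong (_* g (+ i)) (δ-no (λ i≈c → i≢r (Sum.[ distinct i<p r<p (≈-trans i≈c c≈r)
      , (λ r≤i → sym (distinct r<p i<p (≈-sym (≈-trans i≈c c≈r)) r≤i)) ]′ (ℕ.≤-total i r))))

  ∑-δ₁ : ∀ c → ∑ p (λ x → δ (+ x) c) ≡ 1ℤ
  ∑-δ₁ c = trans (∑-cong p (λ x _ → sym (ℤ.*-identityʳ (δ (+ x) c)))) (∑-δ (λ _ → 1ℤ) (λ _ → refl) c)

  inverse : ℤ → ℤ
  inverse y = y ^ (q ∸ 1)

  inverseʳ : ∀ {y} → y ≉ 0ℤ → y * inverse y ≈ 1ℤ
  inverseʳ {y} y≉0 = ≈-trans (≡⇒≈ (cong (y ^_) (ℕ.m+[n∸m]≡n 0<q))) (fermat₁ y≉0)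

  inverseˡ : ∀ {y} → y ≉ 0ℤ → inverse y * y ≈ 1ℤ
  inverseˡ {y} y≉0 = ≈-trans (≡⇒≈ (ℤ.*-comm (inverse y) y)) (inverseʳ y≉0)

  solve-linear : ∀ {y x z} → y ≉ 0ℤ → z ≈ y * x → x ≈ inverse y * z
  solve-linear {y} {x} {z} y≉0 z≈yx = ≈-sym (≈-trans (*-congˡ (inverse y) z≈yx)
    (≈-trans (≡⇒≈ (sym (ℤ.*-assoc (inverse y) y x))) (≈-trans (*-congʳ x (inverseˡ y≉0)) (≡⇒≈ (ℤ.*-identityˡ x)))))

  solve-linear⁻¹ : ∀ {y x z} → y ≉ 0ℤ → x ≈ inverse y * z → z ≈ y * x
  solve-linear⁻¹ {y} {x} {z} y≉0 x≈y⁻¹z = ≈-sym (≈-trans (*-congˡ y x≈y⁻¹z)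
    (≈-trans (≡⇒≈ (sym (ℤ.*-assoc y (inverse y) z))) (≈-trans (*-congʳ z (inverseʳ y≉0)) (≡⇒≈ (ℤ.*-identityˡ z)))))

  -- No permutation of the residues is constructed: after inserting `δ` and exchanging the sums, the
  -- inner sum counts the single solution `x` of `z ≡ y x`.
  ∑-scale : ∀ g → Invariant g → ∀ {y} → y ≉ 0ℤ → ∑ p (λ x → g (y * + x)) ≡ ∑ p (λ x → g (+ x))
  ∑-scale g inv {y} y≉0 = begin
    ∑ p (λ x → g (y * + x))
      ≡⟨ ∑-cong p (λ x _ → sym (∑-δ g inv (y * + x))) ⟩
    ∑ p (λ x → ∑ p (λ z → δ (+ z) (y * + x) * g (+ z)))
      ≡⟨ ∑-swap p p _ ⟩
    ∑ p (λ z → ∑ p (λ x → δ (+ z) (y * + x) * g (+ z)))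
      ≡⟨ ∑-cong p (λ z _ → trans (∑-cong p (λ x _ → cong (_* g (+ z)) (δ-iff (solve-linear {y} {+ x} {+ z} y≉0) (solve-linear⁻¹ {y} {+ x} {+ z} y≉0))))
           (∑-*ʳ p (g (+ z)) (λ x → δ (+ x) (inverse y * + z)))) ⟩
    ∑ p (λ z → ∑ p (λ x → δ (+ x) (inverse y * + z)) * g (+ z))
      ≡⟨ ∑-cong p (λ z _ → trans (cong (_* g (+ z)) (∑-δ₁ (inverse y * + z))) (ℤ.*-identityˡ (g (+ z)))) ⟩
    ∑ p (λ z → g (+ z)) ∎
    where open ≡-Reasoning

  -- The passage from congruences to equalities: zero is the only multiple of `p` in this interval.
  small⇒≡0 : ∀ s → s ≈ 0ℤ → - + q ℤ.≤ s → s ℤ.≤ + q → s ≡ 0ℤ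
  small⇒≡0 (+ k)      s≈0 lower upper = cong +_ (≈0⇒small (s≤s (ℤ.drop‿+≤+ upper)) s≈0)
  small⇒≡0 (-[1+ k ]) s≈0 lower upper = ⊥-elim (small≉0 k<q (≈-trans (neg-cong s≈0) (≡⇒≈ refl)))
    where
    k<q : k ℕ.< q
    k<q = ℤ.drop‿+≤+ (ℤ.neg-cancel-≤ lower)

-- The quadratic character, its moments and its correlation sums.

module JacobiSums (q : ℕ) (p-prime : Prime (suc q)) (m : ℕ) (6m≡q : triple (m ℕ.+ m) ≡ q) where

  open PrimeModulus q p-prime
  open Residues q p-prime

  a n : ℕ
  a = m ℕ.+ m
  n = m ℕ.+ (m ℕ.+ m)

  n+n≡q : n ℕ.+ n ≡ q
  n+n≡q = trans (regroup m) 6m≡q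
    where
    regroup : ∀ m → m ℕ.+ (m ℕ.+ m) ℕ.+ (m ℕ.+ (m ℕ.+ m)) ≡ m ℕ.+ m ℕ.+ (m ℕ.+ m ℕ.+ (m ℕ.+ m))
    regroup = ℕ-Solver.solve-∀

  0<m : 0 ℕ.< m
  0<m = ℕ.n≢0⇒n>0 (λ m≡0 → ℕ.<⇒≢ 0<q (trans (sym (cong (λ m → triple (m ℕ.+ m)) m≡0)) 6m≡q))

  0<a : 0 ℕ.< a
  0<a = ℕ.<-≤-trans 0<m (ℕ.m≤m+n m m)

  0<n : 0 ℕ.< n
  0<n = ℕ.<-≤-trans 0<m (ℕ.m≤m+n m a)

  n<q : n ℕ.< q
  n<q = ℕ.<-≤-trans (ℕ.m<m+n n 0<n) (ℕ.≤-reflexive n+n≡q)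

  a<n : a ℕ.< n
  a<n = ℕ.m<n+m a 0<m

  a+n<q : a ℕ.+ n ℕ.< q
  a+n<q = ℕ.<-≤-trans (ℕ.+-monoˡ-< n a<n) (ℕ.≤-reflexive n+n≡q)

  2<q : 2 ℕ.< q
  2<q = ℕ.≤-trans (ℕ.+-mono-≤ 0<n (ℕ.+-mono-≤ 0<m (ℕ.+-mono-≤ 0<m (z≤n {m})))) (ℕ.≤-reflexive n+n≡q)

  2≉0 : + 2 ≉ 0ℤ
  2≉0 = small≉0 (ℕ.<-trans (ℕ.n<1+n 1) 2<q)

  3≉0 : + 3 ≉ 0ℤ
  3≉0 = small≉0 2<q

  1≉-1 : 1ℤ ≉ -1ℤ
  1≉-1 1≈-1 = 2≉0 (+-congˡ 1ℤ 1≈-1)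

  -- The quadratic character, by Euler's criterion.
  ρ : ℤ → ℤ
  ρ x = δ (x ^ n) 1ℤ - δ (x ^ n) -1ℤ

  data Character (x : ℤ) : Set where
    zero     : x ≈ 0ℤ → x ^ n ≈ 0ℤ → δ (x ^ n) -1ℤ ≡ 0ℤ → ρ x ≡ 0ℤ → δ x 0ℤ ≡ 1ℤ → Character x
    positive : x ≉ 0ℤ → x ^ n ≈ 1ℤ → δ (x ^ n) -1ℤ ≡ 0ℤ → ρ x ≡ 1ℤ → δ x 0ℤ ≡ 0ℤ → Character x
    negative : x ≉ 0ℤ → x ^ n ≈ -1ℤ → δ (x ^ n) -1ℤ ≡ 1ℤ → ρ x ≡ -1ℤ → δ x 0ℤ ≡ 0ℤ → Character x

  character : ∀ x → Character x
  character x = decide (x ≈? 0ℤ)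
    where
    positive-case : x ≉ 0ℤ → x ^ n ≈ 1ℤ → Character x
    positive-case x≉0 xⁿ≈1 = positive x≉0 xⁿ≈1 eq (cong₂ _-_ (δ-yes xⁿ≈1) eq) (δ-no x≉0)
      where
      eq = δ-no (λ xⁿ≈-1 → 1≉-1 (≈-trans (≈-sym xⁿ≈1) xⁿ≈-1))
    negative-case : x ≉ 0ℤ → x ^ n ≈ -1ℤ → Character x
    negative-case x≉0 xⁿ≈-1 = negative x≉0 xⁿ≈-1 (δ-yes xⁿ≈-1)
      (cong₂ _-_ (δ-no (λ xⁿ≈1 → 1≉-1 (≈-trans (≈-sym xⁿ≈1) xⁿ≈-1))) (δ-yes xⁿ≈-1)) (δ-no x≉0)
    factor : ∀ y → (y - 1ℤ) * (y - -1ℤ) ≡ y * y - 1ℤ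
    factor = solve-∀
    square : x ≉ 0ℤ → (x ^ n - 1ℤ) * (x ^ n - -1ℤ) ≈ 0ℤ
    square x≉0 = ≈-trans (≡⇒≈ (trans (factor (x ^ n)) (cong (_- 1ℤ) (trans (sym (ℤ.^-distribˡ-+-* x n n)) (cong (x ^_) n+n≡q)))))
      (≈⇒-≈0 (fermat₁ x≉0))
    decide : Dec (x ≈ 0ℤ) → Character x
    decide (yes x≈0) = zero x≈0 xⁿ≈0 eq (cong₂ _-_ (δ-no (λ xⁿ≈1 → 1≉0 (≈-trans (≈-sym xⁿ≈1) xⁿ≈0))) eq) (δ-yes x≈0)
      where
      xⁿ≈0 : x ^ n ≈ 0ℤ
      xⁿ≈0 = ≈-trans (^-cong n x≈0) (≡⇒≈ (0^suc 0<n))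
      eq = δ-no (λ xⁿ≈-1 → 1≉0 (neg-cong (≈-trans (≈-sym xⁿ≈-1) xⁿ≈0)))
    decide (no x≉0) = Sum.[ (λ e → positive-case x≉0 (-≈0⇒≈ e)) , (λ e → negative-case x≉0 (-≈0⇒≈ e)) ]′ (euclid (square x≉0))

  ρ-invariant : Invariant ρ
  ρ-invariant x≈y = cong₂ _-_ (δ-congˡ 1ℤ (^-cong n x≈y)) (δ-congˡ -1ℤ (^-cong n x≈y))

  ρ≈ : ∀ x → ρ x ≈ x ^ n
  ρ≈ x with character x
  ... | zero     _ xⁿ≈0  _ eq _ = ≈-trans (≡⇒≈ eq) (≈-sym xⁿ≈0)
  ... | positive _ xⁿ≈1  _ eq _ = ≈-trans (≡⇒≈ eq) (≈-sym xⁿ≈1)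
  ... | negative _ xⁿ≈-1 _ eq _ = ≈-trans (≡⇒≈ eq) (≈-sym xⁿ≈-1)

  ρ-0 : ∀ {x} → x ≈ 0ℤ → ρ x ≡ 0ℤ
  ρ-0 {x} x≈0 with character x
  ... | zero     _ _ _ eq _   = eq
  ... | positive x≉0 _ _ _ _  = ⊥-elim (x≉0 x≈0)
  ... | negative x≉0 _ _ _ _  = ⊥-elim (x≉0 x≈0)

  ρ-1 : ∀ {x} → x ≈ 1ℤ → ρ x ≡ 1ℤ
  ρ-1 {x} x≈1 with character x
  ... | zero     x≈0 _ _ _ _    = ⊥-elim (1≉0 (≈-trans (≈-sym x≈1) x≈0))
  ... | positive _ _ _ eq _     = eq
  ... | negative _ xⁿ≈-1 _ _ _  = ⊥-elim (1≉-1 (≈-trans (≈-sym (≈-trans (^-cong n x≈1) (≡⇒≈ (ℤ.^-zeroˡ n)))) xⁿ≈-1))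

  ρ-square : ∀ x → ρ x * ρ x ≡ 1ℤ - δ x 0ℤ
  ρ-square x with character x
  ... | zero     _ _ _ eq e rewrite eq | e = refl
  ... | positive _ _ _ eq e rewrite eq | e = refl
  ... | negative _ _ _ eq e rewrite eq | e = refl

  -- Shows that `ρ x` has the parity of `1 - δ x 0ℤ`, with the quotient explicit; this is what
  -- decides the parity of the Jacobi coordinate in `J-odd`.
  ρ-parity : ∀ x → ρ x ≡ (1ℤ - δ x 0ℤ) - + 2 * δ (x ^ n) -1ℤ
  ρ-parity x with character x
  ... | zero     _ _ d eq e rewrite eq | e | d = refl
  ... | positive _ _ d eq e rewrite eq | e | d = refl
  ... | negative _ _ d eq e rewrite eq | e | d = refl

  ρ-lower : ∀ x → - (1ℤ - δ x 0ℤ) ℤ.≤ ρ x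
  ρ-lower x with character x
  ... | zero     _ _ _ eq e rewrite eq | e = ℤ.≤-refl
  ... | positive _ _ _ eq e rewrite eq | e = ℤ.-≤+
  ... | negative _ _ _ eq e rewrite eq | e = ℤ.≤-refl

  ρ-upper : ∀ x → ρ x ℤ.≤ 1ℤ - δ x 0ℤ
  ρ-upper x with character x
  ... | zero     _ _ _ eq e rewrite eq | e = ℤ.≤-refl
  ... | positive _ _ _ eq e rewrite eq | e = ℤ.≤-refl
  ... | negative _ _ _ eq e rewrite eq | e = ℤ.-≤+

  expand-moment : ∀ e → ∑ p (λ x → (+ x) ^ e * (1ℤ - + x) ^ n) ≡ ∑ (suc n) (λ i → binom n i * -1ℤ ^ i * powerSum (e ℕ.+ i))
  expand-moment e = begin
    ∑ p (λ x → (+ x) ^ e * (1ℤ - + x) ^ n)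
      ≡⟨ ∑-cong p (λ x _ → expand (+ x)) ⟩
    ∑ p (λ x → ∑ (suc n) (λ i → binom n i * -1ℤ ^ i * (+ x) ^ (e ℕ.+ i)))
      ≡⟨ trans (∑-swap p (suc n) _) (∑-cong (suc n) (λ i _ → ∑-*ˡ p (binom n i * -1ℤ ^ i) _)) ⟩
    ∑ (suc n) (λ i → binom n i * -1ℤ ^ i * powerSum (e ℕ.+ i)) ∎
    where
    open ≡-Reasoning
    regroup : ∀ u v w z → u * (v * (w * z)) ≡ v * w * (u * z)
    regroup = solve-∀
    expand : ∀ x → x ^ e * (1ℤ - x) ^ n ≡ ∑ (suc n) (λ i → binom n i * -1ℤ ^ i * x ^ (e ℕ.+ i))
    expand x = trans (cong (x ^ e *_) (binomial-theorem₁ (- x) n)) (trans (sym (∑-*ˡ (suc n) (x ^ e) _)) (∑-cong (suc n) (λ i _ →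
      trans (cong (λ z → x ^ e * (binom n i * z)) (trans (cong (_^ i) (sym (ℤ.-1*i≡-i x))) (^-distribʳ-* -1ℤ x i)))
        (trans (regroup (x ^ e) (binom n i) (-1ℤ ^ i) (x ^ i)) (cong (binom n i * -1ℤ ^ i *_) (sym (ℤ.^-distribˡ-+-* x e i)))))))

  moment-< : ∀ e → e ℕ.+ n ℕ.< q → ∑ p (λ x → (+ x) ^ e * (1ℤ - + x) ^ n) ≈ 0ℤ
  moment-< e e+n<q = ≈-trans (≡⇒≈ (expand-moment e)) (∑-zero≈ (suc n) (λ i i≤n →
    ≈-trans (*-congˡ (binom n i * -1ℤ ^ i) (powerSum-< (e ℕ.+ i) (ℕ.≤-<-trans (ℕ.+-monoʳ-≤ e (ℕ.≤-pred i≤n)) e+n<q)))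
      (≡⇒≈ (ℤ.*-zeroʳ (binom n i * -1ℤ ^ i)))))

  -- The exponent `2a + i` is `q = 3a` only for `i = a`. The coefficient there is
  -- `C(3m, 2m) = C(3m, m)`, with sign 1 because `a` is even.
  moment-2a : ∑ p (λ x → (+ x) ^ (a ℕ.+ a) * (1ℤ - + x) ^ n) ≈ - binom n m
  moment-2a = begin
    ∑ p (λ x → (+ x) ^ (a ℕ.+ a) * (1ℤ - + x) ^ n)
      ≡⟨ expand-moment (a ℕ.+ a) ⟩
    ∑ (suc n) (λ i → binom n i * -1ℤ ^ i * powerSum (a ℕ.+ a ℕ.+ i))
      ≈⟨ ∑-single≈ _ (s≤s (ℕ.<⇒≤ a<n)) off ⟩
    binom n a * -1ℤ ^ a * powerSum (a ℕ.+ a ℕ.+ a)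
      ≈⟨ *-cong (≡⇒≈ (cong₂ _*_ (sym (binom-sym m a)) even)) (≈-trans (≡⇒≈ (cong powerSum 3a≡q)) powerSum-q) ⟩
    binom n m * 1ℤ * -1ℤ
      ≡⟨ negate (binom n m) ⟩
    - binom n m ∎
    where
    open ≈-Reasoning
    negate : ∀ x → x * 1ℤ * -1ℤ ≡ - x
    negate = solve-∀
    3a≡q : a ℕ.+ a ℕ.+ a ≡ q
    3a≡q = trans (ℕ.+-assoc a a a) 6m≡q
    even : -1ℤ ^ a ≡ 1ℤ
    even = trans (ℤ.^-distribˡ-+-* -1ℤ m m) (trans (sym (^-distribʳ-* -1ℤ -1ℤ m)) (ℤ.^-zeroˡ m))
    off : ∀ i → i ℕ.< suc n → i ≢ a → binom n i * -1ℤ ^ i * powerSum (a ℕ.+ a ℕ.+ i) ≈ 0ℤ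
    off i i≤n i≢a = ≈-trans (*-congˡ (binom n i * -1ℤ ^ i) (powerSum≈0 (a ℕ.+ a ℕ.+ i)
        (λ eq → i≢a (ℕ.+-cancelˡ-≡ (a ℕ.+ a) i a (trans eq (sym 3a≡q))))
        (ℕ.+-mono-≤-< (ℕ.≤-trans (ℕ.m≤m+n (a ℕ.+ a) a) (ℕ.≤-reflexive 3a≡q)) (ℕ.≤-<-trans (ℕ.≤-pred i≤n) n<q))))
      (≡⇒≈ (ℤ.*-zeroʳ (binom n i * -1ℤ ^ i)))

  ∑-complement : ∀ c → ∑ p (λ x → 1ℤ - δ (+ x) c) ≡ + q
  ∑-complement c = trans (∑-sub p (λ _ → 1ℤ) (λ x → δ (+ x) c))
    (trans (cong₂ _-_ (trans (∑-const p 1ℤ) (ℤ.*-identityʳ (+ p))) (∑-δ₁ c)) refl)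

  -- A sum of p terms bounded by 1 in absolute value, one of them zero, is determined by its residue.
  vanishing-sum : ∀ (g : ℤ → ℤ) c → (∀ x → - (1ℤ - δ x c) ℤ.≤ g x) → (∀ x → g x ℤ.≤ 1ℤ - δ x c) →
    ∑ p (λ x → g (+ x)) ≈ 0ℤ → ∑ p (λ x → g (+ x)) ≡ 0ℤ
  vanishing-sum g c lower upper ≈0 = small⇒≡0 _ ≈0
    (subst (λ z → - z ℤ.≤ ∑ p (λ x → g (+ x))) (∑-complement c) (∑-≥ p (λ x _ → lower (+ x))))
    (subst (∑ p (λ x → g (+ x)) ℤ.≤_) (∑-complement c) (∑-mono p (λ x _ → upper (+ x))))

  reflect : ∀ x → δ (1ℤ - x) 0ℤ ≡ δ x 1ℤ
  reflect x = δ-iff (λ e → ≈-sym (-≈0⇒≈ e)) (λ e → ≈⇒-≈0 (≈-sym e))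

  ∑-ρ : ∑ p (λ x → ρ (1ℤ - + x)) ≡ 0ℤ
  ∑-ρ = vanishing-sum (λ x → ρ (1ℤ - x)) 1ℤ
    (λ x → subst (λ z → - (1ℤ - z) ℤ.≤ ρ (1ℤ - x)) (reflect x) (ρ-lower (1ℤ - x)))
    (λ x → subst (λ z → ρ (1ℤ - x) ℤ.≤ 1ℤ - z) (reflect x) (ρ-upper (1ℤ - x)))
    (≈-trans (∑-cong≈ p (λ x _ → ≈-trans (ρ≈ (1ℤ - + x)) (≡⇒≈ (sym (ℤ.*-identityˡ _))))) (moment-< 0 n<q))

  -- The correlation of `ρ (1 - y)` with its dilate by `t`. It is the inner sum that arises when the
  -- squares of the Jacobi coordinates are added up.
  K : ℤ → ℤ
  K t = ∑ p (λ y → ρ (1ℤ - + y) * ρ (1ℤ - + y * t))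

  K-1 : ∀ {t} → t ≈ 1ℤ → K t ≡ + q
  K-1 {t} t≈1 = trans (∑-cong p (λ y _ → trans (cong (ρ (1ℤ - + y) *_) (ρ-invariant (+-congˡ 1ℤ (neg-cong (yt≈y (+ y))))))
      (trans (ρ-square (1ℤ - + y)) (cong (λ z → 1ℤ - z) (reflect (+ y)))))) (∑-complement 1ℤ)
    where
    yt≈y : ∀ y → y * t ≈ y
    yt≈y y = ≈-trans (*-congˡ y t≈1) (≡⇒≈ (ℤ.*-identityʳ y))

  -- The summand is a polynomial in `y` of degree `2n = q` with leading coefficient `t^n`, and only
  -- that coefficient contributes.
  K≈ : ∀ t → K t ≈ - t ^ n
  K≈ t = begin
    K t
      ≈⟨ ∑-cong≈ p (λ y _ → *-cong (ρ≈ (1ℤ - + y)) (ρ≈ (1ℤ - + y * t))) ⟩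
    ∑ p (λ y → (1ℤ - + y) ^ n * (1ℤ - + y * t) ^ n)
      ≡⟨ ∑-cong p (λ y _ → expand (+ y)) ⟩
    ∑ p (λ y → ∑ (suc n) (λ i → ∑ (suc n) (λ j → c i j * (+ y) ^ (i ℕ.+ j))))
      ≡⟨ trans (∑-swap p (suc n) _) (∑-cong (suc n) (λ i _ → trans (∑-swap p (suc n) _) (∑-cong (suc n) (λ j _ → ∑-*ˡ p (c i j) _)))) ⟩
    ∑ (suc n) (λ i → ∑ (suc n) (λ j → c i j * powerSum (i ℕ.+ j)))
      ≈⟨ ∑-single≈ _ (ℕ.n<1+n n) (λ i i≤n i≢n → ∑-zero≈ (suc n) (λ j j≤n → small i j
           (ℕ.+-mono-<-≤ (ℕ.≤∧≢⇒< (ℕ.≤-pred i≤n) i≢n) (ℕ.≤-pred j≤n)))) ⟩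
    ∑ (suc n) (λ j → c n j * powerSum (n ℕ.+ j))
      ≈⟨ ∑-single≈ _ (ℕ.n<1+n n) (λ j j≤n j≢n → small n j (ℕ.+-mono-≤-< (ℕ.≤-refl {n}) (ℕ.≤∧≢⇒< (ℕ.≤-pred j≤n) j≢n))) ⟩
    c n n * powerSum (n ℕ.+ n)
      ≈⟨ *-cong (≡⇒≈ leading) (≈-trans (≡⇒≈ (cong powerSum n+n≡q)) powerSum-q) ⟩
    t ^ n * -1ℤ
      ≡⟨ trans (ℤ.*-comm (t ^ n) -1ℤ) (ℤ.-1*i≡-i (t ^ n)) ⟩
    - t ^ n ∎
    where
    open ≈-Reasoning
    c : ℕ → ℕ → ℤ
    c i j = binom n i * -1ℤ ^ i * (binom n j * (- t) ^ j)
    regroup : ∀ u v w x y z → (u * (v * w)) * (x * (y * z)) ≡ u * v * (x * y) * (w * z)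
    regroup = solve-∀
    neg-power : ∀ x i → (- x) ^ i ≡ -1ℤ ^ i * x ^ i
    neg-power x i = trans (cong (_^ i) (sym (ℤ.-1*i≡-i x))) (^-distribʳ-* -1ℤ x i)
    neg-swap : ∀ y t → - (y * t) ≡ - t * y
    neg-swap = solve-∀
    expand : ∀ y → (1ℤ - y) ^ n * (1ℤ - y * t) ^ n ≡ ∑ (suc n) (λ i → ∑ (suc n) (λ j → c i j * y ^ (i ℕ.+ j)))
    expand y = trans (cong₂ _*_ (binomial-theorem₁ (- y) n) (binomial-theorem₁ (- (y * t)) n)) (trans (∑-* (suc n) (suc n) _ _)
      (∑-cong (suc n) (λ i _ → ∑-cong (suc n) (λ j _ → trans (cong₂ (λ u v → binom n i * u * (binom n j * v)) (neg-power y i)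
        (trans (cong (_^ j) (neg-swap y t)) (^-distribʳ-* (- t) y j)))
        (trans (regroup (binom n i) (-1ℤ ^ i) (y ^ i) (binom n j) ((- t) ^ j) (y ^ j)) (cong (c i j *_) (sym (ℤ.^-distribˡ-+-* y i j))))))))
    small : ∀ i j → i ℕ.+ j ℕ.< n ℕ.+ n → c i j * powerSum (i ℕ.+ j) ≈ 0ℤ
    small i j i+j<n+n = ≈-trans (*-congˡ (c i j) (powerSum-< (i ℕ.+ j) (ℕ.<-≤-trans i+j<n+n (ℕ.≤-reflexive n+n≡q)))) (≡⇒≈ (ℤ.*-zeroʳ (c i j)))
    leading : c n n ≡ t ^ n
    leading = trans (cong₂ (λ u v → u * -1ℤ ^ n * (v * (- t) ^ n)) (binom-self n) (binom-self n))
      (trans (drop (-1ℤ ^ n) ((- t) ^ n)) (trans (sym (^-distribʳ-* -1ℤ (- t) n)) (cong (_^ n) (trans (ℤ.-1*i≡-i (- t)) (ℤ.neg-involutive t)))))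
      where
      drop : ∀ u v → 1ℤ * u * (1ℤ * v) ≡ u * v
      drop = solve-∀

  -- The summand vanishes at the two distinct points 1 and `t⁻¹`, so `K t` is at most `q - 1` in
  -- absolute value and `K t + ρ t`, which is 0 modulo `p`, at most `q`. With only one of these
  -- zeros discounted the bound would reach `p`.
  K-generic : ∀ {t} → t ≉ 0ℤ → t ≉ 1ℤ → K t ≡ - ρ t
  K-generic {t} t≉0 t≉1 = trans (sym (cancel (K t) (ρ t))) (trans (cong (_- ρ t) sum≡0) (ℤ.+-identityˡ (- ρ t)))
    where
    cancel : ∀ x y → x + y - y ≡ x
    cancel = solve-∀
    t⁻¹ : ℤ
    t⁻¹ = inverse t
    root : ∀ {y} → y ≈ t⁻¹ → 1ℤ - y * t ≈ 0ℤ
    root y≈t⁻¹ = ≈⇒-≈0 (≈-sym (≈-trans (*-congʳ t y≈t⁻¹) (inverseˡ t≉0)))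
    root′ : ∀ {y} → y ≈ 1ℤ → 1ℤ - y ≈ 0ℤ
    root′ y≈1 = ≈⇒-≈0 (≈-sym y≈1)
    bound : ℤ → ℤ
    bound y = 1ℤ - δ y 1ℤ - δ y t⁻¹
    distinct : 1ℤ ≉ t⁻¹
    distinct 1≈t⁻¹ = t≉1 (≈-trans (≡⇒≈ (sym (ℤ.*-identityˡ t))) (≈-trans (*-congʳ t 1≈t⁻¹) (inverseˡ t≉0)))
    data Located (y : ℤ) : Set where
      vanishing : ρ (1ℤ - y) * ρ (1ℤ - y * t) ≡ 0ℤ → bound y ≡ 0ℤ → Located y
      other     : bound y ≡ 1ℤ → Located y
    locate : ∀ y → Dec (y ≈ 1ℤ) → Dec (y ≈ t⁻¹) → Located y
    locate y (yes y≈1) _ = vanishing (cong (_* ρ (1ℤ - y * t)) (ρ-0 (root′ y≈1)))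
      (cong₂ (λ u v → 1ℤ - u - v) (δ-yes y≈1) (δ-no (λ y≈t⁻¹ → distinct (≈-trans (≈-sym y≈1) y≈t⁻¹))))
    locate y (no y≉1) (yes y≈t⁻¹) = vanishing (trans (cong (ρ (1ℤ - y) *_) (ρ-0 (root y≈t⁻¹))) (ℤ.*-zeroʳ (ρ (1ℤ - y))))
      (cong₂ (λ u v → 1ℤ - u - v) (δ-no y≉1) (δ-yes y≈t⁻¹))
    locate y (no y≉1) (no y≉t⁻¹) = other (cong₂ (λ u v → 1ℤ - u - v) (δ-no y≉1) (δ-no y≉t⁻¹))
    ρρ-lower : ∀ x y → -1ℤ ℤ.≤ ρ x * ρ y
    ρρ-lower x y with character x | character y
    ... | zero     _ _ _ e _ | _ rewrite e = ℤ.-≤+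
    ... | positive _ _ _ e _ | zero     _ _ _ e′ _ rewrite e | e′ = ℤ.-≤+
    ... | positive _ _ _ e _ | positive _ _ _ e′ _ rewrite e | e′ = ℤ.-≤+
    ... | positive _ _ _ e _ | negative _ _ _ e′ _ rewrite e | e′ = ℤ.≤-refl
    ... | negative _ _ _ e _ | zero     _ _ _ e′ _ rewrite e | e′ = ℤ.-≤+
    ... | negative _ _ _ e _ | positive _ _ _ e′ _ rewrite e | e′ = ℤ.≤-refl
    ... | negative _ _ _ e _ | negative _ _ _ e′ _ rewrite e | e′ = ℤ.-≤+
    ρρ-upper : ∀ x y → ρ x * ρ y ℤ.≤ 1ℤ
    ρρ-upper x y with character x | character y
    ... | zero     _ _ _ e _ | _ rewrite e = ℤ.+≤+ z≤n
    ... | positive _ _ _ e _ | zero     _ _ _ e′ _ rewrite e | e′ = ℤ.+≤+ z≤n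
    ... | positive _ _ _ e _ | positive _ _ _ e′ _ rewrite e | e′ = ℤ.≤-refl
    ... | positive _ _ _ e _ | negative _ _ _ e′ _ rewrite e | e′ = ℤ.-≤+
    ... | negative _ _ _ e _ | zero     _ _ _ e′ _ rewrite e | e′ = ℤ.+≤+ z≤n
    ... | negative _ _ _ e _ | positive _ _ _ e′ _ rewrite e | e′ = ℤ.-≤+
    ... | negative _ _ _ e _ | negative _ _ _ e′ _ rewrite e | e′ = ℤ.≤-refl
    lower : ∀ y → Located y → - bound y ℤ.≤ ρ (1ℤ - y) * ρ (1ℤ - y * t)
    lower y (vanishing e e′) = ℤ.≤-reflexive (trans (cong -_ e′) (sym e))
    lower y (other e)        = subst (λ z → - z ℤ.≤ ρ (1ℤ - y) * ρ (1ℤ - y * t)) (sym e) (ρρ-lower (1ℤ - y) (1ℤ - y * t))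
    upper : ∀ y → Located y → ρ (1ℤ - y) * ρ (1ℤ - y * t) ℤ.≤ bound y
    upper y (vanishing e e′) = ℤ.≤-reflexive (trans e (sym e′))
    upper y (other e)        = subst (ρ (1ℤ - y) * ρ (1ℤ - y * t) ℤ.≤_) (sym e) (ρρ-upper (1ℤ - y) (1ℤ - y * t))
    ∑-bound : ∑ p (λ y → bound (+ y)) ≡ + q - 1ℤ
    ∑-bound = trans (∑-sub p (λ y → 1ℤ - δ (+ y) 1ℤ) (λ y → δ (+ y) t⁻¹)) (cong₂ _-_ (∑-complement 1ℤ) (∑-δ₁ t⁻¹))
    K-lower : - (+ q - 1ℤ) ℤ.≤ K t
    K-lower = subst (λ z → - z ℤ.≤ K t) ∑-bound (∑-≥ p (λ y _ → lower (+ y) (locate (+ y) (+ y ≈? 1ℤ) (+ y ≈? t⁻¹))))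
    K-upper : K t ℤ.≤ + q - 1ℤ
    K-upper = subst (K t ℤ.≤_) ∑-bound (∑-mono p (λ y _ → upper (+ y) (locate (+ y) (+ y ≈? 1ℤ) (+ y ≈? t⁻¹))))
    1-δ≡1 : 1ℤ - δ t 0ℤ ≡ 1ℤ
    1-δ≡1 = cong (λ z → 1ℤ - z) (δ-no t≉0)
    recombine : ∀ q → q - 1ℤ + 1ℤ ≡ q
    recombine = solve-∀
    recombine⁻ : ∀ q → - (q - 1ℤ) + -1ℤ ≡ - q
    recombine⁻ = solve-∀
    sum≡0 : K t + ρ t ≡ 0ℤ
    sum≡0 = small⇒≡0 (K t + ρ t)
      (≈-trans (+-cong (K≈ t) (ρ≈ t)) (≡⇒≈ (ℤ.+-inverseˡ (t ^ n))))
      (subst (ℤ._≤ K t + ρ t) (recombine⁻ (+ q)) (ℤ.+-mono-≤ K-lower (subst (λ z → - z ℤ.≤ ρ t) 1-δ≡1 (ρ-lower t))))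
      (subst (K t + ρ t ℤ.≤_) (recombine (+ q)) (ℤ.+-mono-≤ K-upper (subst (ρ t ℤ.≤_) 1-δ≡1 (ρ-upper t))))

-- The cubic cosets and the norm of the Jacobi sum.

module JacobiNorm (q : ℕ) (p-prime : Prime (suc q)) (m : ℕ) (6m≡q : triple (m ℕ.+ m) ≡ q) where

  open PrimeModulus q p-prime
  open Residues q p-prime
  open JacobiSums q p-prime m 6m≡q

  a<q : a ℕ.< q
  a<q = ℕ.<-trans a<n n<q

  2a<q : a ℕ.+ a ℕ.< q
  2a<q = ℕ.<-≤-trans (ℕ.m<n+m (a ℕ.+ a) 0<a) (ℕ.≤-reflexive 6m≡q)

  -- Otherwise `x^a` would be 1 at every nonzero residue and `powerSum a` would be `q ≡ -1`,
  -- although `a < q` makes it 0.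
  non-cube : ∃ λ c → c ≉ 0ℤ × c ^ a ≉ 1ℤ
  non-cube = decide (ℕ.anyUpTo? (λ k → ¬? ((+ suc k) ^ a ≈? 1ℤ)) q)
    where
    open ≈-Reasoning
    decide : Dec (∃ λ k → k ℕ.< q × (+ suc k) ^ a ≉ 1ℤ) → ∃ λ c → c ≉ 0ℤ × c ^ a ≉ 1ℤ
    decide (yes (k , k<q , ≉1)) = + suc k , small≉0 k<q , ≉1
    decide (no none) = ⊥-elim (1≉0 (neg-cong (≈-trans (≈-sym (begin
      powerSum a                              ≡⟨ ∑-head q _ ⟩
      0ℤ ^ a + ∑ q (λ x → (+ suc x) ^ a)      ≈⟨ +-cong (≡⇒≈ (0^suc 0<a)) (∑-cong≈ q (λ x x<q →
                                                   decidable-stable ((+ suc x) ^ a ≈? 1ℤ) (λ ≉1 → none (x , x<q , ≉1)))) ⟩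
      0ℤ + ∑ q (λ _ → 1ℤ)                     ≡⟨ trans (ℤ.+-identityˡ _) (trans (∑-const q 1ℤ) (ℤ.*-identityʳ (+ q))) ⟩
      + q                                     ≈⟨ q≈-1 ⟩
      -1ℤ                                     ∎)) (powerSum-< a a<q))))

  module CubicClasses (c : ℤ) (c≉0 : c ≉ 0ℤ) (cᵃ≉1 : c ^ a ≉ 1ℤ) where

    w W : ℤ
    w = c ^ a
    W = w * w

    w≉0 : w ≉ 0ℤ
    w≉0 = ^-≉0 a c≉0

    W≉0 : W ≉ 0ℤ
    W≉0 = *-≉0 w≉0 w≉0

    cube-power : ∀ {x} → x ≉ 0ℤ → x ^ a * (x ^ a * x ^ a) ≈ 1ℤ
    cube-power {x} x≉0 = ≈-trans (≡⇒≈ (trans (cong (x ^ a *_) (sym (ℤ.^-distribˡ-+-* x a a)))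
      (trans (sym (ℤ.^-distribˡ-+-* x a (a ℕ.+ a))) (cong (x ^_) 6m≡q)))) (fermat₁ x≉0)

    w³≈1 : w * W ≈ 1ℤ
    w³≈1 = cube-power c≉0

    W≉1 : W ≉ 1ℤ
    W≉1 W≈1 = cᵃ≉1 (≈-trans (≡⇒≈ (sym (ℤ.*-identityʳ w))) (≈-trans (*-congˡ w (≈-sym W≈1)) w³≈1))

    w≉W : w ≉ W
    w≉W w≈W = cᵃ≉1 (≈-sym (*-cancelˡ≈ w≉0 (≈-trans (≡⇒≈ (ℤ.*-identityʳ w)) w≈W)))

    1+w+W≈0 : 1ℤ + w + W ≈ 0ℤ
    1+w+W≈0 = Sum.[ (λ w-1≈0 → ⊥-elim (cᵃ≉1 (-≈0⇒≈ w-1≈0))) , (λ e → e) ]′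
      (euclid (≈-trans (≡⇒≈ (factor w)) (≈⇒-≈0 w³≈1)))
      where
      factor : ∀ w → (w - 1ℤ) * (1ℤ + w + w * w) ≡ w * (w * w) - 1ℤ
      factor = solve-∀

    -- As `w` is a primitive cube root of unity modulo `p`, the values 1, `w` and `W` of `v` give
    -- the indicators of the three cosets of the nonzero cubes.
    I : ℤ → ℤ → ℤ
    I v x = δ (x ^ a) v

    data Class (x : ℤ) : Set where
      null   : x ^ a ≈ 0ℤ → I 1ℤ x ≡ 0ℤ → I w x ≡ 0ℤ → I W x ≡ 0ℤ → δ x 0ℤ ≡ 1ℤ → Class x
      class₀ : x ^ a ≈ 1ℤ → I 1ℤ x ≡ 1ℤ → I w x ≡ 0ℤ → I W x ≡ 0ℤ → δ x 0ℤ ≡ 0ℤ → Class x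
      class₁ : x ^ a ≈ w  → I 1ℤ x ≡ 0ℤ → I w x ≡ 1ℤ → I W x ≡ 0ℤ → δ x 0ℤ ≡ 0ℤ → Class x
      class₂ : x ^ a ≈ W  → I 1ℤ x ≡ 0ℤ → I w x ≡ 0ℤ → I W x ≡ 1ℤ → δ x 0ℤ ≡ 0ℤ → Class x

    classify : ∀ x → Class x
    classify x = decide (x ≈? 0ℤ)
      where
      y : ℤ
      y = x ^ a
      off : ∀ {u v} → y ≈ u → u ≉ v → I v x ≡ 0ℤ
      off y≈u u≉v = δ-no (λ y≈v → u≉v (≈-trans (≈-sym y≈u) y≈v))
      -- The product differs from `y³ - 1` only by multiples of `1 + w + w²` and `w³ - 1`.
      factor : ∀ y w → (y - 1ℤ) * ((y - w) * (y - w * w))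
        ≡ (y * (y * y) - 1ℤ) + ((1ℤ + w + w * w) * (y - y * y) + (w * (w * w) - 1ℤ) * (y - 1ℤ))
      factor = solve-∀
      zeros : ∀ u v → 0ℤ + (0ℤ * u + 0ℤ * v) ≡ 0ℤ
      zeros = solve-∀
      product : x ≉ 0ℤ → (y - 1ℤ) * ((y - w) * (y - W)) ≈ 0ℤ
      product x≉0 = ≈-trans (≡⇒≈ (factor y w)) (≈-trans (+-cong (≈⇒-≈0 (cube-power x≉0))
        (+-cong (*-congʳ (y - y * y) 1+w+W≈0) (*-congʳ (y - 1ℤ) (≈⇒-≈0 w³≈1)))) (≡⇒≈ (zeros (y - y * y) (y - 1ℤ))))
      decide : Dec (x ≈ 0ℤ) → Class x
      decide (yes x≈0) = null y≈0 (off y≈0 (λ e → 1≉0 (≈-sym e))) (off y≈0 (λ e → w≉0 (≈-sym e))) (off y≈0 (λ e → W≉0 (≈-sym e))) (δ-yes x≈0)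
        where
        y≈0 : y ≈ 0ℤ
        y≈0 = ≈-trans (^-cong a x≈0) (≡⇒≈ (0^suc 0<a))
      decide (no x≉0) = Sum.[ one , (λ e → Sum.[ two , three ]′ (euclid e)) ]′ (euclid (product x≉0))
        where
        one : y - 1ℤ ≈ 0ℤ → Class x
        one e = class₀ y≈1 (δ-yes y≈1) (off y≈1 (λ e → cᵃ≉1 (≈-sym e))) (off y≈1 (λ e → W≉1 (≈-sym e))) (δ-no x≉0)
          where y≈1 = -≈0⇒≈ e
        two : y - w ≈ 0ℤ → Class x
        two e = class₁ y≈w (off y≈w cᵃ≉1) (δ-yes y≈w) (off y≈w w≉W) (δ-no x≉0)
          where y≈w = -≈0⇒≈ e
        three : y - W ≈ 0ℤ → Class x
        three e = class₂ y≈W (off y≈W W≉1) (off y≈W (λ e → w≉W (≈-sym e))) (δ-yes y≈W) (δ-no x≉0)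
          where y≈W = -≈0⇒≈ e

    partition : ∀ x → I 1ℤ x + I w x + I W x ≡ 1ℤ - δ x 0ℤ
    partition x with classify x
    ... | null   _ e₀ e₁ e₂ d rewrite e₀ | e₁ | e₂ | d = refl
    ... | class₀ _ e₀ e₁ e₂ d rewrite e₀ | e₁ | e₂ | d = refl
    ... | class₁ _ e₀ e₁ e₂ d rewrite e₀ | e₁ | e₂ | d = refl
    ... | class₂ _ e₀ e₁ e₂ d rewrite e₀ | e₁ | e₂ | d = refl

    -- Orthogonality of the three cubic characters, with values modulo `p`: for `x^a = v` the right
    -- side is `1 + v + v²`, and `δ` removes the constant at `x = 0`.
    orthogonality : ∀ x → + 3 * I 1ℤ x ≈ 1ℤ - δ x 0ℤ + x ^ a + x ^ (a ℕ.+ a)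
    orthogonality x = ≈-trans (by-class (classify x))
      (≡⇒≈ (cong (λ z → 1ℤ - δ x 0ℤ + x ^ a + z) (sym (ℤ.^-distribˡ-+-* x a a))))
      where
      value : ∀ {i d v} → I 1ℤ x ≡ i → δ x 0ℤ ≡ d → x ^ a ≈ v → + 3 * i ≈ 1ℤ - d + v + v * v →
        + 3 * I 1ℤ x ≈ 1ℤ - δ x 0ℤ + x ^ a + x ^ a * x ^ a
      value refl refl e h = ≈-trans h (≈-sym (+-cong (+-congˡ (1ℤ - δ x 0ℤ) e) (*-cong e e)))
      swap : ∀ w W → 1ℤ + W + w ≡ 1ℤ + w + W
      swap = solve-∀
      fourth : ∀ w → w * w * (w * w) ≡ w * (w * w) * w
      fourth = solve-∀
      by-class : Class x → + 3 * I 1ℤ x ≈ 1ℤ - δ x 0ℤ + x ^ a + x ^ a * x ^ a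
      by-class (null   e e₀ _ _ d) = value e₀ d e ≈-refl
      by-class (class₀ e e₀ _ _ d) = value e₀ d e ≈-refl
      by-class (class₁ e e₀ _ _ d) = value e₀ d e (≈-sym 1+w+W≈0)
      by-class (class₂ e e₀ _ _ d) = value e₀ d e (≈-sym (≈-trans (+-congˡ (1ℤ + W)
        (≈-trans (≡⇒≈ (fourth w)) (≈-trans (*-congʳ w w³≈1) (≡⇒≈ (ℤ.*-identityˡ w))))) (≈-trans (≡⇒≈ (swap w W)) 1+w+W≈0)))

    cube-class-sum : ∀ (r : ℤ → ℤ) → + 3 * ∑ p (λ x → I 1ℤ (+ x) * r (+ x))
      ≈ ∑ p (λ x → (1ℤ - δ (+ x) 0ℤ) * r (+ x)) + ∑ p (λ x → (+ x) ^ a * r (+ x)) + ∑ p (λ x → (+ x) ^ (a ℕ.+ a) * r (+ x))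
    cube-class-sum r = begin
      + 3 * ∑ p (λ x → I 1ℤ (+ x) * r (+ x))
        ≡⟨ sym (∑-*ˡ p (+ 3) _) ⟩
      ∑ p (λ x → + 3 * (I 1ℤ (+ x) * r (+ x)))
        ≈⟨ ∑-cong≈ p (λ x _ → ≈-trans (≡⇒≈ (sym (ℤ.*-assoc (+ 3) (I 1ℤ (+ x)) (r (+ x))))) (≈-trans (*-congʳ (r (+ x)) (orthogonality (+ x)))
             (≡⇒≈ (distrib (1ℤ - δ (+ x) 0ℤ) ((+ x) ^ a) ((+ x) ^ (a ℕ.+ a)) (r (+ x)))))) ⟩
      ∑ p (λ x → (1ℤ - δ (+ x) 0ℤ) * r (+ x) + (+ x) ^ a * r (+ x) + (+ x) ^ (a ℕ.+ a) * r (+ x))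
        ≡⟨ trans (∑-+ p _ _) (cong (_+ ∑ p (λ x → (+ x) ^ (a ℕ.+ a) * r (+ x))) (∑-+ p _ _)) ⟩
      ∑ p (λ x → (1ℤ - δ (+ x) 0ℤ) * r (+ x)) + ∑ p (λ x → (+ x) ^ a * r (+ x)) + ∑ p (λ x → (+ x) ^ (a ℕ.+ a) * r (+ x)) ∎
      where
      open ≈-Reasoning
      distrib : ∀ u v z r → (u + v + z) * r ≡ u * r + v * r + z * r
      distrib = solve-∀

    ∑-nonzero : ∀ g → Invariant g → ∑ p (λ x → (1ℤ - δ (+ x) 0ℤ) * g (+ x)) ≡ ∑ p (λ x → g (+ x)) - g 0ℤ
    ∑-nonzero g inv = trans (∑-cong p (λ x _ → distrib (δ (+ x) 0ℤ) (g (+ x)))) (trans (∑-sub p _ _)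
      (cong (λ z → ∑ p (λ x → g (+ x)) - z) (∑-δ g inv 0ℤ)))
      where
      distrib : ∀ d g → (1ℤ - d) * g ≡ g - d * g
      distrib = solve-∀

    -- `J 1ℤ`, `J w` and `J W` are α, β and γ: the coefficients of 1, ω and ω² in a Jacobi sum of
    -- the quadratic and a cubic character.
    J : ℤ → ℤ
    J v = ∑ p (λ x → I v (+ x) * ρ (1ℤ - + x))

    J-trace : J 1ℤ + J w + J W ≡ -1ℤ
    J-trace = begin
      J 1ℤ + J w + J W
        ≡⟨ cong (_+ J W) (sym (∑-+ p _ _)) ⟩
      ∑ p (λ x → I 1ℤ (+ x) * ρ (1ℤ - + x) + I w (+ x) * ρ (1ℤ - + x)) + J W
        ≡⟨ sym (∑-+ p _ _) ⟩
      ∑ p (λ x → I 1ℤ (+ x) * ρ (1ℤ - + x) + I w (+ x) * ρ (1ℤ - + x) + I W (+ x) * ρ (1ℤ - + x))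
        ≡⟨ ∑-cong p (λ x _ → trans (collect (I 1ℤ (+ x)) (I w (+ x)) (I W (+ x)) (ρ (1ℤ - + x))) (cong (_* ρ (1ℤ - + x)) (partition (+ x)))) ⟩
      ∑ p (λ x → (1ℤ - δ (+ x) 0ℤ) * ρ (1ℤ - + x))
        ≡⟨ ∑-nonzero (λ x → ρ (1ℤ - x)) (λ x≈y → ρ-invariant (+-congˡ 1ℤ (neg-cong x≈y))) ⟩
      ∑ p (λ x → ρ (1ℤ - + x)) - ρ (1ℤ - 0ℤ)
        ≡⟨ cong₂ _-_ ∑-ρ (ρ-1 ≈-refl) ⟩
      -1ℤ ∎
      where
      open ≡-Reasoning
      collect : ∀ u v z r → u * r + v * r + z * r ≡ (u + v + z) * r
      collect = solve-∀

    -- In `cube-class-sum` the trivial character contributes `-ρ 1 = -1`, `x^a` contributes 0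
    -- because the degree `a + n` is below `q`, and `x^(2a)` contributes `moment-2a`.
    J-congruence : + 3 * J 1ℤ ≈ -1ℤ - binom n m
    J-congruence = ≈-trans (cube-class-sum (λ x → ρ (1ℤ - x))) (≈-trans (+-cong (+-cong
        (≡⇒≈ (trans (∑-nonzero (λ x → ρ (1ℤ - x)) (λ x≈y → ρ-invariant (+-congˡ 1ℤ (neg-cong x≈y)))) (cong₂ _-_ ∑-ρ (ρ-1 ≈-refl))))
        (≈-trans (∑-cong≈ p (λ x _ → *-congˡ ((+ x) ^ a) (ρ≈ (1ℤ - + x)))) (moment-< a a+n<q)))
        (≈-trans (∑-cong≈ p (λ x _ → *-congˡ ((+ x) ^ (a ℕ.+ a)) (ρ≈ (1ℤ - + x)))) moment-2a))
      ≈-refl)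

    N : ℤ
    N = ∑ p (λ x → I 1ℤ (+ x))

    I-lower : ∀ v x → 0ℤ ℤ.≤ I v x
    I-lower v x with x ^ a ≈? v
    ... | yes _ = ℤ.+≤+ z≤n
    ... | no  _ = ℤ.≤-refl

    I₁-upper : ∀ x → I 1ℤ x ℤ.≤ 1ℤ - δ x 0ℤ
    I₁-upper x with classify x
    ... | null   _ e₀ e₁ e₂ d rewrite e₀ | d = ℤ.≤-refl
    ... | class₀ _ e₀ e₁ e₂ d rewrite e₀ | d = ℤ.≤-refl
    ... | class₁ _ e₀ e₁ e₂ d rewrite e₀ | d = ℤ.+≤+ z≤n
    ... | class₂ _ e₀ e₁ e₂ d rewrite e₀ | d = ℤ.+≤+ z≤n

    -- Orthogonality gives `3 N ≡ q = 3a`, and `N` and `a` both lie between 0 and `q`.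
    N-value : N ≡ + a
    N-value = trans (sym (restore N (+ a))) (trans (cong (_+ + a) N-a≡0) (ℤ.+-identityˡ (+ a)))
      where
      restore : ∀ x y → x - y + y ≡ x
      restore = solve-∀
      drop-1 : ∀ g → ∑ p (λ x → g x * 1ℤ) ≡ ∑ p g
      drop-1 g = ∑-cong p (λ x _ → ℤ.*-identityʳ (g x))
      0≤N : 0ℤ ℤ.≤ N
      0≤N = subst (ℤ._≤ N) (∑-zero p (λ _ _ → refl)) (∑-mono p (λ x _ → I-lower 1ℤ (+ x)))
      N≤q : N ℤ.≤ + q
      N≤q = subst (N ℤ.≤_) (∑-complement 0ℤ) (∑-mono p (λ x _ → I₁-upper (+ x)))
      3N≈q : + 3 * N ≈ + q
      3N≈q = ≈-trans (≡⇒≈ (cong (+ 3 *_) (sym (drop-1 _)))) (≈-trans (cube-class-sum (λ _ → 1ℤ))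
        (≈-trans (≡⇒≈ (cong₂ _+_ (cong₂ _+_ (drop-1 _) (drop-1 _)) (drop-1 _)))
        (≈-trans (+-cong (+-cong (≡⇒≈ (∑-complement 0ℤ)) (powerSum-< a a<q)) (powerSum-< (a ℕ.+ a) 2a<q))
          (≡⇒≈ (trans (ℤ.+-identityʳ _) (ℤ.+-identityʳ (+ q)))))))
      thrice : ∀ a → a + (a + a) ≡ + 3 * a
      thrice = solve-∀
      N≈a : N ≈ + a
      N≈a = *-cancelˡ≈ 3≉0 (≈-trans 3N≈q (≡⇒≈ (trans (cong +_ (sym 6m≡q)) (thrice (+ a)))))
      N-a≡0 : N - + a ≡ 0ℤ
      N-a≡0 = small⇒≡0 (N - + a) (≈⇒-≈0 N≈a)
        (ℤ.≤-trans (ℤ.neg-mono-≤ (ℤ.+≤+ (ℕ.<⇒≤ a<q))) (subst (ℤ._≤ N - + a) (ℤ.+-identityˡ (- + a)) (ℤ.+-monoˡ-≤ (- + a) 0≤N)))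
        (ℤ.≤-trans (ℤ.i-j≤i N (+ a)) N≤q)

    -- The exponents that arise are `n = 3m`, `a + n = 5m` and `2a + n = 7m`. None is `q = 6m` and
    -- all are below `2q`, so the sum is 0 modulo `p`, and it is small.
    ∑-Iρ : ∑ p (λ x → I 1ℤ (+ x) * ρ (+ x)) ≡ 0ℤ
    ∑-Iρ = vanishing-sum (λ x → I 1ℤ x * ρ x) 0ℤ (λ x → lower x (classify x)) (λ x → upper x (classify x))
      (*-cancelˡ≈ 3≉0 (≈-trans (cube-class-sum ρ) (+-cong (+-cong nonzero (moment a (ℕ.<⇒≢ a+n<q) (ℕ.<-≤-trans a+n<q (ℕ.m≤m+n q q)))) last)))
      where
      zero-left : ∀ x {i} → i ≡ 0ℤ → i * ρ x ≡ 0ℤ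
      zero-left x refl = refl
      one-left : ∀ x {i} → i ≡ 1ℤ → i * ρ x ≡ ρ x
      one-left x refl = ℤ.*-identityˡ (ρ x)
      0≤1-δ : ∀ x → 0ℤ ℤ.≤ 1ℤ - δ x 0ℤ
      0≤1-δ x = ℤ.≤-trans (I-lower 1ℤ x) (I₁-upper x)
      lower : ∀ x → Class x → - (1ℤ - δ x 0ℤ) ℤ.≤ I 1ℤ x * ρ x
      lower x (class₀ _ e _ _ _) = subst (- (1ℤ - δ x 0ℤ) ℤ.≤_) (sym (one-left x e)) (ρ-lower x)
      lower x (null   _ e _ _ _) = subst (- (1ℤ - δ x 0ℤ) ℤ.≤_) (sym (zero-left x e)) (ℤ.neg-mono-≤ (0≤1-δ x))
      lower x (class₁ _ e _ _ _) = subst (- (1ℤ - δ x 0ℤ) ℤ.≤_) (sym (zero-left x e)) (ℤ.neg-mono-≤ (0≤1-δ x))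
      lower x (class₂ _ e _ _ _) = subst (- (1ℤ - δ x 0ℤ) ℤ.≤_) (sym (zero-left x e)) (ℤ.neg-mono-≤ (0≤1-δ x))
      upper : ∀ x → Class x → I 1ℤ x * ρ x ℤ.≤ 1ℤ - δ x 0ℤ
      upper x (class₀ _ e _ _ _) = subst (ℤ._≤ 1ℤ - δ x 0ℤ) (sym (one-left x e)) (ρ-upper x)
      upper x (null   _ e _ _ _) = subst (ℤ._≤ 1ℤ - δ x 0ℤ) (sym (zero-left x e)) (0≤1-δ x)
      upper x (class₁ _ e _ _ _) = subst (ℤ._≤ 1ℤ - δ x 0ℤ) (sym (zero-left x e)) (0≤1-δ x)
      upper x (class₂ _ e _ _ _) = subst (ℤ._≤ 1ℤ - δ x 0ℤ) (sym (zero-left x e)) (0≤1-δ x)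
      nonzero : ∑ p (λ x → (1ℤ - δ (+ x) 0ℤ) * ρ (+ x)) ≈ 0ℤ
      nonzero = ≈-trans (≡⇒≈ (trans (∑-nonzero ρ ρ-invariant) (cong (λ z → ∑ p (λ x → ρ (+ x)) - z) (ρ-0 ≈-refl))))
        (≈-trans (≡⇒≈ (ℤ.+-identityʳ _)) (≈-trans (∑-cong≈ p (λ x _ → ρ≈ (+ x))) (powerSum-< n n<q)))
      moment : ∀ e → e ℕ.+ n ≢ q → e ℕ.+ n ℕ.< q ℕ.+ q → ∑ p (λ x → (+ x) ^ e * ρ (+ x)) ≈ 0ℤ
      moment e ≢q <2q = ≈-trans (∑-cong≈ p (λ x _ → ≈-trans (*-congˡ ((+ x) ^ e) (ρ≈ (+ x))) (≡⇒≈ (sym (ℤ.^-distribˡ-+-* (+ x) e n)))))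
        (powerSum≈0 (e ℕ.+ n) ≢q <2q)
      2a+n≡q+m : a ℕ.+ a ℕ.+ n ≡ q ℕ.+ m
      2a+n≡q+m = trans (regroup m) (cong (ℕ._+ m) 6m≡q)
        where
        regroup : ∀ m → m ℕ.+ m ℕ.+ (m ℕ.+ m) ℕ.+ (m ℕ.+ (m ℕ.+ m)) ≡ m ℕ.+ m ℕ.+ (m ℕ.+ m ℕ.+ (m ℕ.+ m)) ℕ.+ m
        regroup = ℕ-Solver.solve-∀
      last : ∑ p (λ x → (+ x) ^ (a ℕ.+ a) * ρ (+ x)) ≈ 0ℤ
      last = moment (a ℕ.+ a) (λ eq → ℕ.<⇒≢ (ℕ.m<m+n q 0<m) (trans (sym eq) 2a+n≡q+m))
        (subst (ℕ._< q ℕ.+ q) (sym 2a+n≡q+m) (ℕ.+-monoʳ-< q (ℕ.≤-<-trans (ℕ.m≤m+n m m) a<q)))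

    -- Independent of the coset `v`, so that the three squares combine into one sum over the nonzero
    -- `y`.
    R : ℤ → ℤ
    R y = ρ (1ℤ - y) * ∑ p (λ t → I 1ℤ (+ t) * ρ (1ℤ - y * + t))

    -- The substitution x = y t within the class of y.
    J-square : ∀ v → v ≉ 0ℤ → J v * J v ≡ ∑ p (λ y → I v (+ y) * R (+ y))
    J-square v v≉0 = trans (sym (∑-*ʳ p (J v) _)) (∑-cong p (λ y _ →
      trans (ℤ.*-assoc (I v (+ y)) (ρ (1ℤ - + y)) (J v)) (pointwise (+ y) ((+ y) ^ a ≈? v))))
      where
      g : ℤ → ℤ
      g x = I v x * ρ (1ℤ - x)
      g-invariant : Invariant g
      g-invariant x≈y = cong₂ _*_ (δ-congˡ v (^-cong a x≈y)) (ρ-invariant (+-congˡ 1ℤ (neg-cong x≈y)))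
      rescale : ∀ y → y ^ a ≈ v → J v ≡ ∑ p (λ t → I 1ℤ (+ t) * ρ (1ℤ - y * + t))
      rescale y yᵃ≈v = trans (sym (∑-scale g g-invariant y≉0)) (∑-cong p (λ t _ → cong (_* ρ (1ℤ - y * + t)) (same-class (+ t))))
        where
        y≉0 : y ≉ 0ℤ
        y≉0 y≈0 = v≉0 (≈-trans (≈-sym yᵃ≈v) (≈-trans (^-cong a y≈0) (≡⇒≈ (0^suc 0<a))))
        power : ∀ t → (y * t) ^ a ≈ v * t ^ a
        power t = ≈-trans (≡⇒≈ (^-distribʳ-* y t a)) (*-congʳ (t ^ a) yᵃ≈v)
        same-class : ∀ t → I v (y * t) ≡ I 1ℤ t
        same-class t = δ-iff
          (λ e → *-cancelˡ≈ v≉0 (≈-trans (≈-sym (power t)) (≈-trans e (≡⇒≈ (sym (ℤ.*-identityʳ v))))))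
          (λ e → ≈-trans (power t) (≈-trans (*-congˡ v e) (≡⇒≈ (ℤ.*-identityʳ v))))
      pointwise : ∀ y → Dec (y ^ a ≈ v) → I v y * (ρ (1ℤ - y) * J v) ≡ I v y * R y
      pointwise y (yes e) = cong (λ z → I v y * (ρ (1ℤ - y) * z)) (rescale y e)
      pointwise y (no ¬e) = trans (cong (_* (ρ (1ℤ - y) * J v)) (δ-no ¬e)) (sym (cong (_* R y) (δ-no ¬e)))

    -- The three squares add up to the sum of `R` over nonzero `y`. With `y = 0` included,
    -- exchanging `y` and `t` gives the sum of `K` over the nonzero cubes, which is `p` because `ρ`
    -- sums to 0 there; the excluded `R 0ℤ` is the number `a` of nonzero cubes.
    J-norm : J 1ℤ * J 1ℤ + J w * J w + J W * J W ≡ + p - + a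
    J-norm = begin
      J 1ℤ * J 1ℤ + J w * J w + J W * J W
        ≡⟨ cong₂ _+_ (cong₂ _+_ (J-square 1ℤ 1≉0) (J-square w w≉0)) (J-square W W≉0) ⟩
      ∑ p (λ y → I 1ℤ (+ y) * R (+ y)) + ∑ p (λ y → I w (+ y) * R (+ y)) + ∑ p (λ y → I W (+ y) * R (+ y))
        ≡⟨ trans (cong (_+ ∑ p (λ y → I W (+ y) * R (+ y))) (sym (∑-+ p _ _))) (sym (∑-+ p _ _)) ⟩
      ∑ p (λ y → I 1ℤ (+ y) * R (+ y) + I w (+ y) * R (+ y) + I W (+ y) * R (+ y))
        ≡⟨ ∑-cong p (λ y _ → trans (collect (I 1ℤ (+ y)) (I w (+ y)) (I W (+ y)) (R (+ y))) (cong (_* R (+ y)) (partition (+ y)))) ⟩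
      ∑ p (λ y → (1ℤ - δ (+ y) 0ℤ) * R (+ y))
        ≡⟨ ∑-nonzero R R-invariant ⟩
      ∑ p (λ y → R (+ y)) - R 0ℤ
        ≡⟨ cong₂ _-_ ∑-R R-0 ⟩
      + p - + a ∎
      where
      open ≡-Reasoning
      collect : ∀ u v z r → u * r + v * r + z * r ≡ (u + v + z) * r
      collect = solve-∀
      R-invariant : Invariant R
      R-invariant x≈y = cong₂ _*_ (ρ-invariant (+-congˡ 1ℤ (neg-cong x≈y))) (∑-cong p (λ t _ →
        cong (I 1ℤ (+ t) *_) (ρ-invariant (+-congˡ 1ℤ (neg-cong (*-congʳ (+ t) x≈y))))))
      R-0 : R 0ℤ ≡ + a
      R-0 = trans (cong₂ _*_ (ρ-1 ≈-refl) (∑-cong p (λ t _ → trans (cong (I 1ℤ (+ t) *_) (ρ-1 ≈-refl)) (ℤ.*-identityʳ (I 1ℤ (+ t))))))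
        (trans (ℤ.*-identityˡ N) N-value)
      move : ∀ u v z → u * (v * z) ≡ v * (u * z)
      move = solve-∀
      shift : ∀ q → q ≡ 1ℤ * - 1ℤ + (1ℤ + q) * 1ℤ
      shift = solve-∀
      zero-term : ∀ t → t ≉ 1ℤ → I 1ℤ t ≡ 0ℤ → I 1ℤ t * K t ≡ I 1ℤ t * - ρ t + + p * δ t 1ℤ
      zero-term t t≉1 e = trans (cong (_* K t) e) (sym (trans (cong₂ (λ u v → u * - ρ t + + p * v) e (δ-no t≉1))
        (trans (ℤ.+-identityˡ (+ p * 0ℤ)) (ℤ.*-zeroʳ (+ p)))))
      -- One formula covers all cubes: the value `q` of `K` at `t = 1` is `-ρ 1 + p`.
      term : ∀ t → Dec (t ≈ 1ℤ) → Class t → I 1ℤ t * K t ≡ I 1ℤ t * - ρ t + + p * δ t 1ℤ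
      term t (yes t≈1) _ = trans (cong₂ _*_ I≡1 (K-1 t≈1)) (trans (ℤ.*-identityˡ (+ q))
        (trans (shift (+ q)) (sym (trans (cong₂ (λ u v → u * - v + + p * δ t 1ℤ) I≡1 (ρ-1 t≈1))
          (cong (λ z → 1ℤ * - 1ℤ + + p * z) (δ-yes t≈1))))))
        where
        I≡1 : I 1ℤ t ≡ 1ℤ
        I≡1 = δ-yes (≈-trans (^-cong a t≈1) (≡⇒≈ (ℤ.^-zeroˡ a)))
      term t (no t≉1) (null   _ e _ _ _) = zero-term t t≉1 e
      term t (no t≉1) (class₁ _ e _ _ _) = zero-term t t≉1 e
      term t (no t≉1) (class₂ _ e _ _ _) = zero-term t t≉1 e
      term t (no t≉1) (class₀ tᵃ≈1 _ _ _ _) = trans (cong (I 1ℤ t *_) (K-generic t≉0 t≉1))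
        (sym (trans (cong (λ z → I 1ℤ t * - ρ t + + p * z) (δ-no t≉1)) (trans (cong (λ z → I 1ℤ t * - ρ t + z) (ℤ.*-zeroʳ (+ p))) (ℤ.+-identityʳ _))))
        where
        t≉0 : t ≉ 0ℤ
        t≉0 t≈0 = 1≉0 (≈-trans (≈-sym tᵃ≈1) (≈-trans (^-cong a t≈0) (≡⇒≈ (0^suc 0<a))))
      ∑-R : ∑ p (λ y → R (+ y)) ≡ + p
      ∑-R = begin
        ∑ p (λ y → R (+ y))
          ≡⟨ ∑-cong p (λ y _ → trans (sym (∑-*ˡ p (ρ (1ℤ - + y)) _)) (∑-cong p (λ t _ → move (ρ (1ℤ - + y)) (I 1ℤ (+ t)) (ρ (1ℤ - + y * + t))))) ⟩
        ∑ p (λ y → ∑ p (λ t → I 1ℤ (+ t) * (ρ (1ℤ - + y) * ρ (1ℤ - + y * + t))))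
          ≡⟨ trans (∑-swap p p _) (∑-cong p (λ t _ → ∑-*ˡ p (I 1ℤ (+ t)) _)) ⟩
        ∑ p (λ t → I 1ℤ (+ t) * K (+ t))
          ≡⟨ ∑-cong p (λ t _ → term (+ t) (+ t ≈? 1ℤ) (classify (+ t))) ⟩
        ∑ p (λ t → I 1ℤ (+ t) * - ρ (+ t) + + p * δ (+ t) 1ℤ)
          ≡⟨ ∑-+ p _ _ ⟩
        ∑ p (λ t → I 1ℤ (+ t) * - ρ (+ t)) + ∑ p (λ t → + p * δ (+ t) 1ℤ)
          ≡⟨ cong₂ _+_ (trans (∑-cong p (λ t _ → sym (ℤ.neg-distribʳ-* (I 1ℤ (+ t)) (ρ (+ t))))) (trans (∑-neg p _) (cong -_ ∑-Iρ)))
               (trans (∑-*ˡ p (+ p) _) (trans (cong (+ p *_) (∑-δ₁ 1ℤ)) (ℤ.*-identityʳ (+ p)))) ⟩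
        0ℤ + + p
          ≡⟨ ℤ.+-identityˡ (+ p) ⟩
        + p ∎

    -- Among the `2m` nonzero cubes, `x = 1` contributes `ρ 0 = 0` and each other one a sign. The
    -- sum `D` counts the cubes whose sign is negative.
    J-odd : ∃ λ k → J 1ℤ ≡ + 2 * k - 1ℤ
    J-odd = + m - D , (begin
      ∑ p (λ x → I 1ℤ (+ x) * ρ (1ℤ - + x))
        ≡⟨ ∑-cong p (λ x _ → trans (cong (I 1ℤ (+ x) *_) (ρ-parity (1ℤ - + x))) (trans (cong (λ z → I 1ℤ (+ x) * (1ℤ - z - + 2 * s x)) (reflect (+ x)))
             (distrib (I 1ℤ (+ x)) (δ (+ x) 1ℤ) (s x)))) ⟩
      ∑ p (λ x → I 1ℤ (+ x) - δ (+ x) 1ℤ * I 1ℤ (+ x) - + 2 * (I 1ℤ (+ x) * s x))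
        ≡⟨ trans (∑-sub p _ _) (cong₂ _-_ (∑-sub p _ _) (∑-*ˡ p (+ 2) _)) ⟩
      N - ∑ p (λ x → δ (+ x) 1ℤ * I 1ℤ (+ x)) - + 2 * D
        ≡⟨ cong₂ (λ u v → u - v - + 2 * D) N-value (trans (∑-δ (I 1ℤ) (λ x≈y → δ-congˡ 1ℤ (^-cong a x≈y)) 1ℤ) (δ-yes (≡⇒≈ (ℤ.^-zeroˡ a)))) ⟩
      + a - 1ℤ - + 2 * D
        ≡⟨ collect (+ m) D ⟩
      + 2 * (+ m - D) - 1ℤ ∎)
      where
      open ≡-Reasoning
      s : ℕ → ℤ
      s x = δ ((1ℤ - + x) ^ n) -1ℤ
      D : ℤ
      D = ∑ p (λ x → I 1ℤ (+ x) * s x)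
      distrib : ∀ i d s → i * (1ℤ - d - + 2 * s) ≡ i - d * i - + 2 * (i * s)
      distrib = solve-∀
      collect : ∀ m D → m + m - 1ℤ - + 2 * D ≡ + 2 * (m - D) - 1ℤ
      collect = solve-∀

    representation : ∃ λ k → ∃ λ b → + p ≡ (+ 3 * k - 1ℤ) * (+ 3 * k - 1ℤ) + + 3 * (b * b)
      × binom n m ≈ - (+ 2 * (+ 3 * k - 1ℤ))
    -- With α = `2k - 1` and γ = -1 - α - β, the norm of α + βω + γω² is `a² + 3b²` for
    -- `a = (3α + 1)/2 = 3k - 1` and `b = (β - γ)/2 = β + k`.
    representation = k , J w + k , form , congruence
      where
      open ≡-Reasoning
      k : ℤ
      k = proj₁ J-odd
      J≡2k-1 : J 1ℤ ≡ + 2 * k - 1ℤ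
      J≡2k-1 = proj₂ J-odd
      isolate : ∀ x y z → x + y + z - x - y ≡ z
      isolate = solve-∀
      J-W : J W ≡ -1ℤ - (+ 2 * k - 1ℤ) - J w
      J-W = trans (sym (isolate (J 1ℤ) (J w) (J W))) (cong₂ (λ u v → u - v - J w) J-trace J≡2k-1)
      p-value : ∀ m → 1ℤ + (m + m + (m + m + (m + m))) - (m + m) ≡ 1ℤ + + 4 * m
      p-value = solve-∀
      norm : (+ 2 * k - 1ℤ) * (+ 2 * k - 1ℤ) + J w * J w + (-1ℤ - (+ 2 * k - 1ℤ) - J w) * (-1ℤ - (+ 2 * k - 1ℤ) - J w) ≡ 1ℤ + + 4 * + m
      norm = trans (sym (cong₂ (λ u v → u * u + J w * J w + v * v) J≡2k-1 J-W))
        (trans J-norm (trans (cong (λ z → 1ℤ + + z - + a) (sym 6m≡q)) (p-value (+ m))))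
      double : ∀ m → + 2 * (1ℤ + (m + m + (m + m + (m + m)))) ≡ + 3 * (1ℤ + + 4 * m) - 1ℤ
      double = solve-∀
      expand : ∀ k j → + 3 * ((+ 2 * k - 1ℤ) * (+ 2 * k - 1ℤ) + j * j + (-1ℤ - (+ 2 * k - 1ℤ) - j) * (-1ℤ - (+ 2 * k - 1ℤ) - j)) - 1ℤ
        ≡ + 2 * ((+ 3 * k - 1ℤ) * (+ 3 * k - 1ℤ) + + 3 * ((j + k) * (j + k)))
      expand = solve-∀
      form : + p ≡ (+ 3 * k - 1ℤ) * (+ 3 * k - 1ℤ) + + 3 * ((J w + k) * (J w + k))
      form = ℤ.*-cancelˡ-≡ (+ 2) (+ p) _ (begin
        + 2 * (1ℤ + + q)                    ≡⟨ cong (λ z → + 2 * (1ℤ + + z)) (sym 6m≡q) ⟩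
        + 2 * (1ℤ + + triple a)             ≡⟨ double (+ m) ⟩
        + 3 * (1ℤ + + 4 * + m) - 1ℤ         ≡⟨ cong (λ z → + 3 * z - 1ℤ) (sym norm) ⟩
        + 3 * ((+ 2 * k - 1ℤ) * (+ 2 * k - 1ℤ) + J w * J w + (-1ℤ - (+ 2 * k - 1ℤ) - J w) * (-1ℤ - (+ 2 * k - 1ℤ) - J w)) - 1ℤ
          ≡⟨ expand k (J w) ⟩
        + 2 * ((+ 3 * k - 1ℤ) * (+ 3 * k - 1ℤ) + + 3 * ((J w + k) * (J w + k))) ∎)
      solve-for : ∀ x → - (-1ℤ - x) - 1ℤ ≡ x
      solve-for = solve-∀
      simplify : ∀ k → - (+ 3 * (+ 2 * k - 1ℤ)) - 1ℤ ≡ - (+ 2 * (+ 3 * k - 1ℤ))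
      simplify = solve-∀
      congruence : binom n m ≈ - (+ 2 * (+ 3 * k - 1ℤ))
      congruence = ≈-trans (≡⇒≈ (sym (solve-for (binom n m)))) (≈-trans (+-congʳ -1ℤ (neg-cong (≈-sym J-congruence)))
        (≡⇒≈ (trans (cong (λ z → - (+ 3 * z) - 1ℤ) J≡2k-1) (simplify k))))

  jacobi-representation : ∃ λ k → ∃ λ b → + p ≡ (+ 3 * k - 1ℤ) * (+ 3 * k - 1ℤ) + + 3 * (b * b)
    × binom n m ≈ - (+ 2 * (+ 3 * k - 1ℤ))
  jacobi-representation = CubicClasses.representation (proj₁ non-cube) (proj₁ (proj₂ non-cube)) (proj₂ (proj₂ non-cube))

-- Uniqueness of the representation p = u² + 3v².

square-abs : ∀ i → i * i ≡ + (ℤ.∣ i ∣ ℕ.* ℤ.∣ i ∣)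
square-abs (+ n)      = sym (ℤ.pos-* n n)
square-abs (-[1+ n ]) = refl

unit-form : ∀ l k → l * l + + 3 * (k * k) ≡ 1ℤ → (l ≡ 1ℤ ⊎ l ≡ -1ℤ) × k ≡ 0ℤ
unit-form l k eq = l≡±1 , k≡0
  where
  x y : ℕ
  x = ℤ.∣ l ∣
  y = ℤ.∣ k ∣
  natural : x ℕ.* x ℕ.+ 3 ℕ.* (y ℕ.* y) ≡ 1
  natural = ℤ.+-injective (trans (cong (λ z → + (x ℕ.* x) + z) (ℤ.pos-* 3 (y ℕ.* y)))
    (trans (sym (cong₂ (λ u v → u + + 3 * v) (square-abs l) (square-abs k))) eq))
  zero-or : ∀ y → x ℕ.* x ℕ.+ 3 ℕ.* (y ℕ.* y) ≡ 1 → y ≡ 0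
  zero-or zero    _  = refl
  zero-or (suc y) eq = ⊥-elim (ℕ.<⇒≱ (ℕ.s≤s (ℕ.s≤s z≤n)) (ℕ.≤-trans (ℕ.*-monoʳ-≤ 3 (ℕ.s≤s (z≤n {y ℕ.+ y ℕ.* suc y})))
    (ℕ.≤-trans (ℕ.m≤n+m (3 ℕ.* (suc y ℕ.* suc y)) (x ℕ.* x)) (ℕ.≤-reflexive eq))))
  k≡0 : k ≡ 0ℤ
  k≡0 = ℤ.∣i∣≡0⇒i≡0 (zero-or y natural)
  x≡1 : x ≡ 1
  x≡1 = ℕ.m*n≡1⇒m≡1 x x (trans (sym (ℕ.+-identityʳ (x ℕ.* x))) (trans (cong (λ z → x ℕ.* x ℕ.+ 3 ℕ.* (z ℕ.* z)) (sym (zero-or y natural))) natural))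
  l≡±1 : l ≡ 1ℤ ⊎ l ≡ -1ℤ
  l≡±1 = Sum.map (λ e → trans (sym e) (cong +_ x≡1))
    (λ e → trans (sym (ℤ.neg-involutive l)) (cong -_ (trans (sym e) (cong +_ x≡1)))) (ℤ.+∣i∣≡i⊎+∣i∣≡-i l)

module Uniqueness (q : ℕ) (p-prime : Prime (suc q)) where

  open PrimeModulus q p-prime

  -- Brahmagupta's identity gives `p² = r² + 3s²`. If `p` divides `s` it divides `r`, and dividing
  -- by `p²` leaves a representation of 1, so `s = 0` and `r` is `p` or `-p`. Then
  -- `p a = u r - 3 v s` determines `a`.
  proportional : ∀ a b u v → + p ≡ a * a + + 3 * (b * b) → + p ≡ u * u + + 3 * (v * v) →
    u * b - a * v ≈ 0ℤ → a ≡ u ⊎ a ≡ - u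
  proportional a b u v ab uv s≈0 = conclude (≈0⇒∣ s≈0) (≈0⇒∣ r≈0)
    where
    open ≡-Reasoning
    r s : ℤ
    r = u * a + + 3 * (v * b)
    s = u * b - a * v
    brahmagupta : ∀ a b u v → (a * a + + 3 * (b * b)) * (u * u + + 3 * (v * v))
      ≡ (u * a + + 3 * (v * b)) * (u * a + + 3 * (v * b)) + + 3 * ((u * b - a * v) * (u * b - a * v))
    brahmagupta = solve-∀
    norm : + p * + p ≡ r * r + + 3 * (s * s)
    norm = trans (cong₂ _*_ ab uv) (brahmagupta a b u v)
    isolate : ∀ x y → x ≡ x + + 3 * (y * y) - + 3 * (y * y)
    isolate = solve-∀
    r≈0 : r ≈ 0ℤ
    r≈0 = Sum.[ (λ e → e) , (λ e → e) ]′ (euclid {r} {r} (≈-trans (≡⇒≈ (trans (isolate (r * r) s) (cong (_- + 3 * (s * s)) (sym norm))))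
      (+-cong (*-cong p≈0 p≈0) (neg-cong (*-congˡ (+ 3) (*-cong s≈0 s≈0))))))
    recover : ∀ a u v b → a * (u * u + + 3 * (v * v)) ≡ u * (u * a + + 3 * (v * b)) - + 3 * v * (u * b - a * v)
    recover = solve-∀
    conclude : + p ∣ₛ s → + p ∣ₛ r → a ≡ u ⊎ a ≡ - u
    conclude (divides k s≡kp) (divides l r≡lp) = Sum.map
        (λ l≡1 → trans a-value (trans (cong₂ (λ l k → l * u - + 3 * v * k) l≡1 k≡0) (plus u v)))
        (λ l≡-1 → trans a-value (trans (cong₂ (λ l k → l * u - + 3 * v * k) l≡-1 k≡0) (minus u v)))
        (proj₁ unit)
      where
      factor : ∀ l k p → (l * p) * (l * p) + + 3 * ((k * p) * (k * p)) ≡ p * (p * (l * l + + 3 * (k * k)))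
      factor = solve-∀
      unit : (l ≡ 1ℤ ⊎ l ≡ -1ℤ) × k ≡ 0ℤ
      unit = unit-form l k (ℤ.*-cancelˡ-≡ (+ p) _ _ (ℤ.*-cancelˡ-≡ (+ p) _ _
        (trans (sym (factor l k (+ p))) (trans (sym (cong₂ (λ x y → x * x + + 3 * (y * y)) r≡lp s≡kp))
          (trans (sym norm) (cong (+ p *_) (sym (ℤ.*-identityʳ (+ p)))))))))
      k≡0 = proj₂ unit
      scale : ∀ u v l k p → u * (l * p) - + 3 * v * (k * p) ≡ p * (l * u - + 3 * v * k)
      scale = solve-∀
      a-value : a ≡ l * u - + 3 * v * k
      a-value = ℤ.*-cancelˡ-≡ (+ p) _ _ (begin
        + p * a                                        ≡⟨ trans (ℤ.*-comm (+ p) a) (cong (a *_) uv) ⟩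
        a * (u * u + + 3 * (v * v))                    ≡⟨ recover a u v b ⟩
        u * r - + 3 * v * s                            ≡⟨ cong₂ (λ x y → u * x - + 3 * v * y) r≡lp s≡kp ⟩
        u * (l * + p) - + 3 * v * (k * + p)            ≡⟨ scale u v l k (+ p) ⟩
        + p * (l * u - + 3 * v * k)                    ∎)
      plus : ∀ u v → 1ℤ * u - + 3 * v * 0ℤ ≡ u
      plus = solve-∀
      minus : ∀ u v → -1ℤ * u - + 3 * v * 0ℤ ≡ - u
      minus = solve-∀

  -- The product `(ub - av)(ub + av)` equals `p (b² - v²)`, so `p` divides one factor; in the second
  -- case `v` changes sign.
  unique-form : ∀ a b u v → + p ≡ a * a + + 3 * (b * b) → + p ≡ u * u + + 3 * (v * v) → a ≡ u ⊎ a ≡ - u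
  unique-form a b u v ab uv = Sum.[ proportional a b u v ab uv
      , proportional a b u (- v) ab (trans uv (cong (λ z → u * u + + 3 * z) (sym (neg-square v)))) ]′
    (euclid {u * b - a * v} {u * b - a * - v} (≈-trans (≡⇒≈ (trans (cross a b u v) (sym (cong₂ (λ x y → x * (b * b) - y * (v * v)) uv ab))))
      (≈-trans (≡⇒≈ (collect (+ p) (b * b) (v * v))) (*-congʳ (b * b - v * v) p≈0))))
    where
    neg-square : ∀ v → - v * - v ≡ v * v
    neg-square = solve-∀
    cross : ∀ a b u v → (u * b - a * v) * (u * b - a * - v)
      ≡ (u * u + + 3 * (v * v)) * (b * b) - (a * a + + 3 * (b * b)) * (v * v)
    cross = solve-∀
    collect : ∀ p x y → p * x - p * y ≡ p * (x - y)
    collect = solve-∀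

-- Rationals with denominator prime to p.

ι : ℤ → ℚ
ι i = i ℚ./ 1

toℚᵘ-ι : ∀ i → ℚ.toℚᵘ (ι i) ℚᵘ.≃ mkℚᵘ i 0
toℚᵘ-ι i = ℚ.toℚᵘ-fromℚᵘ (mkℚᵘ i 0)

ι-* : ∀ i j → ι i ℚ.* ι j ≡ ι (i * j)
ι-* i j = ℚ.toℚᵘ-injective (ℚᵘ.≃-trans (ℚ.toℚᵘ-homo-* (ι i) (ι j))
  (ℚᵘ.≃-trans (ℚᵘ.*-cong (toℚᵘ-ι i) (toℚᵘ-ι j)) (ℚᵘ.≃-sym (toℚᵘ-ι (i * j)))))

ι-+ : ∀ i j → ι i ℚ.+ ι j ≡ ι (i + j)
ι-+ i j = ℚ.toℚᵘ-injective (ℚᵘ.≃-trans (ℚ.toℚᵘ-homo-+ (ι i) (ι j))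
  (ℚᵘ.≃-trans (ℚᵘ.+-cong (toℚᵘ-ι i) (toℚᵘ-ι j)) (ℚᵘ.≃-trans (*≡* (unit i j)) (ℚᵘ.≃-sym (toℚᵘ-ι (i + j))))))
  where
  unit : ∀ i j → (i * 1ℤ + j * 1ℤ) * 1ℤ ≡ (i + j) * 1ℤ
  unit = solve-∀

ι-neg : ∀ i → ℚ.- ι i ≡ ι (- i)
ι-neg i = ℚ.toℚᵘ-injective (ℚᵘ.≃-trans (ℚ.toℚᵘ-homo‿- (ι i))
  (ℚᵘ.≃-trans (ℚᵘ.-‿cong (toℚᵘ-ι i)) (ℚᵘ.≃-sym (toℚᵘ-ι (- i)))))

cross-multiply : ∀ x D M → x ℚ.* ι D ≡ ι M → (↥ x) * D ≡ M * (↧ x)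
cross-multiply x@(mkℚ n d _) D M eq = trans (sym (ℤ.*-identityʳ (n * D))) (trans (ℚᵘ.drop-*≡* unnormalised)
  (cong (M *_) (ℤ.*-identityʳ (+ suc d))))
  where
  unnormalised : ℚ.toℚᵘ x ℚᵘ.* mkℚᵘ D 0 ℚᵘ.≃ mkℚᵘ M 0
  unnormalised = ℚᵘ.≃-trans (ℚᵘ.*-congˡ {ℚ.toℚᵘ x} (ℚᵘ.≃-sym (toℚᵘ-ι D)))
    (ℚᵘ.≃-trans (ℚᵘ.≃-sym (ℚ.toℚᵘ-homo-* x (ι D))) (ℚᵘ.≃-trans (ℚᵘ.≃-reflexive (cong ℚ.toℚᵘ eq)) (toℚᵘ-ι M)))

module RationalCongruence (q : ℕ) (p-prime : Prime (suc q)) where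

  open PrimeModulus q p-prime
  open FranelSums q p-prime using (inverse-power)

  -- Cross-multiplication puts `p` into the reduced numerator, since `D` is prime to `p`. The
  -- denominator then avoids `p` because the fraction is in lowest terms.
  numerator-divisible : ∀ x D M → D ≉ 0ℤ → M ≈ 0ℤ → x ℚ.* ι D ≡ ι M → (+ p ∣ℤ ↥ x) × ¬ (+ p ∣ℤ ↧ x)
  numerator-divisible x D M D≉0 M≈0 eq = p∣↥x , λ p∣↧x → coprimality x p∣↥x p∣↧x
    where
    ↥x≈0 : ↥ x ≈ 0ℤ
    ↥x≈0 = Sum.[ (λ e → e) , (λ D≈0 → ⊥-elim (D≉0 D≈0)) ]′ (euclid {↥ x} {D}
      (≈-trans (≡⇒≈ (cross-multiply x D M eq)) (*-congʳ (↧ x) M≈0)))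
    p∣↥x : + p ∣ℤ ↥ x
    p∣↥x = ∣⇒∣ᵤ (≈0⇒∣ ↥x≈0)
    coprimality : ∀ x → + p ∣ℤ ↥ x → + p ∣ℤ ↧ x → ⊥
    coprimality (mkℚ n d coprime) p∣n p∣d = ⊥-elim-irr (ℕ.<⇒≢ (s≤s 0<q) (sym (coprime (p∣n , p∣d))))

  -- The common form of `S6` and `S12`; at `k = q` it unfolds to either of them.
  weighted : (r : ℚ) → ℕ → ℚ
  weighted r k = sumℚ k (λ n → (Q n ℚ./ 1) ℚ.* powℚ r n)

  module _ (c : ℤ) (r : ℚ) (rc≡1 : r ℚ.* ι c ≡ ℚ.1ℚ) where

    powℚ-inverse : ∀ n → powℚ r n ℚ.* ι (c ^ n) ≡ ℚ.1ℚ
    powℚ-inverse zero    = refl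
    powℚ-inverse (suc n) = begin
      powℚ r n ℚ.* r ℚ.* ι (c * c ^ n)              ≡⟨ cong (powℚ r n ℚ.* r ℚ.*_) (sym (ι-* c (c ^ n))) ⟩
      powℚ r n ℚ.* r ℚ.* (ι c ℚ.* ι (c ^ n))        ≡⟨ ℚ.*-assoc (powℚ r n) r _ ⟩
      powℚ r n ℚ.* (r ℚ.* (ι c ℚ.* ι (c ^ n)))      ≡⟨ cong (powℚ r n ℚ.*_) (sym (ℚ.*-assoc r (ι c) (ι (c ^ n)))) ⟩
      powℚ r n ℚ.* (r ℚ.* ι c ℚ.* ι (c ^ n))        ≡⟨ cong (λ z → powℚ r n ℚ.* (z ℚ.* ι (c ^ n))) rc≡1 ⟩
      powℚ r n ℚ.* (ℚ.1ℚ ℚ.* ι (c ^ n))             ≡⟨ cong (powℚ r n ℚ.*_) (ℚ.*-identityˡ (ι (c ^ n))) ⟩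
      powℚ r n ℚ.* ι (c ^ n)                        ≡⟨ powℚ-inverse n ⟩
      ℚ.1ℚ                                          ∎
      where open ≡-Reasoning

    clear-term : ∀ n → n ℕ.≤ q → ι (Q n) ℚ.* powℚ r n ℚ.* ι (c ^ q) ≡ ι (Q n * c ^ (q ∸ n))
    clear-term n n≤q = begin
      ι (Q n) ℚ.* powℚ r n ℚ.* ι (c ^ q)
        ≡⟨ cong (λ z → ι (Q n) ℚ.* powℚ r n ℚ.* ι z) (trans (cong (c ^_) (sym (ℕ.m+[n∸m]≡n n≤q))) (ℤ.^-distribˡ-+-* c n (q ∸ n))) ⟩
      ι (Q n) ℚ.* powℚ r n ℚ.* ι (c ^ n * c ^ (q ∸ n))
        ≡⟨ cong (ι (Q n) ℚ.* powℚ r n ℚ.*_) (sym (ι-* (c ^ n) (c ^ (q ∸ n)))) ⟩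
      ι (Q n) ℚ.* powℚ r n ℚ.* (ι (c ^ n) ℚ.* ι (c ^ (q ∸ n)))
        ≡⟨ ℚ.*-assoc (ι (Q n)) (powℚ r n) _ ⟩
      ι (Q n) ℚ.* (powℚ r n ℚ.* (ι (c ^ n) ℚ.* ι (c ^ (q ∸ n))))
        ≡⟨ cong (ι (Q n) ℚ.*_) (sym (ℚ.*-assoc (powℚ r n) (ι (c ^ n)) (ι (c ^ (q ∸ n))))) ⟩
      ι (Q n) ℚ.* (powℚ r n ℚ.* ι (c ^ n) ℚ.* ι (c ^ (q ∸ n)))
        ≡⟨ cong (λ z → ι (Q n) ℚ.* (z ℚ.* ι (c ^ (q ∸ n)))) (powℚ-inverse n) ⟩
      ι (Q n) ℚ.* (ℚ.1ℚ ℚ.* ι (c ^ (q ∸ n)))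
        ≡⟨ cong (ι (Q n) ℚ.*_) (ℚ.*-identityˡ (ι (c ^ (q ∸ n)))) ⟩
      ι (Q n) ℚ.* ι (c ^ (q ∸ n))
        ≡⟨ ι-* (Q n) (c ^ (q ∸ n)) ⟩
      ι (Q n * c ^ (q ∸ n)) ∎
      where open ≡-Reasoning

    clear-sum : ∀ k → k ℕ.≤ q → weighted r k ℚ.* ι (c ^ q) ≡ ι (∑ (suc k) (λ n → Q n * c ^ (q ∸ n)))
    clear-sum zero    _   = trans (clear-term 0 z≤n) (cong ι (sym (ℤ.+-identityˡ (Q 0 * c ^ q))))
    clear-sum (suc k) k<q = trans (ℚ.*-distribʳ-+ (ι (c ^ q)) (weighted r k) _)
      (trans (cong₂ ℚ._+_ (clear-sum k (ℕ.<⇒≤ k<q)) (clear-term (suc k) k<q))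
      (ι-+ (∑ (suc k) (λ n → Q n * c ^ (q ∸ n))) (Q (suc k) * c ^ (q ∸ suc k))))

    -- Multiplication by `c ^ q` turns the sum into an integer and does not change its residue,
    -- because `c ^ q ≡ 1`. Each `r ^ n` becomes `c ^ (q - n)`, which is `x ^ n` modulo `p`.
    weighted-congruence : ∀ x → x * c ≈ 1ℤ → ∀ t → ∑ p (λ n → Q n * x ^ n) ≈ t → weighted r q ≡ ι t [modℚ p ]
    weighted-congruence x xc≈1 t sum≈t = numerator-divisible (weighted r q ℚ.- ι t) (c ^ q) (s - t * c ^ q)
      (λ e → 1≉0 (≈-trans (≈-sym (fermat₁ c≉0)) e)) difference≈0 cleared
      where
      open ≡-Reasoning
      s : ℤ
      s = ∑ p (λ n → Q n * c ^ (q ∸ n))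
      c≉0 : c ≉ 0ℤ
      c≉0 c≈0 = 1≉0 (≈-trans (≈-sym xc≈1) (≈-trans (*-congˡ x c≈0) (≡⇒≈ (ℤ.*-zeroʳ x))))
      s≈t : s ≈ t
      s≈t = ≈-trans (∑-cong≈ p (λ n n<p → *-congˡ (Q n) (inverse-power xc≈1 (ℕ.≤-pred n<p)))) sum≈t
      difference≈0 : s - t * c ^ q ≈ 0ℤ
      difference≈0 = ≈⇒-≈0 (≈-trans s≈t (≈-sym (≈-trans (*-congˡ t (fermat₁ c≉0)) (≡⇒≈ (ℤ.*-identityʳ t)))))
      cleared : (weighted r q ℚ.- ι t) ℚ.* ι (c ^ q) ≡ ι (s - t * c ^ q)
      cleared = begin
        (weighted r q ℚ.- ι t) ℚ.* ι (c ^ q)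
          ≡⟨ ℚ.*-distribʳ-+ (ι (c ^ q)) (weighted r q) (ℚ.- ι t) ⟩
        weighted r q ℚ.* ι (c ^ q) ℚ.+ (ℚ.- ι t) ℚ.* ι (c ^ q)
          ≡⟨ cong₂ ℚ._+_ (clear-sum q ℕ.≤-refl) (trans (cong (ℚ._* ι (c ^ q)) (ι-neg t)) (ι-* (- t) (c ^ q))) ⟩
        ι s ℚ.+ ι (- t * c ^ q)
          ≡⟨ trans (ι-+ s (- t * c ^ q)) (cong (λ z → ι (s + z)) (sym (ℤ.neg-distribˡ-* t (c ^ q)))) ⟩
        ι (s - t * c ^ q) ∎

-- From the Franel values to the two rational sums.

module Sums (q : ℕ) (p-prime : Prime (suc q)) (2<q : 2 ℕ.< q) where

  open PrimeModulus q p-prime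
  open Residues q p-prime using (inverse; inverseˡ)
  open FranelSums q p-prime
  open FranelValues q p-prime 2<q
  open RationalCongruence q p-prime

  2≉0 : + 2 ≉ 0ℤ
  2≉0 = small≉0 (ℕ.<-trans (ℕ.n<1+n 1) 2<q)

  neg-≉0 : ∀ {a} → a ≉ 0ℤ → - a ≉ 0ℤ
  neg-≉0 {a} a≉0 -a≈0 = a≉0 (≈-trans (≡⇒≈ (sym (ℤ.neg-involutive a))) (neg-cong -a≈0))

  -6≉0 : - + 6 ≉ 0ℤ
  -6≉0 = neg-≉0 (*-≉0 2≉0 3≉0)

  -12≉0 : - + 12 ≉ 0ℤ
  -12≉0 = neg-≉0 (*-≉0 2≉0 (*-≉0 2≉0 3≉0))

  -- At `x = -1/6` the number `1 + 8x` is -1/3, with inverse -3, and `t = -3x` is 1/2.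
  S6-congruence : ∀ z → (∀ t → + 2 * t ≈ 1ℤ → ∑ p (λ k → franel k * t ^ k) ≈ z) → S6 p ≡ ι z [modℚ p ]
  S6-congruence z value = weighted-congruence (- + 6) inv-6 refl x (inverseˡ -6≉0) z
    (≈-trans (Q-sum x (- + 3) (≈-trans (≡⇒≈ (rewrite₁ x)) (+-congˡ (- + 3) (*-congˡ (+ 4) (inverseˡ -6≉0)))))
      (value (- + 3 * x) (≈-trans (≡⇒≈ (rewrite₂ x)) (inverseˡ -6≉0))))
    where
    x : ℤ
    x = inverse (- + 6)
    rewrite₁ : ∀ x → - + 3 * (1ℤ + + 8 * x) ≡ - + 3 + + 4 * (x * - + 6)
    rewrite₁ = solve-∀
    rewrite₂ : ∀ x → + 2 * (- + 3 * x) ≡ x * - + 6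
    rewrite₂ = solve-∀

  -- At `x = -1/12` the number `1 + 8x` is 1/3, with inverse 3, and `t = 3x` is -1/4.
  S12-congruence : ∀ z → (∀ t → - + 4 * t ≈ 1ℤ → ∑ p (λ k → franel k * t ^ k) ≈ z) → S12 p ≡ ι z [modℚ p ]
  S12-congruence z value = weighted-congruence (- + 12) inv-12 refl x (inverseˡ -12≉0) z
    (≈-trans (Q-sum x (+ 3) (≈-trans (≡⇒≈ (rewrite₁ x)) (+-congˡ (+ 3) (*-congˡ (- + 2) (inverseˡ -12≉0)))))
      (value (+ 3 * x) (≈-trans (≡⇒≈ (rewrite₂ x)) (inverseˡ -12≉0))))
    where
    x : ℤ
    x = inverse (- + 12)
    rewrite₁ : ∀ x → + 3 * (1ℤ + + 8 * x) ≡ + 3 + - + 2 * (x * - + 12)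
    rewrite₁ = solve-∀
    rewrite₂ : ∀ x → - + 4 * (+ 3 * x) ≡ x * - + 12
    rewrite₂ = solve-∀

  -- Uniqueness leaves `3k - 1 = u` or `3k - 1 = -u`. The first contradicts `u ≡ 1` modulo 3, since
  -- 3 would divide 2.
  binom-value : ∀ m → triple (m ℕ.+ m) ≡ q → ∀ u v → + p ≡ u * u + + 3 * (v * v) → + 3 ∣ℤ (u - 1ℤ) →
    binom (m ℕ.+ (m ℕ.+ m)) m ≈ + 2 * u
  binom-value m 6m≡q u v uv 3∣u-1 = conclude (JacobiNorm.jacobi-representation q p-prime m 6m≡q)
    where
    double-neg : ∀ u → - (+ 2 * - u) ≡ + 2 * u
    double-neg = solve-∀
    isolate : ∀ k l → + 3 * (k - l) ≡ + 3 * k - 1ℤ - (l * + 3 + 1ℤ) + + 2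
    isolate = solve-∀
    cancel : ∀ u → u - (u - 1ℤ + 1ℤ) + + 2 ≡ + 2
    cancel = solve-∀
    3∤2 : ¬ (+ 3 ∣ₛ + 2)
    3∤2 3∣2 = ℕ.<⇒≱ (ℕ.n<1+n 2) (ℕ.∣⇒≤ (∣⇒∣ᵤ 3∣2))
    residue-class : ∀ k → + 3 ∣ₛ (u - 1ℤ) → + 3 * k - 1ℤ ≢ u
    residue-class k (divides l u-1≡3l) a≡u = 3∤2 (divides (k - l) (sym (trans (ℤ.*-comm (k - l) (+ 3))
      (trans (isolate k l) (trans (cong₂ (λ x y → x - (y + 1ℤ) + + 2) a≡u (sym u-1≡3l)) (cancel u))))))
    conclude : (∃ λ k → ∃ λ b → + p ≡ (+ 3 * k - 1ℤ) * (+ 3 * k - 1ℤ) + + 3 * (b * b)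
      × binom (m ℕ.+ (m ℕ.+ m)) m ≈ - (+ 2 * (+ 3 * k - 1ℤ))) → binom (m ℕ.+ (m ℕ.+ m)) m ≈ + 2 * u
    conclude (k , b , form , congruence) = ≈-trans congruence (≡⇒≈ (trans (cong (λ z → - (+ 2 * z)) a≡-u) (double-neg u)))
      where
      a≡-u : + 3 * k - 1ℤ ≡ - u
      a≡-u = Sum.[ (λ a≡u → ⊥-elim (residue-class k (∣ᵤ⇒∣ 3∣u-1) a≡u)) , (λ e → e) ]′
        (Uniqueness.unique-form q p-prime (+ 3 * k - 1ℤ) b u v form uv)

-- The residue of p modulo 6.

parity : ∀ j → (∃ λ m → j ≡ m ℕ.+ m) ⊎ (∃ λ m → j ≡ suc (m ℕ.+ m))
parity zero    = inj₁ (0 , refl)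
parity (suc j) = Sum.[ (λ { (m , e) → inj₂ (m , cong suc e) })
                     , (λ { (m , e) → inj₁ (suc m , trans (cong suc e) (cong suc (sym (ℕ.+-suc m m)))) }) ]′ (parity j)

prime-odd : ∀ {p} h → Prime p → p > 3 → p ≢ h ℕ.* 2
prime-odd h p-prime p>3 p≡2h = Sum.[ (λ ()) , (λ { refl → ℕ.<⇒≱ p>3 (s≤s (s≤s z≤n)) }) ]′
  (prime⇒irreducible p-prime (ℕ.divides h p≡2h))

-- Write `p = 3j + 1`. If `j` were odd, `p` would be even.
sixfold-split : ∀ q → Prime (suc q) → suc q > 3 → suc q % 3 ≡ 1 → ∃ λ m → triple (m ℕ.+ m) ≡ q
sixfold-split q p-prime p>3 p%3≡1 = Sum.[ even , odd ]′ (parity j)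
  where
  j = suc q ℕ./ 3
  decompose : suc q ≡ 1 ℕ.+ j ℕ.* 3
  decompose = trans (ℕ.m≡m%n+[m/n]*n (suc q) 3) (cong (ℕ._+ j ℕ.* 3) p%3≡1)
  rearrange : ∀ m → m ℕ.+ m ℕ.+ (m ℕ.+ m ℕ.+ (m ℕ.+ m)) ≡ (m ℕ.+ m) ℕ.* 3
  rearrange = ℕ-Solver.solve-∀
  halve : ∀ m → 1 ℕ.+ (1 ℕ.+ (m ℕ.+ m)) ℕ.* 3 ≡ (2 ℕ.+ m ℕ.* 3) ℕ.* 2
  halve = ℕ-Solver.solve-∀
  even : (∃ λ m → j ≡ m ℕ.+ m) → ∃ λ m → triple (m ℕ.+ m) ≡ q
  even (m , j≡2m) = m , trans (rearrange m) (sym (ℕ.suc-injective (trans decompose (cong (λ i → 1 ℕ.+ i ℕ.* 3) j≡2m))))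
  odd : (∃ λ m → j ≡ suc (m ℕ.+ m)) → ∃ λ m → triple (m ℕ.+ m) ≡ q
  odd (m , j≡2m+1) = ⊥-elim (prime-odd (2 ℕ.+ m ℕ.* 3) p-prime p>3
    (trans decompose (trans (cong (λ i → 1 ℕ.+ i ℕ.* 3) j≡2m+1) (halve m))))

-- Write `p = 3j + 2`. If `j` were even, `p` would be even.
sixfold-inert : ∀ q → Prime (suc q) → suc q > 3 → suc q % 3 ≡ 2 → ∃ λ m → suc (triple (suc (m ℕ.+ m))) ≡ q
sixfold-inert q p-prime p>3 p%3≡2 = Sum.[ even , odd ]′ (parity j)
  where
  j = suc q ℕ./ 3
  decompose : suc q ≡ 2 ℕ.+ j ℕ.* 3
  decompose = trans (ℕ.m≡m%n+[m/n]*n (suc q) 3) (cong (ℕ._+ j ℕ.* 3) p%3≡2)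
  rearrange : ∀ m → 1 ℕ.+ (1 ℕ.+ (m ℕ.+ m) ℕ.+ (1 ℕ.+ (m ℕ.+ m) ℕ.+ (1 ℕ.+ (m ℕ.+ m)))) ≡ 1 ℕ.+ (1 ℕ.+ (m ℕ.+ m)) ℕ.* 3
  rearrange = ℕ-Solver.solve-∀
  halve : ∀ m → 2 ℕ.+ (m ℕ.+ m) ℕ.* 3 ≡ (1 ℕ.+ m ℕ.* 3) ℕ.* 2
  halve = ℕ-Solver.solve-∀
  even : (∃ λ m → j ≡ m ℕ.+ m) → ∃ λ m → suc (triple (suc (m ℕ.+ m))) ≡ q
  even (m , j≡2m) = ⊥-elim (prime-odd (1 ℕ.+ m ℕ.* 3) p-prime p>3
    (trans decompose (trans (cong (λ i → 2 ℕ.+ i ℕ.* 3) j≡2m) (halve m))))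
  odd : (∃ λ m → j ≡ suc (m ℕ.+ m)) → ∃ λ m → suc (triple (suc (m ℕ.+ m))) ≡ q
  odd (m , j≡2m+1) = m , trans (rearrange m) (sym (ℕ.suc-injective (trans decompose (cong (λ i → 2 ℕ.+ i ℕ.* 3) j≡2m+1))))

theorem5p2 : (p : ℕ) → Prime p → p > 3 →
    ((p % 3 ≡ 1) → (u v : ℤ) → (+ p) ≡ u ℤ.* u ℤ.+ (+ 3) ℤ.* (v ℤ.* v) → (+ 3) ∣ℤ (u ℤ.- (+ 1)) →
    (S6 p ≡ (((+ 2) ℤ.* u) ℚ./ 1) [modℚ p ]) × (S12 p ≡ (((+ 2) ℤ.* u) ℚ./ 1) [modℚ p ]))
    × ((p % 3 ≡ 2) →
    (S6 p ≡ ℚ.0ℚ [modℚ p ]) × (S12 p ≡ ℚ.0ℚ [modℚ p ]))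
theorem5p2 zero    p-prime = ⊥-elim (¬prime[0] p-prime)
theorem5p2 (suc q) p-prime p>3 = split , inert
  where
  2<q : 2 ℕ.< q
  2<q = ℕ.≤-pred p>3
  open Sums q p-prime 2<q
  open PrimeModulus q p-prime using (≈-trans)
  open FranelValues q p-prime 2<q using (module Split; module Inert)
  split : suc q % 3 ≡ 1 → (u v : ℤ) → + suc q ≡ u * u + + 3 * (v * v) → + 3 ∣ℤ (u - + 1) →
    (S6 (suc q) ≡ ((+ 2 * u) ℚ./ 1) [modℚ suc q ]) × (S12 (suc q) ≡ ((+ 2 * u) ℚ./ 1) [modℚ suc q ])
  split p%3≡1 u v uv 3∣u-1 with m , 6m≡q ← sixfold-split q p-prime p>3 p%3≡1 =
    S6-congruence (+ 2 * u) (λ t 2t≈1 → ≈-trans (Split.half-split m 6m≡q t 2t≈1) (binom-value m 6m≡q u v uv 3∣u-1)) ,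
    S12-congruence (+ 2 * u) (λ t -4t≈1 → ≈-trans (Split.quarter-split m 6m≡q t -4t≈1) (binom-value m 6m≡q u v uv 3∣u-1))
  inert : suc q % 3 ≡ 2 → (S6 (suc q) ≡ ℚ.0ℚ [modℚ suc q ]) × (S12 (suc q) ≡ ℚ.0ℚ [modℚ suc q ])
  inert p%3≡2 with m , 6m+4≡q ← sixfold-inert q p-prime p>3 p%3≡2 =
    S6-congruence 0ℤ (Inert.half-inert m 6m+4≡q) , S12-congruence 0ℤ (Inert.quarter-inert m 6m+4≡q)
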